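{- For every $\varepsilon>0$ there exists a positive integer $q$ such that for every $k$ and every $2\le r\le k-q$, every $k$-uniform hypergraph with $m$ edges has an $r$-cut of surplus $\Omega(m^{2/3-\varepsilon})$ (the implicit constant depending on $k$ and $\varepsilon$).
   Context: An $r$-cut of a $k$-uniform hypergraph is a partition of its vertex set into $r$ parts; its size is the number of edges with at least one vertex in each part. The surplus of an $r$-cut in a $k$-uniform hypergraph with $m$ edges is its size minus $\frac{S(k,r)\,r!}{r^k}m$, with $S(k,r)$ the Stirling number of the second kind. -}

module Defs where

open import Data.Nat as ℕ using (ℕ; zero; suc; _!)
open import Data.Integer as ℤ using (ℤ; +_)
open import Data.Rational as ℚ using (ℚ; _/_; _≤_; _<_; ↥_; ↧ₙ_)
open import Data.Fin using (Fin)
open import Data.Fin.Properties using (all?; any?)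
open import Data.Fin.Subset using (Subset; _∈_; ∣_∣)
open import Data.Fin.Subset.Properties using (_∈?_)
open import Data.List using (List; length; filter)
open import Data.List.Relation.Unary.All using (All)
open import Data.List.Relation.Unary.Unique.Propositional using (Unique)
open import Data.Product using (Σ; _×_; ∃; ∃-syntax)
open import Relation.Nullary using (Dec)
open import Relation.Nullary.Decidable using (_×-dec_)
open import Relation.Binary.PropositionalEquality using (_≡_)
open import Data.Fin using (_≟_)

stirling2 : ℕ → ℕ → ℕ
stirling2 zero    zero    = 1
stirling2 zero    (suc k) = 0
stirling2 (suc n) zero    = 0
stirling2 (suc n) (suc k) = suc k ℕ.* stirling2 n (suc k) ℕ.+ stirling2 n k

record Hypergraph (k : ℕ) : Set where
  field
    n        : ℕ
    edges    : List (Subset n)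
    distinct : Unique edges
    uniform  : All (λ e → ∣ e ∣ ≡ k) edges
open Hypergraph public

numEdges : ∀ {k} → Hypergraph k → ℕ
numEdges H = length (edges H)

Cut : ∀ {k} → Hypergraph k → ℕ → Set
Cut H r = Fin (n H) → Fin r

IsCutEdge : ∀ {n r} → (Fin n → Fin r) → Subset n → Set
IsCutEdge {n} {r} f e = ∀ (j : Fin r) → ∃[ v ] (v ∈ e × f v ≡ j)

isCutEdge? : ∀ {n r} (f : Fin n → Fin r) (e : Subset n) → Dec (IsCutEdge f e)
isCutEdge? f e = all? (λ j → any? (λ v → (v ∈? e) ×-dec (f v ≟ j)))

cutSize : ∀ {k r} (H : Hypergraph k) → Cut H r → ℕ
cutSize H f = length (filter (isCutEdge? f) (edges H))

-- a / d as a rational; only used with d > 0 (d = r ^ k, r ≥ 2)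
frac : ℕ → ℕ → ℚ
frac a zero    = ℚ.0ℚ
frac a (suc d) = (+ a) / suc d

surplus : ∀ {k r} (H : Hypergraph k) → Cut H r → ℚ
surplus {k} {r} H f =
  (+ cutSize H f / 1) ℚ.- frac (stirling2 k r ℕ.* (r !) ℕ.* numEdges H) (r ℕ.^ k)

_^ℚ_ : ℚ → ℕ → ℚ
x ^ℚ zero  = ℚ.1ℚ
x ^ℚ suc e = x ℚ.* (x ^ℚ e)

-- "s ≥ c · m ^ (2/3 − ε)" for ε = a/b in lowest terms (a = |num ε|,
-- b = den ε), c > 0, m ≥ 1.  Stated without real exponents: for s ≥ 0 it is
-- equivalent to s^(3b) · m^(3a) ≥ c^(3b) · m^(2b).
AtLeastPow : (s c ε : ℚ) (m : ℕ) → Set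
AtLeastPow s c ε m =
  ℚ.0ℚ ≤ s ×
  (c ^ℚ (3 ℕ.* b)) ℚ.* (M ^ℚ (2 ℕ.* b)) ≤ (s ^ℚ (3 ℕ.* b)) ℚ.* (M ^ℚ (3 ℕ.* a))
  where
    a = ℤ.∣ ↥ ε ∣
    b = ↧ₙ ε
    M = (+ m) / 1

{-# OPTIONS --safe #-}

-- Give the vertex v either of the first two colours with probability (1 ± y_v)/r and every other colour with
-- probability 1/r. By inclusion-exclusion the expected size of the cut exceeds the average by −2 F(y)/r^k, where
-- F(y) = Σ_e Σ_{S ⊆ e} c_|S| y^S over nonempty even S, with c_s ≥ 0 and c_s ≥ 1 for s ≤ k − r + 2. Hence −2 F(y) ≤ σ
-- on the cube, σ/r^k being the largest surplus.
--
-- For a family P of even sets take y_v = (z_v − λ L_v(z))/2 with z uniform on {±1}^V and L_v the sum of the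
-- characters of t ∖ v over v ∈ t ∈ P. The part of E[−F(y)] linear in λ counts the edges that contain a member of P,
-- the other odd parts are nonnegative, and the even parts count representations of sets as sums of members of P.
-- For pairs lying in a matching or in a clique, of maximum degree Δ, this shows that only O(Δσ) edges contain such
-- a pair, so that vertices of large degree and pairs of large codegree can be discarded.
--
-- Let ε = a/b and m ≈ B^{3b}. What remains of an edge contains a set t of bounded size that is spread out: at most 2B
-- times as many edges contain a given quarter of t as contain t (otherwise continue with that quarter, at most 3b
-- times). If P consists of the spread-out sets of one of these scales and λ ≈ B^{−b−2}, then the representation
-- counts are small enough to give σ ≥ c λ m ≥ c B^{2b−2}.
--
-- Everything below is multiplied by powers of M = 2Λ, where Λ = 1/λ, so that it takes place in the integers.
module Submission where

open import Defs renaming (n to order)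
open import Data.Nat using (ℕ; zero; suc; _+_; _*_; _∸_; _^_; _≤_; z≤n; s≤s; _≤?_; _≤ᵇ_; _!; >-nonZero) renaming (_<_ to _<ᴺ_)
open import Data.Nat.Properties hiding (_≟_)
open import Data.Rational as ℚ using (ℚ; 0ℚ; _<_)
import Data.Rational.Properties as ℚP
import Data.Rational.Unnormalised as ℚᵘ
import Data.Rational.Unnormalised.Properties as ℚᵘP
open import Data.Product using (Σ; _×_; ∃; ∃-syntax; _,_; proj₁; proj₂)
open import Data.Sum using (_⊎_; inj₁; inj₂)
open import Data.Empty using (⊥-elim) renaming (⊥ to Absurd)
open import Data.Unit using (tt) renaming (⊤ to Unit)
open import Data.Bool using (Bool; true; false; if_then_else_; _∧_; _∨_; _xor_; not) renaming (T to IsTrue)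
open import Data.Integer as ℤ using (ℤ; +_; -[1+_]; 0ℤ; 1ℤ; -1ℤ)
import Data.Integer.Properties as ℤP
open import Data.Fin using (Fin; zero; suc; _≟_)
open import Data.Fin.Subset using (Subset; ∣_∣; _∪_; _∩_; ⁅_⁆; ⊥)
import Data.Fin.Subset.Properties as SubP
open import Data.Vec using (Vec; []; _∷_; lookup; zipWith; replicate)
import Data.Vec as Vec
import Data.Vec.Properties as VecP
open import Data.Vec.Properties using (lookup-zipWith; lookup-replicate)
open import Data.List using (List; []; _∷_; _++_; map; length; filter; allFin; upTo)
import Data.List as List
import Data.List.Properties as ListP
open import Data.List.Properties using (length-map; length-++; map-∘)
open import Data.List.Membership.Propositional using (_∈_)
open import Data.List.Membership.Propositional.Properties using (∈-map⁺; ∈-map⁻; ∈-++⁺ˡ; ∈-++⁺ʳ; ∈-++⁻; ∈-allFin; ∈-cartesianProduct⁺; ∈-upTo⁺; ∈-upTo⁻)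
open import Data.List.Relation.Unary.Any using (here; there)
open import Data.List.Relation.Unary.All as All using (All; []; _∷_)
open import Data.List.Relation.Unary.AllPairs using ([]; _∷_)
open import Data.List.Relation.Unary.Unique.Propositional using (Unique)
import Data.List.Relation.Unary.Unique.Propositional.Properties as UniqueP
open import Function using (_∘_; id; case_of_)
open import Relation.Nullary using (Dec; yes; no; ¬_; does; contradiction)
open import Relation.Binary.PropositionalEquality using (_≡_; _≢_; refl; sym; trans; cong; cong₂; subst; module ≡-Reasoning)
import Data.Nat.Tactic.RingSolver as ℕR
import Data.Integer.Tactic.RingSolver as ℤR

-- The exponent 2/3 comes from balancing `λ` against degrees. Representations by `2h + 2` spread-out
-- sets cost about `Δ^h` choices, `Δ` being the largest degree in the family, so `λ` must be at most
-- `Δ^(-1/2)`, and the linear term gives surplus about `λ m`. If the conclusion fails, `σ` is at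
-- most a small multiple of `m^(2/3)`. Only `O(m^(1/3))` vertices have degree above `m^(2/3)`, and
-- the bound for cliques leaves `O(m^(1/3) σ)` edges with two of them, a minority. So `Δ` can be
-- `m^(2/3)` and `λ` about `m^(-1/3)`. The obstacle is that even terms must be smaller than `λ`,
-- while halving the number of free members only bounds them by `(λ² Δ)^(h+1)`, about 1. A member
-- that shares a quarter with no other one is determined by the rest, which saves a factor `Δ`. All
-- other tuples contain two members sharing a quarter; these are averaged over the edges at the
-- price of the largest codegree, whence a codegree threshold `B^(b-1)`, slightly below `m^(1/3)`.
-- The result `B^(2b-2)` is about `m^(2/3 - 2/(3b))`, which is enough because `ε ≥ 1/b`.

private variable
  A A′ : Set
  n : ℕ

-- Finite sums over lists, and indicators

∑ : List A → (A → ℕ) → ℕ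
∑ []       f = 0
∑ (x ∷ xs) f = f x + ∑ xs f

∑-mono∈ : (xs : List A) {f g : A → ℕ} → (∀ x → x ∈ xs → f x ≤ g x) → ∑ xs f ≤ ∑ xs g
∑-mono∈ []       h = z≤n
∑-mono∈ (x ∷ xs) h = +-mono-≤ (h x (here refl)) (∑-mono∈ xs (λ y y∈ → h y (there y∈)))

∑-mono : (xs : List A) {f g : A → ℕ} → (∀ x → f x ≤ g x) → ∑ xs f ≤ ∑ xs g
∑-mono xs h = ∑-mono∈ xs (λ x _ → h x)

∑-cong : (xs : List A) {f g : A → ℕ} → (∀ x → f x ≡ g x) → ∑ xs f ≡ ∑ xs g
∑-cong []       h = refl
∑-cong (x ∷ xs) h = cong₂ _+_ (h x) (∑-cong xs h)

*-swapˡ : ∀ a b c → a * (b * c) ≡ b * (a * c)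
*-swapˡ = ℕR.solve-∀

+-interchange : ∀ a b c d → (a + b) + (c + d) ≡ (a + c) + (b + d)
+-interchange = ℕR.solve-∀

∑-+ : (xs : List A) (f g : A → ℕ) → ∑ xs (λ x → f x + g x) ≡ ∑ xs f + ∑ xs g
∑-+ []       f g = refl
∑-+ (x ∷ xs) f g = trans (cong (λ w → (f x + g x) + w) (∑-+ xs f g)) (+-interchange (f x) (g x) _ _)

∑-*ˡ : (xs : List A) (c : ℕ) (f : A → ℕ) → ∑ xs (λ x → c * f x) ≡ c * ∑ xs f
∑-*ˡ []       c f = sym (*-zeroʳ c)
∑-*ˡ (x ∷ xs) c f = trans (cong (λ w → c * f x + w) (∑-*ˡ xs c f)) (sym (*-distribˡ-+ c (f x) _))

∑-*ʳ : (xs : List A) (c : ℕ) (f : A → ℕ) → ∑ xs (λ x → f x * c) ≡ ∑ xs f * c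
∑-*ʳ xs c f = trans (∑-cong xs (λ x → *-comm (f x) c)) (trans (∑-*ˡ xs c f) (*-comm c _))

∑-const : (xs : List A) (c : ℕ) → ∑ xs (λ _ → c) ≡ length xs * c
∑-const []       c = refl
∑-const (x ∷ xs) c = cong (λ w → c + w) (∑-const xs c)

∑-bound : (xs : List A) {f : A → ℕ} (c : ℕ) → (∀ x → x ∈ xs → f x ≤ c) → ∑ xs f ≤ length xs * c
∑-bound xs c h = ≤-trans (∑-mono∈ xs h) (≤-reflexive (∑-const xs c))

∑-0 : (xs : List A) {f : A → ℕ} → (∀ x → x ∈ xs → f x ≡ 0) → ∑ xs f ≡ 0
∑-0 []       h = refl
∑-0 (x ∷ xs) h = cong₂ _+_ (h x (here refl)) (∑-0 xs (λ y y∈ → h y (there y∈)))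

∑-swap : (xs : List A) (ys : List A′) (f : A → A′ → ℕ) →
  ∑ xs (λ x → ∑ ys (f x)) ≡ ∑ ys (λ y → ∑ xs (λ x → f x y))
∑-swap []       ys f = sym (∑-0 ys (λ _ _ → refl))
∑-swap (x ∷ xs) ys f = trans (cong (λ w → ∑ ys (f x) + w) (∑-swap xs ys f)) (sym (∑-+ ys (f x) _))

∑-++ : (xs ys : List A) (f : A → ℕ) → ∑ (xs ++ ys) f ≡ ∑ xs f + ∑ ys f
∑-++ []       ys f = refl
∑-++ (x ∷ xs) ys f = trans (cong (λ w → f x + w) (∑-++ xs ys f)) (sym (+-assoc (f x) _ _))

∑-map : (g : A → A′) (xs : List A) (f : A′ → ℕ) → ∑ (map g xs) f ≡ ∑ xs (f ∘ g)
∑-map g []       f = refl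
∑-map g (x ∷ xs) f = cong (λ w → f (g x) + w) (∑-map g xs f)

∑-≥ : {xs : List A} {x : A} (f : A → ℕ) → x ∈ xs → f x ≤ ∑ xs f
∑-≥ f (here refl) = m≤m+n _ _
∑-≥ f (there {x = y} x∈) = ≤-trans (∑-≥ f x∈) (m≤n+m _ (f y))

∑-≢0 : (xs : List A) (f : A → ℕ) → ∑ xs f ≢ 0 → ∃[ x ] (x ∈ xs × f x ≢ 0)
∑-≢0 []       f h = contradiction refl h
∑-≢0 (x ∷ xs) f h with f x in eq
... | suc _ = x , here refl , λ e → contradiction (trans (sym eq) e) λ ()
... | zero with ∑-≢0 xs f h
...   | y , y∈ , fy = y , there y∈ , fy

∑ᶻ : List A → (A → ℤ) → ℤ
∑ᶻ []       f = 0ℤ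
∑ᶻ (x ∷ xs) f = f x ℤ.+ ∑ᶻ xs f

∑ᶻ-cong∈ : (xs : List A) {f g : A → ℤ} → (∀ x → x ∈ xs → f x ≡ g x) → ∑ᶻ xs f ≡ ∑ᶻ xs g
∑ᶻ-cong∈ []       h = refl
∑ᶻ-cong∈ (x ∷ xs) h = cong₂ ℤ._+_ (h x (here refl)) (∑ᶻ-cong∈ xs (λ y y∈ → h y (there y∈)))

∑ᶻ-cong : (xs : List A) {f g : A → ℤ} → (∀ x → f x ≡ g x) → ∑ᶻ xs f ≡ ∑ᶻ xs g
∑ᶻ-cong xs h = ∑ᶻ-cong∈ xs (λ x _ → h x)

∑ᶻ-mono∈ : (xs : List A) {f g : A → ℤ} → (∀ x → x ∈ xs → f x ℤ.≤ g x) → ∑ᶻ xs f ℤ.≤ ∑ᶻ xs g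
∑ᶻ-mono∈ []       h = ℤP.≤-refl
∑ᶻ-mono∈ (x ∷ xs) h = ℤP.+-mono-≤ (h x (here refl)) (∑ᶻ-mono∈ xs (λ y y∈ → h y (there y∈)))

∑ᶻ-mono : (xs : List A) {f g : A → ℤ} → (∀ x → f x ℤ.≤ g x) → ∑ᶻ xs f ℤ.≤ ∑ᶻ xs g
∑ᶻ-mono xs h = ∑ᶻ-mono∈ xs (λ x _ → h x)

*ᶻ-swapˡ : ∀ a b c → a ℤ.* (b ℤ.* c) ≡ b ℤ.* (a ℤ.* c)
*ᶻ-swapˡ = ℤR.solve-∀

+ᶻ-interchange : ∀ a b c d → (a ℤ.+ b) ℤ.+ (c ℤ.+ d) ≡ (a ℤ.+ c) ℤ.+ (b ℤ.+ d)
+ᶻ-interchange = ℤR.solve-∀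

∑ᶻ-+ : (xs : List A) (f g : A → ℤ) → ∑ᶻ xs (λ x → f x ℤ.+ g x) ≡ ∑ᶻ xs f ℤ.+ ∑ᶻ xs g
∑ᶻ-+ []       f g = refl
∑ᶻ-+ (x ∷ xs) f g = trans (cong (λ w → f x ℤ.+ g x ℤ.+ w) (∑ᶻ-+ xs f g)) (+ᶻ-interchange (f x) (g x) _ _)

∑ᶻ-*ˡ : (xs : List A) (c : ℤ) (f : A → ℤ) → ∑ᶻ xs (λ x → c ℤ.* f x) ≡ c ℤ.* ∑ᶻ xs f
∑ᶻ-*ˡ []       c f = sym (ℤP.*-zeroʳ c)
∑ᶻ-*ˡ (x ∷ xs) c f = trans (cong (λ w → c ℤ.* f x ℤ.+ w) (∑ᶻ-*ˡ xs c f)) (sym (ℤP.*-distribˡ-+ c (f x) _))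

∑ᶻ-*ʳ : (xs : List A) (c : ℤ) (f : A → ℤ) → ∑ᶻ xs (λ x → f x ℤ.* c) ≡ ∑ᶻ xs f ℤ.* c
∑ᶻ-*ʳ xs c f = trans (∑ᶻ-cong xs (λ x → ℤP.*-comm (f x) c)) (trans (∑ᶻ-*ˡ xs c f) (ℤP.*-comm c _))

∑ᶻ-0 : (xs : List A) {f : A → ℤ} → (∀ x → x ∈ xs → f x ≡ 0ℤ) → ∑ᶻ xs f ≡ 0ℤ
∑ᶻ-0 []       h = refl
∑ᶻ-0 (x ∷ xs) h = cong₂ ℤ._+_ (h x (here refl)) (∑ᶻ-0 xs (λ y y∈ → h y (there y∈)))

∑ᶻ-swap : (xs : List A) (ys : List A′) (f : A → A′ → ℤ) →
  ∑ᶻ xs (λ x → ∑ᶻ ys (f x)) ≡ ∑ᶻ ys (λ y → ∑ᶻ xs (λ x → f x y))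
∑ᶻ-swap []       ys f = sym (∑ᶻ-0 ys (λ _ _ → refl))
∑ᶻ-swap (x ∷ xs) ys f = trans (cong (λ w → ∑ᶻ ys (f x) ℤ.+ w) (∑ᶻ-swap xs ys f)) (sym (∑ᶻ-+ ys (f x) _))

∑ᶻ-++ : (xs ys : List A) (f : A → ℤ) → ∑ᶻ (xs ++ ys) f ≡ ∑ᶻ xs f ℤ.+ ∑ᶻ ys f
∑ᶻ-++ []       ys f = sym (ℤP.+-identityˡ _)
∑ᶻ-++ (x ∷ xs) ys f = trans (cong (λ w → f x ℤ.+ w) (∑ᶻ-++ xs ys f)) (sym (ℤP.+-assoc (f x) _ _))

∑ᶻ-map : (g : A → A′) (xs : List A) (f : A′ → ℤ) → ∑ᶻ (map g xs) f ≡ ∑ᶻ xs (f ∘ g)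
∑ᶻ-map g []       f = refl
∑ᶻ-map g (x ∷ xs) f = cong (λ w → f (g x) ℤ.+ w) (∑ᶻ-map g xs f)

∑ᶻ-+∑ : (xs : List A) (f : A → ℕ) → ∑ᶻ xs (λ x → + f x) ≡ + ∑ xs f
∑ᶻ-+∑ []       f = refl
∑ᶻ-+∑ (x ∷ xs) f = cong (λ w → + f x ℤ.+ w) (∑ᶻ-+∑ xs f)

𝟙 : Bool → ℕ
𝟙 true  = 1
𝟙 false = 0

𝟙≤1 : ∀ b → 𝟙 b ≤ 1
𝟙≤1 true  = s≤s z≤n
𝟙≤1 false = z≤n

𝟙-≢0 : ∀ {b} → 𝟙 b ≢ 0 → b ≡ true
𝟙-≢0 {true}  _ = refl
𝟙-≢0 {false} h = contradiction refl h

𝟙≡1 : ∀ {b} → b ≡ true → 1 ≤ 𝟙 b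
𝟙≡1 refl = s≤s z≤n

𝟙-mono : ∀ {a b} → (a ≡ true → b ≡ true) → 𝟙 a ≤ 𝟙 b
𝟙-mono {true}  h = 𝟙≡1 (h refl)
𝟙-mono {false} h = z≤n

*≢0ˡ : ∀ a {b} → a * b ≢ 0 → a ≢ 0
*≢0ˡ zero h = λ _ → h refl
*≢0ˡ (suc a) h = λ ()

*≢0ʳ : ∀ a {b} → a * b ≢ 0 → b ≢ 0
*≢0ʳ a h refl = h (*-zeroʳ a)

≤ᵇ-true : ∀ {a b} → a ≤ b → (a ≤ᵇ b) ≡ true
≤ᵇ-true {a} {b} h with a ≤ᵇ b | ≤⇒≤ᵇ h
... | true | _ = refl

true-≤ᵇ : ∀ a b → (a ≤ᵇ b) ≡ true → a ≤ b
true-≤ᵇ a b h = ≤ᵇ⇒≤ a b (subst IsTrue (sym h) tt)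

-- Subsets as vectors over the field with two elements

_⊕_ : Subset n → Subset n → Subset n
_⊕_ = zipWith _xor_

infixl 7 _⊕_

_∋_ : Subset n → Fin n → Set
s ∋ x = lookup s x ≡ true

infix 4 _∋_

_⊆′_ : Subset n → Subset n → Set
s ⊆′ t = ∀ x → s ∋ x → t ∋ x

infix 4 _⊆′_

xor-comm : ∀ a b → a xor b ≡ b xor a
xor-comm true  true  = refl
xor-comm true  false = refl
xor-comm false true  = refl
xor-comm false false = refl

xor-assoc : ∀ a b c → (a xor b) xor c ≡ a xor (b xor c)
xor-assoc true  true  true  = refl
xor-assoc true  true  false = refl
xor-assoc true  false c     = refl
xor-assoc false b     c     = refl

xor-self : ∀ a → a xor a ≡ false
xor-self true  = refl
xor-self false = refl

⊕-comm : (s t : Subset n) → s ⊕ t ≡ t ⊕ s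
⊕-comm []      []      = refl
⊕-comm (a ∷ s) (b ∷ t) = cong₂ _∷_ (xor-comm a b) (⊕-comm s t)

⊕-assoc : (s t u : Subset n) → (s ⊕ t) ⊕ u ≡ s ⊕ (t ⊕ u)
⊕-assoc []      []      []      = refl
⊕-assoc (a ∷ s) (b ∷ t) (c ∷ u) = cong₂ _∷_ (xor-assoc a b c) (⊕-assoc s t u)

⊕-identityˡ : (s : Subset n) → ⊥ ⊕ s ≡ s
⊕-identityˡ []      = refl
⊕-identityˡ (a ∷ s) = cong (a ∷_) (⊕-identityˡ s)

⊕-self : (s : Subset n) → s ⊕ s ≡ ⊥
⊕-self []      = refl
⊕-self (a ∷ s) = cong₂ _∷_ (xor-self a) (⊕-self s)

⊕-swapʳ : (s t u : Subset n) → s ⊕ t ⊕ u ≡ s ⊕ u ⊕ t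
⊕-swapʳ s t u = trans (⊕-assoc s t u) (trans (cong (s ⊕_) (⊕-comm t u)) (sym (⊕-assoc s u t)))

lookup-⊕ : (s t : Subset n) (x : Fin n) → lookup (s ⊕ t) x ≡ lookup s x xor lookup t x
lookup-⊕ s t x = lookup-zipWith _xor_ x s t

lookup-⁅⁆ : (x : Fin n) → ⁅ x ⁆ ∋ x
lookup-⁅⁆ zero    = refl
lookup-⁅⁆ (suc x) = lookup-⁅⁆ x

∋-⁅⁆ : (x y : Fin n) → ⁅ x ⁆ ∋ y → x ≡ y
∋-⁅⁆ zero    zero    h = refl
∋-⁅⁆ zero    (suc y) h = contradiction (trans (sym (lookup-replicate y false)) h) λ ()
∋-⁅⁆ (suc x) (suc y) h = cong suc (∋-⁅⁆ x y h)

∋-∪ˡ : (s t : Subset n) → s ⊆′ (s ∪ t)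
∋-∪ˡ s t x h rewrite lookup-zipWith _∨_ x s t | h = refl

∋-∪ʳ : (s t : Subset n) → t ⊆′ (s ∪ t)
∋-∪ʳ s t x h rewrite lookup-zipWith _∨_ x s t | h with lookup s x
... | true  = refl
... | false = refl

∋-∩⁻ : (s t : Subset n) (x : Fin n) → s ∩ t ∋ x → (s ∋ x) × (t ∋ x)
∋-∩⁻ s t x h rewrite lookup-zipWith _∧_ x s t with lookup s x
... | true = refl , h

∋-⊥ : (x : Fin n) {Z : Set} → ⊥ ∋ x → Z
∋-⊥ x h = contradiction (trans (sym (lookup-replicate x false)) h) λ ()

∋-⊕⁻ : (s t : Subset n) (x : Fin n) → s ⊕ t ∋ x → (s ∋ x) ⊎ (t ∋ x)
∋-⊕⁻ s t x h rewrite lookup-⊕ s t x with lookup s x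
... | true  = inj₁ refl
... | false = inj₂ h

empty : Subset n → Bool
empty []      = true
empty (b ∷ s) = not b ∧ empty s

empty-⊥ : ∀ n → empty (⊥ {n}) ≡ true
empty-⊥ zero    = refl
empty-⊥ (suc n) = empty-⊥ n

empty-≡⊥ : (s : Subset n) → empty s ≡ true → s ≡ ⊥
empty-≡⊥ []          h = refl
empty-≡⊥ (false ∷ s) h = cong (false ∷_) (empty-≡⊥ s h)

empty-⊕ : (s t : Subset n) → empty (s ⊕ t) ≡ true → s ≡ t
empty-⊕ []          []          h = refl
empty-⊕ (true ∷ s)  (true ∷ t)  h = cong (true ∷_) (empty-⊕ s t h)
empty-⊕ (false ∷ s) (false ∷ t) h = cong (false ∷_) (empty-⊕ s t h)

allS : ∀ n → List (Subset n)
allS zero    = [] ∷ []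
allS (suc n) = map (false ∷_) (allS n) ++ map (true ∷_) (allS n)

∈-allS : (s : Subset n) → s ∈ allS n
∈-allS []          = here refl
∈-allS (false ∷ s) = ∈-++⁺ˡ (∈-map⁺ (false ∷_) (∈-allS s))
∈-allS {suc n} (true ∷ s) = ∈-++⁺ʳ (map (false ∷_) (allS n)) (∈-map⁺ (true ∷_) (∈-allS s))

∑-allS : (f : Subset (suc n) → ℕ) →
  ∑ (allS (suc n)) f ≡ ∑ (allS n) (f ∘ (false ∷_)) + ∑ (allS n) (f ∘ (true ∷_))
∑-allS {n} f = trans (∑-++ (map (false ∷_) (allS n)) _ f)
  (cong₂ _+_ (∑-map (false ∷_) (allS n) f) (∑-map (true ∷_) (allS n) f))

∑ᶻ-allS : (f : Subset (suc n) → ℤ) →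
  ∑ᶻ (allS (suc n)) f ≡ ∑ᶻ (allS n) (f ∘ (false ∷_)) ℤ.+ ∑ᶻ (allS n) (f ∘ (true ∷_))
∑ᶻ-allS {n} f = trans (∑ᶻ-++ (map (false ∷_) (allS n)) _ f)
  (cong₂ ℤ._+_ (∑ᶻ-map (false ∷_) (allS n) f) (∑ᶻ-map (true ∷_) (allS n) f))

-- Only `t = s` contributes. This is what makes one member of a vanishing tuple determined by the
-- others.
∑-empty-⊕ : (s : Subset n) → ∑ (allS n) (λ t → 𝟙 (empty (s ⊕ t))) ≡ 1
∑-empty-⊕ []          = refl
∑-empty-⊕ {suc n} (true ∷ s)  = trans (∑-allS {n} (λ t → 𝟙 (empty ((true ∷ s) ⊕ t))))
  (cong₂ _+_ (∑-0 (allS n) (λ _ _ → refl)) (∑-empty-⊕ s))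
∑-empty-⊕ {suc n} (false ∷ s) = trans (∑-allS {n} (λ t → 𝟙 (empty ((false ∷ s) ⊕ t))))
  (trans (cong₂ _+_ (∑-empty-⊕ s) (∑-0 (allS n) (λ _ _ → refl))) refl)

_⊆ᵇ_ : Subset n → Subset n → Bool
[]      ⊆ᵇ []      = true
(a ∷ s) ⊆ᵇ (b ∷ t) = (not a ∨ b) ∧ (s ⊆ᵇ t)

⊆ᵇ-sound : (s t : Subset n) → (s ⊆ᵇ t) ≡ true → s ⊆′ t
⊆ᵇ-sound (a ∷ s) (true ∷ t) h zero    e = refl
⊆ᵇ-sound (true ∷ s) (false ∷ t) () zero e
⊆ᵇ-sound (true ∷ s)  (true ∷ t)  h (suc x) e = ⊆ᵇ-sound s t h x e
⊆ᵇ-sound (false ∷ s) (b ∷ t)     h (suc x) e = ⊆ᵇ-sound s t h x e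

⊆ᵇ-complete : (s t : Subset n) → s ⊆′ t → (s ⊆ᵇ t) ≡ true
⊆ᵇ-complete []          []      h = refl
⊆ᵇ-complete (true ∷ s)  (b ∷ t) h rewrite h zero refl = ⊆ᵇ-complete s t (λ x → h (suc x))
⊆ᵇ-complete (false ∷ s) (b ∷ t) h = ⊆ᵇ-complete s t (λ x → h (suc x))

#subsets : (e : Subset n) → ∑ (allS n) (λ t → 𝟙 (t ⊆ᵇ e)) ≡ 2 ^ ∣ e ∣
#subsets []         = refl
#subsets {suc n} (true ∷ e) = trans (∑-allS {n} (λ t → 𝟙 (t ⊆ᵇ (true ∷ e))))
  (trans (cong₂ _+_ (#subsets e) (#subsets e)) (cong (λ w → 2 ^ ∣ e ∣ + w) (sym (+-identityʳ _))))
#subsets {suc n} (false ∷ e) = trans (∑-allS {n} (λ t → 𝟙 (t ⊆ᵇ (false ∷ e))))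
  (trans (cong₂ _+_ (#subsets e) (∑-0 (allS n) (λ _ _ → refl))) (+-identityʳ _))

∣∣-mono : (s t : Subset n) → s ⊆′ t → ∣ s ∣ ≤ ∣ t ∣
∣∣-mono []          []          h = z≤n
∣∣-mono (true ∷ s)  (b ∷ t)     h rewrite h zero refl = s≤s (∣∣-mono s t (λ x → h (suc x)))
∣∣-mono (false ∷ s) (true ∷ t)  h = m≤n⇒m≤1+n (∣∣-mono s t (λ x → h (suc x)))
∣∣-mono (false ∷ s) (false ∷ t) h = ∣∣-mono s t (λ x → h (suc x))

∣∪∣≤ : (s t : Subset n) → ∣ s ∪ t ∣ ≤ ∣ s ∣ + ∣ t ∣
∣∪∣≤ []          []          = z≤n
∣∪∣≤ (true ∷ s)  (true ∷ t)  = s≤s (≤-trans (∣∪∣≤ s t) (+-monoʳ-≤ ∣ s ∣ (n≤1+n _)))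
∣∪∣≤ (true ∷ s)  (false ∷ t) = s≤s (∣∪∣≤ s t)
∣∪∣≤ (false ∷ s) (true ∷ t)  = ≤-trans (s≤s (∣∪∣≤ s t)) (≤-reflexive (sym (+-suc ∣ s ∣ ∣ t ∣)))
∣∪∣≤ (false ∷ s) (false ∷ t) = ∣∪∣≤ s t

-- In the tuple count the three sets are what has been read, a set held aside and what is still to
-- come; a large `t` must meet one of them in a third of its points.
∣∣-cover₃ : (t a b c : Subset n) → (∀ x → t ∋ x → (a ∋ x) ⊎ (b ∋ x) ⊎ (c ∋ x)) →
  ∣ t ∣ ≤ ∣ t ∩ a ∣ + (∣ t ∩ b ∣ + ∣ t ∩ c ∣)
∣∣-cover₃ t a b c h = begin
  ∣ t ∣ ≤⟨ ∣∣-mono t ((t ∩ a) ∪ ((t ∩ b) ∪ (t ∩ c))) cover ⟩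
  ∣ (t ∩ a) ∪ ((t ∩ b) ∪ (t ∩ c)) ∣ ≤⟨ ∣∪∣≤ (t ∩ a) _ ⟩
  ∣ t ∩ a ∣ + ∣ (t ∩ b) ∪ (t ∩ c) ∣ ≤⟨ +-monoʳ-≤ ∣ t ∩ a ∣ (∣∪∣≤ (t ∩ b) (t ∩ c)) ⟩
  ∣ t ∩ a ∣ + (∣ t ∩ b ∣ + ∣ t ∩ c ∣) ∎
  where
  open ≤-Reasoning
  both : ∀ u x → t ∋ x → u ∋ x → t ∩ u ∋ x
  both u x p q rewrite lookup-zipWith _∧_ x t u | p = q
  cover : t ⊆′ ((t ∩ a) ∪ ((t ∩ b) ∪ (t ∩ c)))
  cover x p with h x p
  ... | inj₁ q = ∋-∪ˡ (t ∩ a) _ x (both a x p q)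
  ... | inj₂ (inj₁ q) = ∋-∪ʳ (t ∩ a) _ x (∋-∪ˡ (t ∩ b) _ x (both b x p q))
  ... | inj₂ (inj₂ q) = ∋-∪ʳ (t ∩ a) _ x (∋-∪ʳ (t ∩ b) (t ∩ c) x (both c x p q))

*-^ : ∀ x y a → (x * y) ^ a ≡ x ^ a * y ^ a
*-^ x y zero    = refl
*-^ x y (suc a) = trans (cong (λ w → x * y * w) (*-^ x y a)) (interchange x y (x ^ a) (y ^ a))
  where
  interchange : ∀ a b c d → a * b * (c * d) ≡ (a * c) * (b * d)
  interchange = ℕR.solve-∀

-- Fourier analysis on the cube

sg : Bool → ℤ → ℤ
sg true  x = ℤ.- x
sg false x = x

-- The Walsh character of `s` at the point of the cube that is -1 exactly on `z`.
χ : Subset n → Subset n → ℤ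
χ []      []      = 1ℤ
χ (a ∷ s) (b ∷ z) = sg (a ∧ b) (χ s z)

χ-⊕ : (s t z : Subset n) → χ (s ⊕ t) z ≡ χ s z ℤ.* χ t z
χ-⊕ []          []          []          = refl
χ-⊕ (true ∷ s)  (true ∷ t)  (true ∷ z)  = trans (χ-⊕ s t z) (neg-neg (χ s z) (χ t z))
  where
  neg-neg : ∀ a b → a ℤ.* b ≡ (ℤ.- a) ℤ.* (ℤ.- b)
  neg-neg = ℤR.solve-∀
χ-⊕ (true ∷ s)  (false ∷ t) (true ∷ z)  = trans (cong ℤ.-_ (χ-⊕ s t z)) (ℤP.neg-distribˡ-* (χ s z) (χ t z))
χ-⊕ (false ∷ s) (true ∷ t)  (true ∷ z)  = trans (cong ℤ.-_ (χ-⊕ s t z)) (ℤP.neg-distribʳ-* (χ s z) (χ t z))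
χ-⊕ (false ∷ s) (false ∷ t) (true ∷ z)  = χ-⊕ s t z
χ-⊕ (true ∷ s)  (true ∷ t)  (false ∷ z) = χ-⊕ s t z
χ-⊕ (true ∷ s)  (false ∷ t) (false ∷ z) = χ-⊕ s t z
χ-⊕ (false ∷ s) (true ∷ t)  (false ∷ z) = χ-⊕ s t z
χ-⊕ (false ∷ s) (false ∷ t) (false ∷ z) = χ-⊕ s t z

χ-⊥ : (z : Subset n) → χ ⊥ z ≡ 1ℤ
χ-⊥ []      = refl
χ-⊥ (b ∷ z) = χ-⊥ z

∣χ∣≡1 : (s z : Subset n) → ℤ.∣ χ s z ∣ ≡ 1
∣χ∣≡1 []      []      = refl
∣χ∣≡1 (a ∷ s) (b ∷ z) with a ∧ b
... | true  = trans (ℤP.∣-i∣≡∣i∣ (χ s z)) (∣χ∣≡1 s z)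
... | false = ∣χ∣≡1 s z

∑χ : (s : Subset n) → ∑ᶻ (allS n) (χ s) ≡ + (2 ^ n * 𝟙 (empty s))
∑χ []         = refl
∑χ {suc n} (a ∷ s) = trans (∑ᶻ-allS {n} (χ (a ∷ s))) (halves a)
  where
  m+0 : ∀ x → x ℤ.+ (ℤ.- 1ℤ) ℤ.* x ≡ 0ℤ
  m+0 = ℤR.solve-∀
  dbl : ∀ x y → x * y + x * y ≡ (2 * x) * y
  dbl = ℕR.solve-∀
  halves : ∀ a → ∑ᶻ (allS n) (λ z → sg (a ∧ false) (χ s z)) ℤ.+ ∑ᶻ (allS n) (λ z → sg (a ∧ true) (χ s z))
    ≡ + (2 ^ suc n * 𝟙 (empty (a ∷ s)))
  halves true  = trans (cong (λ w → ∑ᶻ (allS n) (χ s) ℤ.+ w)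
      (trans (∑ᶻ-cong (allS n) (λ z → sym (ℤP.-1*i≡-i (χ s z)))) (∑ᶻ-*ˡ (allS n) -1ℤ (χ s))))
    (trans (m+0 (∑ᶻ (allS n) (χ s))) (cong +_ (sym (*-zeroʳ (2 ^ suc n)))))
  halves false = trans (cong₂ ℤ._+_ (∑χ s) (∑χ s)) (cong +_ (dbl (2 ^ n) (𝟙 (empty s))))

-- All ordered bipartitions, with the order kept inside each half. For a list without repetition the
-- first half runs once over every subset.
splits : List A → List (List A × List A)
splits []       = ([] , []) ∷ []
splits (x ∷ xs) = map (λ p → x ∷ proj₁ p , proj₂ p) (splits xs) ++ map (λ p → proj₁ p , x ∷ proj₂ p) (splits xs)

∑ᶻ-splits : (x : A) (xs : List A) (f : List A × List A → ℤ) → ∑ᶻ (splits (x ∷ xs)) f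
  ≡ ∑ᶻ (splits xs) (λ p → f (x ∷ proj₁ p , proj₂ p)) ℤ.+ ∑ᶻ (splits xs) (λ p → f (proj₁ p , x ∷ proj₂ p))
∑ᶻ-splits x xs f = trans (∑ᶻ-++ (map (λ p → x ∷ proj₁ p , proj₂ p) (splits xs)) _ f)
  (cong₂ ℤ._+_ (∑ᶻ-map _ (splits xs) f) (∑ᶻ-map _ (splits xs) f))

prod : (A → ℤ) → List A → ℤ
prod a []       = 1ℤ
prod a (x ∷ xs) = a x ℤ.* prod a xs

prod-splits : (a b : A → ℤ) (S : List A) →
  prod (λ v → a v ℤ.+ b v) S ≡ ∑ᶻ (splits S) (λ p → prod a (proj₁ p) ℤ.* prod b (proj₂ p))
prod-splits a b []      = refl
prod-splits a b (v ∷ S) = sym (begin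
  ∑ᶻ (splits (v ∷ S)) f ≡⟨ ∑ᶻ-splits v S f ⟩
  ∑ᶻ (splits S) (λ p → a v ℤ.* prod a (proj₁ p) ℤ.* prod b (proj₂ p)) ℤ.+ ∑ᶻ (splits S) (λ p → prod a (proj₁ p) ℤ.* (b v ℤ.* prod b (proj₂ p)))
    ≡⟨ cong₂ ℤ._+_ (trans (∑ᶻ-cong (splits S) (λ p → ℤP.*-assoc (a v) _ _)) (∑ᶻ-*ˡ (splits S) (a v) f))
                    (trans (∑ᶻ-cong (splits S) (λ p → comm₃ (prod a (proj₁ p)) (b v) _)) (∑ᶻ-*ˡ (splits S) (b v) f)) ⟩
  a v ℤ.* ∑ᶻ (splits S) f ℤ.+ b v ℤ.* ∑ᶻ (splits S) f ≡⟨ sym (ℤP.*-distribʳ-+ (∑ᶻ (splits S) f) (a v) (b v)) ⟩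
  (a v ℤ.+ b v) ℤ.* ∑ᶻ (splits S) f ≡⟨ cong (λ w → (a v ℤ.+ b v) ℤ.* w) (sym (prod-splits a b S)) ⟩
  (a v ℤ.+ b v) ℤ.* prod (λ w → a w ℤ.+ b w) S ∎)
  where
  open ≡-Reasoning
  f : List _ × List _ → ℤ
  f p = prod a (proj₁ p) ℤ.* prod b (proj₂ p)
  comm₃ : ∀ x y z → x ℤ.* (y ℤ.* z) ≡ y ℤ.* (x ℤ.* z)
  comm₃ = ℤR.solve-∀

-- A sum modulo 2, so repeated entries cancel, exactly as they do in a product of characters.
set : List (Fin n) → Subset n
set []      = ⊥
set (v ∷ W) = ⁅ v ⁆ ⊕ set W

prod-χ : (Λ : ℕ) (W : List (Fin n)) (z : Subset n) →
  prod (λ v → + Λ ℤ.* χ ⁅ v ⁆ z) W ≡ + (Λ ^ length W) ℤ.* χ (set W) z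
prod-χ Λ []      z = sym (trans (ℤP.*-identityˡ _) (χ-⊥ z))
prod-χ Λ (v ∷ W) z = trans (cong (λ w → + Λ ℤ.* χ ⁅ v ⁆ z ℤ.* w) (prod-χ Λ W z))
  (trans (rearr (+ Λ) (χ ⁅ v ⁆ z) (+ (Λ ^ length W)) (χ (set W) z))
    (cong₂ ℤ._*_ (sym (ℤP.pos-* Λ (Λ ^ length W))) (sym (χ-⊕ ⁅ v ⁆ (set W) z))))
  where
  rearr : ∀ a b c d → a ℤ.* b ℤ.* (c ℤ.* d) ≡ (a ℤ.* c) ℤ.* (b ℤ.* d)
  rearr = ℤR.solve-∀

-- Expectation of the cut polynomial at a perturbed random point

isEven : List A → Bool
isEven []      = true
isEven (_ ∷ U) = not (isEven U)

isSingle : List A → Bool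
isSingle (_ ∷ []) = true
isSingle _        = false

prod-neg : (a : A → ℤ) (U : List A) → prod (λ u → ℤ.- a u) U ≡ sg (not (isEven U)) (prod a U)
prod-neg a []      = refl
prod-neg a (u ∷ U) with isEven U | prod-neg a U
... | true  | h = trans (cong (λ w → ℤ.- a u ℤ.* w) h) (sym (ℤP.neg-distribˡ-* (a u) (prod a U)))
... | false | h = trans (cong (λ w → ℤ.- a u ℤ.* w) h) (neg-neg (a u) (prod a U))
  where
  neg-neg : ∀ x y → (ℤ.- x) ℤ.* (ℤ.- y) ≡ x ℤ.* y
  neg-neg = ℤR.solve-∀

-- `M^k F(Y / M)` for edges of size `k`: each vertex left out of `S` contributes a factor `M`, which
-- makes the polynomial homogeneous.
cutPoly : (cf : ℕ → ℕ) (es : List (List (Fin n))) (M : ℕ) (Y : Fin n → ℤ) → ℤ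
cutPoly cf es M Y = ∑ᶻ es λ e → ∑ᶻ (splits e) λ p →
  + (cf (length (proj₁ p)) * M ^ length (proj₂ p)) ℤ.* prod Y (proj₁ p)

-- `wt a u` says whether the member `a` contains `u`, and `at a u` is that member without `u`. The
-- indices are abstract because there are two instances: families of sets, and graphs, where an edge
-- at `u` is indexed by its other end.
module Chaos {A : Set} {n : ℕ} (P : List A) (wt : A → Fin n → ℕ) (at : A → Fin n → Subset n) where

  L : Fin n → Subset n → ℤ
  L u z = ∑ᶻ P (λ a → + wt a u ℤ.* χ (at a u) z)

  -- The number of ways to write R as a sum of one member at each u ∈ us.
  N : List (Fin n) → Subset n → ℕ
  N []       R = 𝟙 (empty R)
  N (u ∷ us) R = ∑ P (λ a → wt a u * N us (R ⊕ at a u))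

  -- Multiplying by a term of `L u` translates `R` by `at a u`; only the trivial character has
  -- nonzero mean, so the mean counts the choices whose total vanishes.
  ∑-χ-prod : (us : List (Fin n)) (R : Subset n) →
    ∑ᶻ (allS n) (λ z → χ R z ℤ.* prod (λ u → L u z) us) ≡ + (2 ^ n * N us R)
  ∑-χ-prod []       R = trans (∑ᶻ-cong (allS n) (λ z → ℤP.*-identityʳ (χ R z))) (∑χ R)
  ∑-χ-prod (u ∷ us) R = begin
    ∑ᶻ (allS n) (λ z → χ R z ℤ.* (L u z ℤ.* Π z))
      ≡⟨ ∑ᶻ-cong (allS n) (λ z → trans (rearr (χ R z) (L u z) (Π z)) (sym (∑ᶻ-*ʳ P (χ R z ℤ.* Π z) _))) ⟩
    ∑ᶻ (allS n) (λ z → ∑ᶻ P (λ a → + wt a u ℤ.* χ (at a u) z ℤ.* (χ R z ℤ.* Π z)))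
      ≡⟨ ∑ᶻ-swap (allS n) P _ ⟩
    ∑ᶻ P (λ a → ∑ᶻ (allS n) (λ z → + wt a u ℤ.* χ (at a u) z ℤ.* (χ R z ℤ.* Π z)))
      ≡⟨ ∑ᶻ-cong P (λ a → trans (∑ᶻ-cong (allS n) (λ z → trans (rearr₂ (+ wt a u) (χ (at a u) z) (χ R z) (Π z))
            (cong (λ w → + wt a u ℤ.* (w ℤ.* Π z)) (sym (χ-⊕ R (at a u) z))))) (∑ᶻ-*ˡ (allS n) (+ wt a u) _)) ⟩
    ∑ᶻ P (λ a → + wt a u ℤ.* ∑ᶻ (allS n) (λ z → χ (R ⊕ at a u) z ℤ.* Π z))
      ≡⟨ ∑ᶻ-cong P (λ a → trans (cong (λ w → + wt a u ℤ.* w) (∑-χ-prod us (R ⊕ at a u)))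
            (trans (sym (ℤP.pos-* (wt a u) _)) (cong +_ (rearr₃ (wt a u) (2 ^ n) _)))) ⟩
    ∑ᶻ P (λ a → + (2 ^ n * (wt a u * N us (R ⊕ at a u)))) ≡⟨ ∑ᶻ-+∑ P _ ⟩
    + ∑ P (λ a → 2 ^ n * (wt a u * N us (R ⊕ at a u))) ≡⟨ cong +_ (∑-*ˡ P (2 ^ n) _) ⟩
    + (2 ^ n * N (u ∷ us) R) ∎
    where
    open ≡-Reasoning
    Π : Subset n → ℤ
    Π z = prod (λ v → L v z) us
    rearr : ∀ a b c → a ℤ.* (b ℤ.* c) ≡ b ℤ.* (a ℤ.* c)
    rearr = ℤR.solve-∀
    rearr₂ : ∀ a b c d → a ℤ.* b ℤ.* (c ℤ.* d) ≡ a ℤ.* ((c ℤ.* b) ℤ.* d)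
    rearr₂ = ℤR.solve-∀
    rearr₃ : ∀ a b c → a * (b * c) ≡ b * (a * c)
    rearr₃ = ℕR.solve-∀

  module _ (Λ : ℕ) where

    -- `2Λ` times the point `y` of the overview, with `λ = 1/Λ`.
    point : Subset n → Fin n → ℤ
    point z v = ℤ.- L v z ℤ.+ + Λ ℤ.* χ ⁅ v ⁆ z

    repr : List (Fin n) × List (Fin n) → ℕ
    repr p = Λ ^ length (proj₂ p) * N (proj₁ p) (set (proj₂ p))

    ∑-prod-point : (S : List (Fin n)) → ∑ᶻ (allS n) (λ z → prod (point z) S)
      ≡ ∑ᶻ (splits S) (λ p → sg (not (isEven (proj₁ p))) (+ (2 ^ n * repr p)))
    ∑-prod-point S = begin
      ∑ᶻ (allS n) (λ z → prod (point z) S)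
        ≡⟨ ∑ᶻ-cong (allS n) (λ z → trans (prod-splits (λ v → ℤ.- L v z) (λ v → + Λ ℤ.* χ ⁅ v ⁆ z) S)
             (∑ᶻ-cong (splits S) (λ p → trans (cong₂ ℤ._*_ (prod-neg (λ u → L u z) (proj₁ p)) (prod-χ Λ (proj₂ p) z))
               (sg-* (not (isEven (proj₁ p))) (prod (λ u → L u z) (proj₁ p)) (+ (Λ ^ length (proj₂ p))) (χ (set (proj₂ p)) z))))) ⟩
      ∑ᶻ (allS n) (λ z → ∑ᶻ (splits S) (λ p → + (Λ ^ length (proj₂ p)) ℤ.* sg (not (isEven (proj₁ p))) (χ (set (proj₂ p)) z ℤ.* prod (λ u → L u z) (proj₁ p))))
        ≡⟨ ∑ᶻ-swap (allS n) (splits S) _ ⟩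
      ∑ᶻ (splits S) (λ p → ∑ᶻ (allS n) (λ z → + (Λ ^ length (proj₂ p)) ℤ.* sg (not (isEven (proj₁ p))) (χ (set (proj₂ p)) z ℤ.* prod (λ u → L u z) (proj₁ p))))
        ≡⟨ ∑ᶻ-cong (splits S) (λ p → trans (∑ᶻ-*ˡ (allS n) (+ (Λ ^ length (proj₂ p))) (λ z → sg (not (isEven (proj₁ p))) (χ (set (proj₂ p)) z ℤ.* prod (λ u → L u z) (proj₁ p)))) (trans (cong (λ w → + (Λ ^ length (proj₂ p)) ℤ.* w)
             (trans (∑-sg (not (isEven (proj₁ p))) (allS n) _) (cong (sg (not (isEven (proj₁ p)))) (∑-χ-prod (proj₁ p) (set (proj₂ p))))))
             (fin (not (isEven (proj₁ p))) (Λ ^ length (proj₂ p)) (2 ^ n) _))) ⟩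
      ∑ᶻ (splits S) (λ p → sg (not (isEven (proj₁ p))) (+ (2 ^ n * repr p))) ∎
      where
      open ≡-Reasoning
      sg-* : ∀ b x y w → sg b x ℤ.* (y ℤ.* w) ≡ y ℤ.* sg b (w ℤ.* x)
      sg-* true  = neg
        where
        neg : ∀ x y w → (ℤ.- x) ℤ.* (y ℤ.* w) ≡ y ℤ.* (ℤ.- (w ℤ.* x))
        neg = ℤR.solve-∀
      sg-* false = pos
        where
        pos : ∀ x y w → x ℤ.* (y ℤ.* w) ≡ y ℤ.* (w ℤ.* x)
        pos = ℤR.solve-∀
      ∑-sg : ∀ {C : Set} b (xs : List C) f → ∑ᶻ xs (λ x → sg b (f x)) ≡ sg b (∑ᶻ xs f)
      ∑-sg true  xs f = trans (∑ᶻ-cong xs (λ x → sym (ℤP.-1*i≡-i (f x)))) (trans (∑ᶻ-*ˡ xs -1ℤ f) (ℤP.-1*i≡-i _))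
      ∑-sg false xs f = refl
      fin : ∀ b l t x → + l ℤ.* sg b (+ (t * x)) ≡ sg b (+ (t * (l * x)))
      fin false l t x = trans (sym (ℤP.pos-* l (t * x))) (cong +_ (*-swapˡ l t x))
      fin true  l t x = trans (sym (ℤP.neg-distribʳ-* (+ l) (+ (t * x)))) (cong ℤ.-_ (fin false l t x))

    singles evens : List (Fin n) → ℕ
    singles S = ∑ (splits S) (λ p → 𝟙 (isSingle (proj₁ p)) * repr p)
    evens   S = ∑ (splits S) (λ p → 𝟙 (isEven (proj₁ p)) * repr p)

    -- Odd terms of the expansion are negative; keep the linear ones and discard the rest.
    ∑-prod-point-≤ : (S : List (Fin n)) →
      ∑ᶻ (allS n) (λ z → prod (point z) S) ℤ.+ + (2 ^ n * singles S) ℤ.≤ + (2 ^ n * evens S)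
    ∑-prod-point-≤ S = begin
      ∑ᶻ (allS n) (λ z → prod (point z) S) ℤ.+ + (2 ^ n * singles S)
        ≡⟨ cong₂ ℤ._+_ (∑-prod-point S) (sym (trans (∑ᶻ-+∑ (splits S) _) (cong +_ (∑-*ˡ (splits S) (2 ^ n) _)))) ⟩
      ∑ᶻ (splits S) (λ p → sg (not (isEven (proj₁ p))) (+ (2 ^ n * repr p))) ℤ.+ ∑ᶻ (splits S) (λ p → + (2 ^ n * (𝟙 (isSingle (proj₁ p)) * repr p)))
        ≡⟨ sym (∑ᶻ-+ (splits S) _ _) ⟩
      ∑ᶻ (splits S) (λ p → sg (not (isEven (proj₁ p))) (+ (2 ^ n * repr p)) ℤ.+ + (2 ^ n * (𝟙 (isSingle (proj₁ p)) * repr p)))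
        ≤⟨ ∑ᶻ-mono (splits S) (λ p → term (proj₁ p) (repr p)) ⟩
      ∑ᶻ (splits S) (λ p → + (2 ^ n * (𝟙 (isEven (proj₁ p)) * repr p)))
        ≡⟨ trans (∑ᶻ-+∑ (splits S) _) (cong +_ (∑-*ˡ (splits S) (2 ^ n) _)) ⟩
      + (2 ^ n * evens S) ∎
      where
      open ℤP.≤-Reasoning
      odd : ∀ b x → ℤ.- (+ (2 ^ n * x)) ℤ.+ + (2 ^ n * (𝟙 b * x)) ℤ.≤ 0ℤ
      odd true  x rewrite +-identityʳ x = ℤP.≤-reflexive (ℤP.+-inverseˡ (+ (2 ^ n * x)))
      odd false x rewrite *-zeroʳ (2 ^ n) = ℤP.≤-trans (ℤP.≤-reflexive (ℤP.+-identityʳ _)) (ℤP.neg-≤-pos {2 ^ n * x} {0})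
      term : ∀ U x → sg (not (isEven U)) (+ (2 ^ n * x)) ℤ.+ + (2 ^ n * (𝟙 (isSingle U) * x)) ℤ.≤ + (2 ^ n * (𝟙 (isEven U) * x))
      term [] x rewrite +-identityʳ x | *-zeroʳ (2 ^ n) = ℤP.≤-reflexive (ℤP.+-identityʳ _)
      term (u ∷ []) x rewrite *-zeroʳ (2 ^ n) = odd true x
      term (u ∷ v ∷ U) x with isEven U
      ... | false rewrite *-zeroʳ (2 ^ n) = ℤP.≤-trans (ℤP.≤-reflexive (ℤP.+-identityʳ _)) (ℤP.neg-≤-pos {2 ^ n * x} {0})
      ... | true rewrite +-identityʳ x | *-zeroʳ (2 ^ n) = ℤP.≤-reflexive (ℤP.+-identityʳ _)

    module _ (cf : ℕ → ℕ) (es : List (List (Fin n))) (M : ℕ) where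

      gain loss : ℕ
      gain = ∑ es λ e → ∑ (splits e) λ p → cf (length (proj₁ p)) * M ^ length (proj₂ p) * singles (proj₁ p)
      loss = ∑ es λ e → ∑ (splits e) λ p → cf (length (proj₁ p)) * M ^ length (proj₂ p) * evens (proj₁ p)

      ∑-cutPoly : ∑ᶻ (allS n) (λ z → cutPoly cf es M (point z)) ≡
        ∑ᶻ es λ e → ∑ᶻ (splits e) λ p → + (cf (length (proj₁ p)) * M ^ length (proj₂ p)) ℤ.* ∑ᶻ (allS n) (λ z → prod (point z) (proj₁ p))
      ∑-cutPoly = trans (∑ᶻ-swap (allS n) es _) (∑ᶻ-cong es (λ e →
        trans (∑ᶻ-swap (allS n) (splits e) _) (∑ᶻ-cong (splits e) (λ p → ∑ᶻ-*ˡ (allS n) (+ (cf (length (proj₁ p)) * M ^ length (proj₂ p))) (λ z → prod (point z) (proj₁ p))))))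

      pull : (g : List (Fin n) → ℕ) →
        ∑ᶻ es (λ e → ∑ᶻ (splits e) λ p → + (cf (length (proj₁ p)) * M ^ length (proj₂ p)) ℤ.* + (2 ^ n * g (proj₁ p)))
        ≡ + (2 ^ n * ∑ es λ e → ∑ (splits e) λ p → cf (length (proj₁ p)) * M ^ length (proj₂ p) * g (proj₁ p))
      pull g = trans (∑ᶻ-cong es (λ e → trans (∑ᶻ-cong (splits e) (λ p → trans (sym (ℤP.pos-* (c p) (2 ^ n * g (proj₁ p))))
          (cong +_ (*-swapˡ (c p) (2 ^ n) (g (proj₁ p))))))
          (trans (∑ᶻ-+∑ (splits e) _) (cong +_ (∑-*ˡ (splits e) (2 ^ n) _)))))
        (trans (∑ᶻ-+∑ es _) (cong +_ (∑-*ˡ es (2 ^ n) _)))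
        where
        c : List (Fin n) × List (Fin n) → ℕ
        c p = cf (length (proj₁ p)) * M ^ length (proj₂ p)

      ∑-cutPoly-≤ : ∑ᶻ (allS n) (λ z → cutPoly cf es M (point z)) ℤ.+ + (2 ^ n * gain) ℤ.≤ + (2 ^ n * loss)
      ∑-cutPoly-≤ = begin
        ∑ᶻ (allS n) (λ z → cutPoly cf es M (point z)) ℤ.+ + (2 ^ n * gain)
          ≡⟨ cong₂ ℤ._+_ ∑-cutPoly (sym (pull singles)) ⟩
        ∑ᶻ es f ℤ.+ ∑ᶻ es g ≡⟨ sym (trans (∑ᶻ-cong es (λ e → ∑ᶻ-+ (splits e) _ _)) (∑ᶻ-+ es f g)) ⟩
        ∑ᶻ es (λ e → ∑ᶻ (splits e) λ p → c p ℤ.* X p ℤ.+ c p ℤ.* + (2 ^ n * singles (proj₁ p)))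
          ≤⟨ ∑ᶻ-mono es (λ e → ∑ᶻ-mono (splits e) (λ p → ℤP.≤-trans
               (ℤP.≤-reflexive (sym (ℤP.*-distribˡ-+ (c p) (X p) _)))
               (ℤP.*-monoˡ-≤-nonNeg (c p) (∑-prod-point-≤ (proj₁ p))))) ⟩
        ∑ᶻ es (λ e → ∑ᶻ (splits e) λ p → c p ℤ.* + (2 ^ n * evens (proj₁ p))) ≡⟨ pull evens ⟩
        + (2 ^ n * loss) ∎
        where
        open ℤP.≤-Reasoning
        c X : List (Fin n) × List (Fin n) → ℤ
        c p = + (cf (length (proj₁ p)) * M ^ length (proj₂ p))
        X p = ∑ᶻ (allS n) (λ z → prod (point z) (proj₁ p))
        f g : List (Fin n) → ℤ
        f e = ∑ᶻ (splits e) λ p → c p ℤ.* X p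
        g e = ∑ᶻ (splits e) λ p → c p ℤ.* + (2 ^ n * singles (proj₁ p))

      -- Averaging `hyp` over the cube. The error `E` is for those `z` at which the point leaves the
      -- cube and the cut bound says nothing; the factor `a` allows the error to be measured against
      -- a high moment of `L`.
      gain-≤ : (a K Ē : ℕ) (E : Subset n → ℕ) →
        (∀ z → ℤ.- (+ (2 * a) ℤ.* cutPoly cf es M (point z)) ℤ.≤ + (a * K + E z)) →
        ∑ (allS n) E ≤ 2 ^ n * Ē → 2 * a * gain ≤ a * K + Ē + 2 * a * loss
      gain-≤ a K Ē E hyp hE = *-cancelˡ-≤ (2 ^ n) {{>-nonZero (m^n>0 2 n)}} (ℤP.drop‿+≤+ (begin
        + (2 ^ n * (2 * a * gain)) ≡⟨ trans (cong +_ (*-swapˡ (2 ^ n) (2 * a) gain)) (ℤP.pos-* (2 * a) (2 ^ n * gain)) ⟩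
        2a ℤ.* + (2 ^ n * gain) ≡⟨ addsub 2a X (+ (2 ^ n * gain)) ⟩
        ℤ.- (2a ℤ.* X) ℤ.+ 2a ℤ.* (X ℤ.+ + (2 ^ n * gain))
          ≤⟨ ℤP.+-mono-≤ negX (ℤP.*-monoˡ-≤-nonNeg 2a ∑-cutPoly-≤) ⟩
        + (2 ^ n * (a * K + Ē)) ℤ.+ 2a ℤ.* + (2 ^ n * loss)
          ≡⟨ trans (cong (λ w → + (2 ^ n * (a * K + Ē)) ℤ.+ w) (sym (ℤP.pos-* (2 * a) (2 ^ n * loss))))
               (cong +_ (fin (2 ^ n) (a * K + Ē) (2 * a) loss)) ⟩
        + (2 ^ n * (a * K + Ē + 2 * a * loss)) ∎))
        where
        open ℤP.≤-Reasoning
        2a X : ℤ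
        2a = + (2 * a)
        X = ∑ᶻ (allS n) (λ z → cutPoly cf es M (point z))
        fin : ∀ t x a l → t * x + a * (t * l) ≡ t * (x + a * l)
        fin = ℕR.solve-∀
        addsub : ∀ a x g → a ℤ.* g ≡ ℤ.- (a ℤ.* x) ℤ.+ a ℤ.* (x ℤ.+ g)
        addsub = ℤR.solve-∀
        negX : ℤ.- (2a ℤ.* X) ℤ.≤ + (2 ^ n * (a * K + Ē))
        negX = begin
          ℤ.- (2a ℤ.* X) ≡⟨ trans (ℤP.neg-distribˡ-* 2a X) (sym (∑ᶻ-*ˡ (allS n) (ℤ.- 2a) _)) ⟩
          ∑ᶻ (allS n) (λ z → ℤ.- 2a ℤ.* cutPoly cf es M (point z))
            ≤⟨ ∑ᶻ-mono (allS n) (λ z → ℤP.≤-trans (ℤP.≤-reflexive (sym (ℤP.neg-distribˡ-* 2a _))) (hyp z)) ⟩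
          ∑ᶻ (allS n) (λ z → + (a * K + E z)) ≡⟨ ∑ᶻ-+∑ (allS n) _ ⟩
          + ∑ (allS n) (λ z → a * K + E z) ≡⟨ cong +_ (trans (∑-+ (allS n) _ E) (cong (λ w → w + ∑ (allS n) E) (trans (∑-const (allS n) (a * K)) (cong (λ w → w * (a * K)) (#allS n))))) ⟩
          + (2 ^ n * (a * K) + ∑ (allS n) E) ≤⟨ ℤ.+≤+ (+-monoʳ-≤ (2 ^ n * (a * K)) hE) ⟩
          + (2 ^ n * (a * K) + 2 ^ n * Ē) ≡⟨ cong +_ (sym (*-distribˡ-+ (2 ^ n) (a * K) Ē)) ⟩
          + (2 ^ n * (a * K + Ē)) ∎
          where
          #allS : ∀ n → length (allS n) ≡ 2 ^ n
          #allS zero = refl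
          #allS (suc n) = trans (length-++ (map (false ∷_) (allS n)))
            (cong₂ _+_ (trans (length-map _ (allS n)) (#allS n)) (trans (trans (length-map _ (allS n)) (#allS n)) (sym (+-identityʳ _))))

-- Subsets as lists of their elements, and their splits

els : Subset n → List (Fin n)
els []          = []
els (true ∷ s)  = zero ∷ map suc (els s)
els (false ∷ s) = map suc (els s)

∈-els⁺ : (s : Subset n) (x : Fin n) → s ∋ x → x ∈ els s
∈-els⁺ (true ∷ s)  zero    h = here refl
∈-els⁺ (true ∷ s)  (suc x) h = there (∈-map⁺ suc (∈-els⁺ s x h))
∈-els⁺ (false ∷ s) (suc x) h = ∈-map⁺ suc (∈-els⁺ s x h)

∈-els⁻ : (s : Subset n) (x : Fin n) → x ∈ els s → s ∋ x
∈-els⁻ (true ∷ s)  .zero (here refl) = refl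
∈-els⁻ (true ∷ s)  x (there h) with ∈-map⁻ suc h
... | y , y∈ , refl = ∈-els⁻ s y y∈
∈-els⁻ (false ∷ s) x h with ∈-map⁻ suc h
... | y , y∈ , refl = ∈-els⁻ s y y∈

length-els : (s : Subset n) → length (els s) ≡ ∣ s ∣
length-els []          = refl
length-els (true ∷ s)  = cong suc (trans (length-map suc (els s)) (length-els s))
length-els (false ∷ s) = trans (length-map suc (els s)) (length-els s)

Unique-els : (s : Subset n) → Unique (els s)
Unique-els []          = []
Unique-els (true ∷ s)  = All.tabulate (λ x∈ → λ { refl → case ∈-map⁻ suc x∈ of λ { (_ , _ , ()) } })
  ∷ UniqueP.map⁺ (λ { refl → refl }) (Unique-els s)
Unique-els (false ∷ s) = UniqueP.map⁺ (λ { refl → refl }) (Unique-els s)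

set-suc : (W : List (Fin n)) → set (map suc W) ≡ false ∷ set W
set-suc []      = refl
set-suc (v ∷ W) = cong ((false ∷ ⁅ v ⁆) ⊕_) (set-suc W)

set-els : (s : Subset n) → set (els s) ≡ s
set-els []          = refl
set-els (true ∷ s)  = trans (cong ((true ∷ ⊥) ⊕_) (set-suc (els s))) (cong (true ∷_) (trans (⊕-identityˡ _) (set-els s)))
set-els (false ∷ s) = trans (set-suc (els s)) (cong (false ∷_) (set-els s))

set-∈ : (W : List (Fin n)) (x : Fin n) → set W ∋ x → x ∈ W
set-∈ []      x h = ∋-⊥ x h
set-∈ (v ∷ W) x h with ∋-⊕⁻ ⁅ v ⁆ (set W) x h
... | inj₁ p = here (sym (∋-⁅⁆ v x p))
... | inj₂ p = there (set-∈ W x p)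

lookup-set : (W : List (Fin n)) (x : Fin n) → ¬ (x ∈ W) → lookup (set W) x ≡ false
lookup-set W x h with lookup (set W) x in eq
... | false = refl
... | true  = contradiction (set-∈ W x eq) h

empty-∋ : (s : Subset n) (x : Fin n) → s ∋ x → empty s ≡ false
empty-∋ s x h with empty s in eq
... | false = refl
... | true  = ∋-⊥ x (subst (_∋ x) (empty-≡⊥ s eq) h)

empty-set : (v : Fin n) (S : List (Fin n)) → Unique (v ∷ S) → empty (set (v ∷ S)) ≡ false
empty-set v S (v∉ ∷ _) = empty-∋ (⁅ v ⁆ ⊕ set S) v (trans (lookup-⊕ ⁅ v ⁆ (set S) v)
  (cong₂ _xor_ (lookup-⁅⁆ v) (lookup-set S v (λ v∈ → All.lookup v∉ v∈ refl))))

length-splits : (S : List A) → length (splits S) ≡ 2 ^ length S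
length-splits []      = refl
length-splits (x ∷ S) = trans (length-++ (map _ (splits S)))
  (cong₂ _+_ (trans (length-map _ (splits S)) (length-splits S))
    (trans (trans (length-map _ (splits S)) (length-splits S)) (sym (+-identityʳ _))))

splits-∷⁻ : {x : A} (S : List A) {p : List A × List A} → p ∈ splits (x ∷ S) →
  (∃[ q ] (q ∈ splits S × p ≡ (x ∷ proj₁ q , proj₂ q))) ⊎ (∃[ q ] (q ∈ splits S × p ≡ (proj₁ q , x ∷ proj₂ q)))
splits-∷⁻ {x = x} S h with ∈-++⁻ (map (λ p → x ∷ proj₁ p , proj₂ p) (splits S)) h
... | inj₁ h₁ = inj₁ (∈-map⁻ _ h₁)
... | inj₂ h₂ = inj₂ (∈-map⁻ _ h₂)

splits-consˡ : {x : A} (S : List A) {U W : List A} → (U , W) ∈ splits S → (x ∷ U , W) ∈ splits (x ∷ S)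
splits-consˡ S h = ∈-++⁺ˡ (∈-map⁺ _ h)

splits-consʳ : {x : A} (S : List A) {U W : List A} → (U , W) ∈ splits S → (U , x ∷ W) ∈ splits (x ∷ S)
splits-consʳ {x = x} S h = ∈-++⁺ʳ (map (λ p → x ∷ proj₁ p , proj₂ p) (splits S)) (∈-map⁺ _ h)

splits-∅ˡ : (S : List A) → ([] , S) ∈ splits S
splits-∅ˡ []      = here refl
splits-∅ˡ (x ∷ S) = splits-consʳ S (splits-∅ˡ S)

splits-length : (S : List A) {p : List A × List A} → p ∈ splits S → length (proj₁ p) + length (proj₂ p) ≡ length S
splits-length []      (here refl) = refl
splits-length (x ∷ S) h with splits-∷⁻ S h
... | inj₁ (q , q∈ , refl) = cong suc (splits-length S q∈)
... | inj₂ (q , q∈ , refl) = trans (+-suc (length (proj₁ q)) _) (cong suc (splits-length S q∈))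

splits-⊆ˡ : (S : List A) {p : List A × List A} → p ∈ splits S → ∀ {y} → y ∈ proj₁ p → y ∈ S
splits-⊆ˡ []      (here refl) ()
splits-⊆ˡ (x ∷ S) h y∈ with splits-∷⁻ S h | y∈
... | inj₁ (q , q∈ , refl) | here e   = here e
... | inj₁ (q , q∈ , refl) | there y∈′ = there (splits-⊆ˡ S q∈ y∈′)
... | inj₂ (q , q∈ , refl) | y∈′ = there (splits-⊆ˡ S q∈ y∈′)

splits-⊆ʳ : (S : List A) {p : List A × List A} → p ∈ splits S → ∀ {y} → y ∈ proj₂ p → y ∈ S
splits-⊆ʳ []      (here refl) ()
splits-⊆ʳ (x ∷ S) h y∈ with splits-∷⁻ S h | y∈
... | inj₂ (q , q∈ , refl) | here e   = here e
... | inj₂ (q , q∈ , refl) | there y∈′ = there (splits-⊆ʳ S q∈ y∈′)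
... | inj₁ (q , q∈ , refl) | y∈′ = there (splits-⊆ʳ S q∈ y∈′)

splits-Unique : (S : List A) {p : List A × List A} → p ∈ splits S → Unique S → Unique (proj₁ p)
splits-Unique []      (here refl) _ = []
splits-Unique (x ∷ S) h (x∉ ∷ uS) with splits-∷⁻ S h
... | inj₁ (q , q∈ , refl) = All.tabulate (λ y∈ → All.lookup x∉ (splits-⊆ˡ S q∈ y∈)) ∷ splits-Unique S q∈ uS
... | inj₂ (q , q∈ , refl) = splits-Unique S q∈ uS

splits-empty : (S : List A) {W : List A} → ([] , W) ∈ splits S → W ≡ S
splits-empty []      (here refl) = refl
splits-empty (x ∷ S) h with splits-∷⁻ S h
... | inj₂ ((_ , W) , q∈ , refl) = cong (x ∷_) (splits-empty S q∈)

splits-map : {C : Set} (f : A → C) (S : List A) {U W : List A} → (U , W) ∈ splits S → (map f U , map f W) ∈ splits (map f S)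
splits-map f []      (here refl) = here refl
splits-map f (x ∷ S) h with splits-∷⁻ S h
... | inj₁ (q , q∈ , refl) = splits-consˡ (map f S) (splits-map f S q∈)
... | inj₂ (q , q∈ , refl) = splits-consʳ (map f S) (splits-map f S q∈)

splits-els : (t e : Subset n) → t ⊆′ e → ∃[ R ] ((els t , R) ∈ splits (els e))
splits-els []          []          h = [] , here refl
splits-els (true ∷ t)  (true ∷ e)  h with splits-els t e (λ x → h (suc x))
... | R , R∈ = map suc R , splits-consˡ (map suc (els e)) (splits-map suc (els e) R∈)
splits-els (true ∷ t)  (false ∷ e) h = contradiction (h zero refl) λ ()
splits-els (false ∷ t) (true ∷ e)  h with splits-els t e (λ x → h (suc x))
... | R , R∈ = zero ∷ map suc R , splits-consʳ (map suc (els e)) (splits-map suc (els e) R∈)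
splits-els (false ∷ t) (false ∷ e) h with splits-els t e (λ x → h (suc x))
... | R , R∈ = map suc R , splits-map suc (els e) R∈

splits-one : {x : A} {S : List A} → x ∈ S → ∃[ R ] ((x ∷ [] , R) ∈ splits S)
splits-one {S = x ∷ S} (here refl) = S , splits-consˡ S (splits-∅ˡ S)
splits-one {S = x ∷ S} (there h) with splits-one h
... | R , R∈ = x ∷ R , splits-consʳ S R∈

splits-two : {x y : A} {S : List A} → x ∈ S → y ∈ S → x ≢ y →
  ∃[ R ] (((x ∷ y ∷ [] , R) ∈ splits S) ⊎ ((y ∷ x ∷ [] , R) ∈ splits S))
splits-two (here refl) (here refl) x≢y = contradiction refl x≢y
splits-two {S = x ∷ S} (here refl) (there y∈) _ with splits-one y∈
... | R , R∈ = R , inj₁ (splits-consˡ S R∈)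
splits-two {S = y ∷ S} (there x∈) (here refl) _ with splits-one x∈
... | R , R∈ = R , inj₂ (splits-consˡ S R∈)
splits-two {S = z ∷ S} (there x∈) (there y∈) x≢y with splits-two x∈ y∈ x≢y
... | R , inj₁ R∈ = z ∷ R , inj₁ (splits-consʳ S R∈)
... | R , inj₂ R∈ = z ∷ R , inj₂ (splits-consʳ S R∈)

-- Gain and loss of a single edge

module EdgeBounds {A : Set} {n : ℕ} (P : List A) (wt : A → Fin n → ℕ) (at : A → Fin n → Subset n)
  (Λ : ℕ) (cf : ℕ → ℕ) (cf0 : cf 0 ≡ 0) (Cw : ℕ) (cf≤ : ∀ s → cf s ≤ Cw) where

  open Chaos P wt at

  edgeGain edgeLoss : List (Fin n) → ℕ
  edgeGain e = ∑ (splits e) λ p → cf (length (proj₁ p)) * (2 * Λ) ^ length (proj₂ p) * singles Λ (proj₁ p)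
  edgeLoss e = ∑ (splits e) λ p → cf (length (proj₁ p)) * (2 * Λ) ^ length (proj₂ p) * evens Λ (proj₁ p)

  pow-split : ∀ a b → (2 * Λ) ^ a * Λ ^ b ≡ 2 ^ a * Λ ^ (a + b)
  pow-split a b = trans (cong (λ w → w * Λ ^ b) (*-^ 2 Λ a))
    (trans (*-assoc (2 ^ a) (Λ ^ a) (Λ ^ b)) (cong (λ w → 2 ^ a * w) (sym (^-distribˡ-+-* Λ a b))))

  -- One term of the expansion is enough. Its powers of `Λ` come from all vertices of the edge but
  -- `u`, where `L` was chosen instead.
  edgeGain-≥ : ∀ {e S R u W} → (S , R) ∈ splits e → 1 ≤ cf (length S) → (u ∷ [] , W) ∈ splits S →
    1 ≤ N (u ∷ []) (set W) → Λ ^ (length e ∸ 1) ≤ edgeGain e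
  edgeGain-≥ {e} {S} {R} {u} {W} S∈ 1≤c U∈ 1≤N = begin
    Λ ^ (length e ∸ 1) ≡⟨ cong (Λ ^_) lens ⟩
    Λ ^ (length R + length W) ≤⟨ m≤n*m _ (2 ^ length R) {{>-nonZero (m^n>0 2 (length R))}} ⟩
    2 ^ length R * Λ ^ (length R + length W) ≡⟨ sym (pow-split (length R) (length W)) ⟩
    (2 * Λ) ^ length R * Λ ^ length W ≡⟨ unit ((2 * Λ) ^ length R) (Λ ^ length W) ⟩
    1 * (2 * Λ) ^ length R * (1 * (Λ ^ length W * 1))
      ≤⟨ *-mono-≤ (*-monoˡ-≤ ((2 * Λ) ^ length R) 1≤c) (*-monoʳ-≤ 1 (*-monoʳ-≤ (Λ ^ length W) 1≤N)) ⟩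
    cf (length S) * (2 * Λ) ^ length R * (1 * (Λ ^ length W * N (u ∷ []) (set W)))
      ≤⟨ *-monoʳ-≤ (cf (length S) * (2 * Λ) ^ length R) (∑-≥ (λ p → 𝟙 (isSingle (proj₁ p)) * repr Λ p) U∈) ⟩
    cf (length S) * (2 * Λ) ^ length R * singles Λ S
      ≤⟨ ∑-≥ (λ p → cf (length (proj₁ p)) * (2 * Λ) ^ length (proj₂ p) * singles Λ (proj₁ p)) S∈ ⟩
    edgeGain e ∎
    where
    open ≤-Reasoning
    unit : ∀ a b → a * b ≡ 1 * a * (1 * (b * 1))
    unit = ℕR.solve-∀
    lens : length e ∸ 1 ≡ length R + length W
    lens = trans (cong (_∸ 1) (sym (trans (cong (_+ length R) (splits-length S U∈)) (splits-length e S∈)))) (+-comm (length W) (length R))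

  -- The three powers of 2 count the choices of `S` and of `U` and bound the 2 in
  -- `(2 * Λ) ^ length R`. The term without any factor `L` has nonzero mean only for empty `S`,
  -- where `cf 0 ≡ 0` removes it, so `bnd` is asked for nonempty `U` only.
  edgeLoss-≤ : ∀ e X → Unique e →
    (∀ u us W → isEven (u ∷ us) ≡ true → Unique (u ∷ us) → (∀ {x} → x ∈ u ∷ us → x ∈ e) → (∀ {x} → x ∈ W → x ∈ e) →
      length (u ∷ us) ≤ length e → Λ ^ (length e ∸ length (u ∷ us)) * N (u ∷ us) (set W) ≤ X) →
    edgeLoss e ≤ 2 ^ length e * (2 ^ length e * (Cw * (2 ^ length e * X)))
  edgeLoss-≤ e X ue bnd = ≤-trans (∑-bound (splits e) _ outer) (≤-reflexive (cong (_* (2 ^ k * (Cw * (2 ^ k * X)))) (length-splits e)))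
    where
    k = length e
    open ≤-Reasoning
    pow2 : ∀ {i} → i ≤ k → 2 ^ i ≤ 2 ^ k
    pow2 = ^-monoʳ-≤ 2
    perm : ∀ c a b l x → c * a * (b * (l * x)) ≡ b * (c * ((a * l) * x))
    perm = ℕR.solve-∀
    inner : ∀ S R → (S , R) ∈ splits e → ∀ p → p ∈ splits S →
      cf (length S) * (2 * Λ) ^ length R * (𝟙 (isEven (proj₁ p)) * repr Λ p) ≤ Cw * (2 ^ k * X)
    inner S R S∈ p@([] , W) p∈ with splits-empty S p∈
    inner []      R S∈ p@([] , W) p∈ | refl rewrite cf0 = z≤n
    inner (v ∷ S) R S∈ p@([] , W) p∈ | refl
      rewrite empty-set v S (splits-Unique e S∈ ue) | *-zeroʳ (Λ ^ suc (length S))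
        | *-zeroʳ (cf (suc (length S)) * (2 * Λ) ^ length R) = z≤n
    inner S R S∈ p@(u ∷ us , W) p∈ with isEven (u ∷ us) in ev
    ... | false rewrite *-zeroʳ (cf (length S) * (2 * Λ) ^ length R) = z≤n
    ... | true = begin
      cf (length S) * (2 * Λ) ^ length R * (1 * (Λ ^ length W * N (u ∷ us) (set W)))
        ≡⟨ perm (cf (length S)) ((2 * Λ) ^ length R) 1 (Λ ^ length W) _ ⟩
      1 * (cf (length S) * ((2 * Λ) ^ length R * Λ ^ length W * N (u ∷ us) (set W)))
        ≡⟨ trans (*-identityˡ _) (cong (λ w → cf (length S) * (w * N (u ∷ us) (set W))) (trans (pow-split (length R) (length W)) (cong (λ w → 2 ^ length R * Λ ^ w) lens))) ⟩
      cf (length S) * (2 ^ length R * Λ ^ (k ∸ length (u ∷ us)) * N (u ∷ us) (set W))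
        ≤⟨ *-mono-≤ (cf≤ (length S)) (≤-trans (≤-reflexive (*-assoc (2 ^ length R) _ _)) (*-mono-≤ (pow2 R≤)
             (bnd u us W ev (splits-Unique S p∈ (splits-Unique e S∈ ue)) (λ x∈ → splits-⊆ˡ e S∈ (splits-⊆ˡ S p∈ x∈))
               (λ x∈ → splits-⊆ˡ e S∈ (splits-⊆ʳ S p∈ x∈)) U≤))) ⟩
      Cw * (2 ^ k * X) ∎
      where
      tot : length (u ∷ us) + (length R + length W) ≡ k
      tot = trans (rearr (length (u ∷ us)) (length R) (length W)) (trans (cong (_+ length R) (splits-length S p∈)) (splits-length e S∈))
        where
        rearr : ∀ a b c → a + (b + c) ≡ (a + c) + b
        rearr = ℕR.solve-∀
      lens : length R + length W ≡ k ∸ length (u ∷ us)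
      lens = sym (trans (cong (_∸ length (u ∷ us)) (sym tot)) (m+n∸m≡n (length (u ∷ us)) _))
      U≤ : length (u ∷ us) ≤ k
      U≤ = subst (length (u ∷ us) ≤_) tot (m≤m+n _ _)
      R≤ : length R ≤ k
      R≤ = subst (length R ≤_) (splits-length e S∈) (m≤n+m _ (length S))
    outer : ∀ q → q ∈ splits e → cf (length (proj₁ q)) * (2 * Λ) ^ length (proj₂ q) * evens Λ (proj₁ q) ≤ 2 ^ k * (Cw * (2 ^ k * X))
    outer (S , R) S∈ = begin
      cf (length S) * (2 * Λ) ^ length R * evens Λ S ≡⟨ sym (∑-*ˡ (splits S) (cf (length S) * (2 * Λ) ^ length R) (λ p → 𝟙 (isEven (proj₁ p)) * repr Λ p)) ⟩
      ∑ (splits S) (λ p → cf (length S) * (2 * Λ) ^ length R * (𝟙 (isEven (proj₁ p)) * repr Λ p))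
        ≤⟨ ∑-bound (splits S) _ (inner S R S∈) ⟩
      length (splits S) * (Cw * (2 ^ k * X))
        ≤⟨ *-monoˡ-≤ _ (≤-trans (≤-reflexive (length-splits S)) (pow2 (subst (length S ≤_) (splits-length e S∈) (m≤m+n _ _)))) ⟩
      2 ^ k * (Cw * (2 ^ k * X)) ∎

∣∑ᶻ∣≤ : (xs : List A) (f : A → ℤ) (g : A → ℕ) → (∀ x → ℤ.∣ f x ∣ ≤ g x) → ℤ.∣ ∑ᶻ xs f ∣ ≤ ∑ xs g
∣∑ᶻ∣≤ []       f g h = z≤n
∣∑ᶻ∣≤ (x ∷ xs) f g h = ≤-trans (ℤP.∣i+j∣≤∣i∣+∣j∣ (f x) (∑ᶻ xs f)) (+-mono-≤ (h x) (∣∑ᶻ∣≤ xs f g h))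

∑-at-most-one : (xs : List A) (f : A → ℕ) → Unique xs → (∀ x → f x ≤ 1) →
  (∀ x y → f x ≢ 0 → f y ≢ 0 → x ≡ y) → ∑ xs f ≤ 1
∑-at-most-one []       f _         f≤1 inj = z≤n
∑-at-most-one (x ∷ xs) f (x∉ ∷ u) f≤1 inj with f x in eq
... | zero  = ∑-at-most-one xs f u f≤1 inj
... | suc m = ≤-trans (≤-reflexive (trans (cong (λ w → suc m + w) (∑-0 xs rest)) (trans (+-identityʳ _) (sym eq)))) (f≤1 x)
  where
  rest : ∀ y → y ∈ xs → f y ≡ 0
  rest y y∈ with f y in eqy
  ... | zero  = refl
  ... | suc _ = contradiction (inj x y (λ e → contradiction (trans (sym eq) e) λ ()) (λ e → contradiction (trans (sym eqy) e) λ ()))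
                  (All.lookup x∉ y∈)

module ChaosSize {A : Set} {n : ℕ} (P : List A) (wt : A → Fin n → ℕ) (at : A → Fin n → Subset n) where

  open Chaos P wt at

  ∣L∣≤ : ∀ u z → ℤ.∣ L u z ∣ ≤ ∑ P (λ a → wt a u)
  ∣L∣≤ u z = ∣∑ᶻ∣≤ P _ (λ a → wt a u) (λ a → ≤-reflexive (trans (ℤP.abs-* (+ wt a u) (χ (at a u) z))
    (trans (cong (λ w → wt a u * w) (∣χ∣≡1 (at a u) z)) (*-identityʳ _))))

  ∣point∣≤ : ∀ Λ z v → ℤ.∣ point Λ z v ∣ ≤ ℤ.∣ L v z ∣ + Λ
  ∣point∣≤ Λ z v = ≤-trans (ℤP.∣i+j∣≤∣i∣+∣j∣ (ℤ.- L v z) (+ Λ ℤ.* χ ⁅ v ⁆ z)) (+-mono-≤ (≤-reflexive (ℤP.∣-i∣≡∣i∣ (L v z)))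
    (≤-reflexive (trans (ℤP.abs-* (+ Λ) (χ ⁅ v ⁆ z)) (trans (cong (λ w → Λ * w) (∣χ∣≡1 ⁅ v ⁆ z)) (*-identityʳ Λ)))))

-- For r colours, −2 cutPoly / (r M)^k is the excess of the expected size of a random cut over the average one,
-- so σ / r^k bounds the surplus of every cut.
CutBound : {n : ℕ} (k : ℕ) (cf : ℕ → ℕ) (es : List (Subset n)) (σ : ℕ) → Set
CutBound {n} k cf es σ = (M : ℕ) → 1 ≤ M → (Y : Fin n → ℤ) → (∀ v → ℤ.∣ Y v ∣ ≤ M) →
  ℤ.- (+ 2 ℤ.* cutPoly cf (map els es) M Y) ℤ.≤ + (M ^ k * σ)

-- Edges containing a pair from a matching or a clique

module Pairs {n : ℕ} (k : ℕ) (2≤k : 2 ≤ k) (es : List (Subset n)) (uni : ∀ e → e ∈ es → ∣ e ∣ ≡ k)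
  (cf : ℕ → ℕ) (cf0 : cf 0 ≡ 0) (1≤cf2 : 1 ≤ cf 2) (Cw : ℕ) (cf≤ : ∀ s → cf s ≤ Cw)
  (σ : ℕ) (bounded : CutBound k cf es σ)
  (adj : Fin n → Fin n → Bool)
  (adj-sym : ∀ u w → adj u w ≡ true → adj w u ≡ true)
  (adj-irrefl : ∀ u w → adj u w ≡ true → u ≢ w)
  (adj-trans : ∀ u v w → adj u w ≡ true → adj v w ≡ true → u ≢ v → adj u v ≡ true)
  (Δ : ℕ) (1≤Δ : 1 ≤ Δ) (degree : ∀ u → ∑ (allFin n) (λ w → 𝟙 (adj u w)) ≤ Δ)
  (bad : Subset n → Bool)
  (bad⁻ : ∀ e → bad e ≡ true → ∃[ u ] ∃[ w ] ((e ∋ u) × (e ∋ w) × adj u w ≡ true))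
  (bad⁺ : ∀ e u w → e ∋ u → e ∋ w → adj u w ≡ true → bad e ≡ true)
  where

  private
    -- The pair of `u` and `w`, seen from `u`, is indexed by `w`.
    wt : Fin n → Fin n → ℕ
    wt w u = 𝟙 (adj u w)
    at : Fin n → Fin n → Subset n
    at w u = ⁅ w ⁆
    -- `c₀` is the constant of `edgeLoss-≤`. Since `2 * c₀ ≤ κ`, the loss will be at most half of
    -- the lower bound for the gain.
    c₀ κ Λ : ℕ
    c₀ = 2 ^ k * (2 ^ k * (Cw * 2 ^ k))
    κ = 2 * suc c₀
    Λ = κ * Δ

  open Chaos (allFin n) wt at
  open ChaosSize (allFin n) wt at

  private
    Δ≤Λ : Δ ≤ Λ
    Δ≤Λ = m≤n*m Δ κ
    1≤Λ : 1 ≤ Λ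
    1≤Λ = ≤-trans 1≤Δ Δ≤Λ

  open EdgeBounds (allFin n) wt at Λ cf cf0 Cw cf≤

  -- Every vertex has at most `Δ` neighbours to choose from, except the last one, whose neighbour is
  -- forced by the vanishing of the sum.
  N≤ : ∀ u us R → N (u ∷ us) R ≤ Δ ^ length us
  N≤ u [] R = ≤-trans (∑-mono (allFin n) (λ w → *-monoˡ-≤ (𝟙 (empty (R ⊕ ⁅ w ⁆))) (𝟙≤1 (adj u w))))
    (∑-at-most-one (allFin n) _ (UniqueP.allFin⁺ n) (λ w → ≤-trans (≤-reflexive (*-identityˡ _)) (𝟙≤1 (empty (R ⊕ ⁅ w ⁆))))
      (λ x y fx fy → ∋-⁅⁆ x y (subst (_∋ y) (trans (sym (empty-⊕ R ⁅ y ⁆ (ne y fy))) (empty-⊕ R ⁅ x ⁆ (ne x fx))) (lookup-⁅⁆ y))))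
    where
    ne : ∀ x → 1 * 𝟙 (empty (R ⊕ ⁅ x ⁆)) ≢ 0 → empty (R ⊕ ⁅ x ⁆) ≡ true
    ne x h = 𝟙-≢0 (*≢0ʳ 1 h)
  N≤ u (v ∷ us) R = begin
    ∑ (allFin n) (λ w → 𝟙 (adj u w) * N (v ∷ us) (R ⊕ ⁅ w ⁆)) ≤⟨ ∑-mono (allFin n) (λ w → *-monoʳ-≤ (𝟙 (adj u w)) (N≤ v us (R ⊕ ⁅ w ⁆))) ⟩
    ∑ (allFin n) (λ w → 𝟙 (adj u w) * Δ ^ length us) ≡⟨ ∑-*ʳ (allFin n) (Δ ^ length us) _ ⟩
    ∑ (allFin n) (λ w → 𝟙 (adj u w)) * Δ ^ length us ≤⟨ *-monoˡ-≤ (Δ ^ length us) (degree u) ⟩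
    Δ * Δ ^ length us ∎
    where open ≤-Reasoning

  N≢0⇒∈ : ∀ us R x → N us R ≢ 0 → R ∋ x → ∃[ u ] (u ∈ us × adj u x ≡ true)
  N≢0⇒∈ [] R x h x∈ = contradiction (trans (sym (𝟙-≢0 h)) (empty-∋ R x x∈)) λ ()
  N≢0⇒∈ (u ∷ us) R x h x∈ with ∑-≢0 (allFin n) _ h
  ... | w , _ , hw with w ≟ x
  ...   | yes refl = u , here refl , 𝟙-≢0 (*≢0ˡ (𝟙 (adj u w)) hw)
  ...   | no w≢x with N≢0⇒∈ us (R ⊕ ⁅ w ⁆) x (*≢0ʳ (𝟙 (adj u w)) hw) x∈′
    where
    x∈′ : R ⊕ ⁅ w ⁆ ∋ x
    x∈′ with lookup ⁅ w ⁆ x in eq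
    ... | true  = contradiction (∋-⁅⁆ w x eq) w≢x
    ... | false = trans (lookup-⊕ R ⁅ w ⁆ x) (cong₂ _xor_ x∈ eq)
  ...     | u′ , u′∈ , a = u′ , there u′∈ , a

  -- The neighbour `w` chosen for `u` must be cancelled. Either it lies in `W`, and `u`, `w` form a
  -- pair inside `e`, or another `u′` is adjacent to `w` too, and `adj-trans` makes `u`, `u′` such a
  -- pair. Hence only edges that contribute to the gain can contribute to the loss.
  N≢0⇒bad : ∀ e u us W → Unique (u ∷ us) → (∀ {x} → x ∈ u ∷ us → e ∋ x) → (∀ {x} → x ∈ W → e ∋ x) →
    N (u ∷ us) (set W) ≢ 0 → bad e ≡ true
  N≢0⇒bad e u us W (u∉ ∷ _) us⊆ W⊆ h with ∑-≢0 (allFin n) _ h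
  ... | w , _ , hw with lookup (set W) w in eq
  ...   | true = bad⁺ e u w (us⊆ (here refl)) (W⊆ (set-∈ W w eq)) (𝟙-≢0 (*≢0ˡ (𝟙 (adj u w)) hw))
  ...   | false with N≢0⇒∈ us (set W ⊕ ⁅ w ⁆) w (*≢0ʳ (𝟙 (adj u w)) hw)
                       (trans (lookup-⊕ (set W) ⁅ w ⁆ w) (cong₂ _xor_ eq (lookup-⁅⁆ w)))
  ...     | u′ , u′∈ , a = bad⁺ e u u′ (us⊆ (here refl)) (us⊆ (there u′∈))
                             (adj-trans u u′ w (𝟙-≢0 (*≢0ˡ (𝟙 (adj u w)) hw)) a (All.lookup u∉ u′∈))

  private
    gain≥ : Λ ^ (k ∸ 1) * ∑ es (𝟙 ∘ bad) ≤ gain Λ cf (map els es) (2 * Λ)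
    gain≥ = ≤-trans (≤-reflexive (sym (∑-*ˡ es (Λ ^ (k ∸ 1)) (𝟙 ∘ bad))))
      (≤-trans (∑-mono∈ es edge) (≤-reflexive (sym (∑-map els es edgeGain))))
      where
      edge : ∀ e → e ∈ es → Λ ^ (k ∸ 1) * 𝟙 (bad e) ≤ edgeGain (els e)
      edge e e∈ with bad e in eq
      ... | false = ≤-trans (≤-reflexive (*-zeroʳ (Λ ^ (k ∸ 1)))) z≤n
      ... | true with bad⁻ e eq
      ...   | u , w , u∈ , w∈ , a = ≤-trans (≤-reflexive (trans (*-identityʳ _) (cong (λ l → Λ ^ (l ∸ 1)) (sym (trans (length-els e) (uni e e∈))))))
                (pick (splits-two (∈-els⁺ e u u∈) (∈-els⁺ e w w∈) (adj-irrefl u w a)))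
        where
        one : ∀ u w → adj u w ≡ true → 1 ≤ N (u ∷ []) (set (w ∷ []))
        one u w a = ≤-trans (*-mono-≤ (𝟙≡1 a) (𝟙≡1 (trans (cong empty
            (trans (cong (_⊕ ⁅ w ⁆) (trans (⊕-comm ⁅ w ⁆ ⊥) (⊕-identityˡ ⁅ w ⁆))) (⊕-self ⁅ w ⁆))) (empty-⊥ n))))
          (∑-≥ (λ x → wt x u * N [] (set (w ∷ []) ⊕ at x u)) (∈-allFin w))
        pick : ∃[ R ] (((u ∷ w ∷ [] , R) ∈ splits (els e)) ⊎ ((w ∷ u ∷ [] , R) ∈ splits (els e))) →
          Λ ^ (length (els e) ∸ 1) ≤ edgeGain (els e)
        pick (R , inj₁ R∈) = edgeGain-≥ {els e} R∈ 1≤cf2 (there (here refl)) (one u w a)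
        pick (R , inj₂ R∈) = edgeGain-≥ {els e} R∈ 1≤cf2 (there (here refl)) (one w u (adj-sym u w a))

    loss≤ : loss Λ cf (map els es) (2 * Λ) ≤ c₀ * (Λ ^ (k ∸ 2) * Δ) * ∑ es (𝟙 ∘ bad)
    loss≤ = ≤-trans (≤-reflexive (∑-map els es edgeLoss))
      (≤-trans (∑-mono∈ es edge) (≤-reflexive (∑-*ˡ es (c₀ * (Λ ^ (k ∸ 2) * Δ)) (𝟙 ∘ bad))))
      where
      perm : ∀ p c a b → p * (p * (c * (p * (a * b)))) ≡ (p * (p * (c * p))) * a * b
      perm = ℕR.solve-∀
      perm₂ : ∀ a b c → a * (b * c) ≡ (a * c) * b
      perm₂ = ℕR.solve-∀
      edge : ∀ e → e ∈ es → edgeLoss (els e) ≤ c₀ * (Λ ^ (k ∸ 2) * Δ) * 𝟙 (bad e)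
      edge e e∈ = ≤-trans (edgeLoss-≤ (els e) (Λ ^ (k ∸ 2) * Δ * 𝟙 (bad e)) (Unique-els e) bnd)
          (≤-reflexive (trans (cong (λ l → 2 ^ l * (2 ^ l * (Cw * (2 ^ l * (Λ ^ (k ∸ 2) * Δ * 𝟙 (bad e)))))) len)
            (perm (2 ^ k) Cw (Λ ^ (k ∸ 2) * Δ) (𝟙 (bad e)))))
        where
        open ≤-Reasoning
        len : length (els e) ≡ k
        len = trans (length-els e) (uni e e∈)
        bnd : ∀ u us W → isEven (u ∷ us) ≡ true → Unique (u ∷ us) → (∀ {x} → x ∈ u ∷ us → x ∈ els e) → (∀ {x} → x ∈ W → x ∈ els e) →
          length (u ∷ us) ≤ length (els e) → Λ ^ (length (els e) ∸ length (u ∷ us)) * N (u ∷ us) (set W) ≤ Λ ^ (k ∸ 2) * Δ * 𝟙 (bad e)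
        bnd u [] W () _ _ _ _
        bnd u (v ∷ us) W _ un us⊆ W⊆ l≤ rewrite len with N (u ∷ v ∷ us) (set W) in eq
        ... | zero = ≤-trans (≤-reflexive (*-zeroʳ (Λ ^ (k ∸ suc (suc (length us)))))) z≤n
        ... | suc m rewrite N≢0⇒bad e u (v ∷ us) W un (λ x∈ → ∈-els⁻ e _ (us⊆ x∈)) (λ x∈ → ∈-els⁻ e _ (W⊆ x∈))
                 (λ z → contradiction (trans (sym eq) z) λ ()) = begin
          Λ ^ (k ∸ j) * suc m ≤⟨ *-monoʳ-≤ (Λ ^ (k ∸ j)) (≤-trans (≤-reflexive (sym eq)) (N≤ u (v ∷ us) (set W))) ⟩
          -- One `Δ` is kept while the others grow to `Λ`: the quotient `Λ / Δ = κ` is what makes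
          -- the loss small.
          Λ ^ (k ∸ j) * (Δ * Δ ^ length us) ≤⟨ *-monoʳ-≤ (Λ ^ (k ∸ j)) (*-monoʳ-≤ Δ (^-monoˡ-≤ (length us) Δ≤Λ)) ⟩
          Λ ^ (k ∸ j) * (Δ * Λ ^ length us) ≡⟨ perm₂ (Λ ^ (k ∸ j)) Δ (Λ ^ length us) ⟩
          Λ ^ (k ∸ j) * Λ ^ length us * Δ ≡⟨ cong (_* Δ) (trans (sym (^-distribˡ-+-* Λ (k ∸ j) (length us))) (cong (Λ ^_) exps)) ⟩
          Λ ^ (k ∸ 2) * Δ ≡⟨ sym (*-identityʳ _) ⟩
          Λ ^ (k ∸ 2) * Δ * 1 ∎
          where
          j : ℕ
          j = suc (suc (length us))
          exps : k ∸ j + length us ≡ k ∸ 2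
          exps = trans (cong (_+ length us) (sym (∸-+-assoc k 2 (length us)))) (m∸n+n≡m (∸-monoˡ-≤ 2 l≤))

  pairs-≤ : ∑ es (𝟙 ∘ bad) ≤ 2 ^ k * κ * (Δ * σ)
  pairs-≤ = *-cancelˡ-≤ (Λ ^ (k ∸ 1)) {{>-nonZero (m^n>0 Λ {{>-nonZero 1≤Λ}} (k ∸ 1))}} (begin
    Λ ^ (k ∸ 1) * G ≤⟨ +-cancelʳ-≤ (Λ ^ (k ∸ 1) * G) _ _ main ⟩
    (2 * Λ) ^ k * σ ≡⟨ cong (_* σ) (trans (*-^ 2 Λ k) (cong (λ l → 2 ^ k * Λ ^ l) (sym (m+[n∸m]≡n {1} (≤-trans (s≤s z≤n) 2≤k))))) ⟩
    2 ^ k * (κ * Δ * Λ ^ (k ∸ 1)) * σ ≡⟨ perm (2 ^ k) κ Δ (Λ ^ (k ∸ 1)) σ ⟩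
    Λ ^ (k ∸ 1) * (2 ^ k * κ * (Δ * σ)) ∎)
    where
    open ≤-Reasoning
    G : ℕ
    G = ∑ es (𝟙 ∘ bad)
    perm : ∀ p κ d l s → p * (κ * d * l) * s ≡ l * (p * κ * (d * s))
    perm = ℕR.solve-∀
    dbl : ∀ x → x + x ≡ 2 * 1 * x
    dbl = ℕR.solve-∀
    perm₃ : ∀ c l d g → 2 * 1 * (c * (l * d) * g) ≡ (2 * c) * (d * l * g)
    perm₃ = ℕR.solve-∀
    perm₄ : ∀ κ d l g → κ * (d * l * g) ≡ κ * d * l * g
    perm₄ = ℕR.solve-∀
    main : Λ ^ (k ∸ 1) * G + Λ ^ (k ∸ 1) * G ≤ (2 * Λ) ^ k * σ + Λ ^ (k ∸ 1) * G
    main = begin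
      Λ ^ (k ∸ 1) * G + Λ ^ (k ∸ 1) * G ≡⟨ dbl (Λ ^ (k ∸ 1) * G) ⟩
      2 * 1 * (Λ ^ (k ∸ 1) * G) ≤⟨ *-monoʳ-≤ 2 gain≥ ⟩
      2 * 1 * gain Λ cf (map els es) (2 * Λ)
        -- Here `L` is bounded by `Δ ≤ Λ`, so the point never leaves the cube and the error is 0.
        ≤⟨ gain-≤ Λ cf (map els es) (2 * Λ) 1 ((2 * Λ) ^ k * σ) 0 (λ _ → 0)
             (λ z → ℤP.≤-trans (bounded (2 * Λ) (≤-trans 1≤Λ (m≤m+n Λ _)) (point Λ z) (λ v → ≤-trans (∣point∣≤ Λ z v)
                 (≤-trans (+-monoˡ-≤ Λ (≤-trans (∣L∣≤ v z) (≤-trans (degree v) Δ≤Λ))) (≤-reflexive (cong (λ w → Λ + w) (sym (+-identityʳ Λ)))))))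
               (ℤP.≤-reflexive (cong +_ (sym (trans (+-identityʳ _) (*-identityˡ _))))))
             (≤-trans (≤-reflexive (∑-0 (allS n) (λ _ _ → refl))) z≤n) ⟩
      1 * ((2 * Λ) ^ k * σ) + 0 + 2 * 1 * loss Λ cf (map els es) (2 * Λ)
        ≤⟨ +-mono-≤ (≤-reflexive (trans (+-identityʳ _) (*-identityˡ ((2 * Λ) ^ k * σ)))) (*-monoʳ-≤ (2 * 1) loss≤) ⟩
      (2 * Λ) ^ k * σ + 2 * 1 * (c₀ * (Λ ^ (k ∸ 2) * Δ) * G)
        ≡⟨ cong (λ w → (2 * Λ) ^ k * σ + w) (perm₃ c₀ (Λ ^ (k ∸ 2)) Δ G) ⟩
      (2 * Λ) ^ k * σ + (2 * c₀) * (Δ * Λ ^ (k ∸ 2) * G)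
        ≤⟨ +-monoʳ-≤ ((2 * Λ) ^ k * σ) (*-monoˡ-≤ (Δ * Λ ^ (k ∸ 2) * G) (*-monoʳ-≤ 2 (n≤1+n c₀))) ⟩
      (2 * Λ) ^ k * σ + κ * (Δ * Λ ^ (k ∸ 2) * G)
        ≡⟨ cong (λ w → (2 * Λ) ^ k * σ + w) (trans (perm₄ κ Δ (Λ ^ (k ∸ 2)) G) (cong (λ l → Λ ^ l * G) exp)) ⟩
      (2 * Λ) ^ k * σ + Λ ^ (k ∸ 1) * G ∎
      where
      exp : suc (k ∸ 2) ≡ k ∸ 1
      exp = trans (sym (+-∸-assoc 1 2≤k)) refl

-- Counting tuples of sets with vanishing sum

picks : List A → List (A × List A)
picks []       = []
picks (u ∷ us) = (u , us) ∷ map (λ q → proj₁ q , u ∷ proj₂ q) (picks us)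

picks-∈ : (us : List A) {q : A × List A} → q ∈ picks us → proj₁ q ∈ us
picks-∈ (u ∷ us) (here refl) = here refl
picks-∈ (u ∷ us) (there h) with ∈-map⁻ _ h
... | q , q∈ , refl = there (picks-∈ us q∈)

picks-⊆ : (us : List A) {q : A × List A} → q ∈ picks us → ∀ {x} → x ∈ proj₂ q → x ∈ us
picks-⊆ (u ∷ us) (here refl) x∈ = there x∈
picks-⊆ (u ∷ us) (there h) x∈ with ∈-map⁻ _ h | x∈
... | q , q∈ , refl | here e = here e
... | q , q∈ , refl | there x∈′ = there (picks-⊆ us q∈ x∈′)

picks-length : (us : List A) {q : A × List A} → q ∈ picks us → suc (length (proj₂ q)) ≡ length us
picks-length (u ∷ us) (here refl) = refl
picks-length (u ∷ us) (there h) with ∈-map⁻ _ h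
... | q , q∈ , refl = cong suc (picks-length us q∈)

∑-picks : (us : List A) (g : A → ℕ) → ∑ (picks us) (g ∘ proj₁) ≡ ∑ us g
∑-picks []       g = refl
∑-picks (u ∷ us) g = cong (λ w → g u + w) (trans (∑-map _ (picks us) (g ∘ proj₁)) (∑-picks us g))

any𝟚 : (A → Bool) → List A → Bool
any𝟚 Q []       = false
any𝟚 Q (t ∷ ts) = Q t ∨ any𝟚 Q ts

any𝟚-false : (Q : A → Bool) (ts : List A) → any𝟚 Q ts ≡ false → ∀ t → t ∈ ts → Q t ≡ false
any𝟚-false Q (t ∷ ts) h x x∈ with Q t in eq | x∈
... | false | here refl = eq
... | false | there x∈′ = any𝟚-false Q ts h x x∈′

-- Counting tuples (tᵤ ∋ u) of members of P whose sum vanishes. Every tuple is read forwards or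
-- backwards; a member that meets what has been read so far in at least s₀ points has only C choices,
-- any other member at most Δ, and in one of the two directions at most half of them are of the latter kind.
module Tuples {n : ℕ} (P : List (Subset n)) (s₀ s C Δ κ : ℕ) (1≤s₀ : 1 ≤ s₀) (1≤Δ : 1 ≤ Δ)
  (once : ∀ r → ∑ P (λ t → 𝟙 (empty (r ⊕ t))) ≤ 1)
  (size≤ : ∀ t → t ∈ P → ∣ t ∣ ≤ s) (size≥ : ∀ t → t ∈ P → s₀ + (s₀ + s₀) ≤ ∣ t ∣)
  (overlaps : ∀ K → ∣ K ∣ ≤ κ → ∑ P (λ t → 𝟙 (s₀ ≤ᵇ ∣ t ∩ K ∣)) ≤ C)
  (degree : ∀ u → ∑ P (λ t → 𝟙 (lookup t u)) ≤ Δ) where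

  wt : Subset n → Fin n → ℕ
  wt t u = 𝟙 (lookup t u)

  at : Subset n → Fin n → Subset n
  at t u = t ⊕ ⁅ u ⁆

  open Chaos P wt at

  ∑T : List (Fin n) → (List (Subset n) → ℕ) → ℕ
  ∑T []       f = f []
  ∑T (u ∷ us) f = ∑ P (λ t → wt t u * ∑T us (λ ts → f (t ∷ ts)))

  Good : List (Fin n) → List (Subset n) → Set
  Good us ts = (∀ t → t ∈ ts → t ∈ P) × length ts ≡ length us

  Good-∷ : ∀ {u us t ts} → t ∈ P → Good us ts → Good (u ∷ us) (t ∷ ts)
  Good-∷ t∈ (h , l) = (λ { _ (here refl) → t∈ ; x (there x∈) → h x x∈ }) , cong suc l

  ∑T-mono : ∀ us {f g} → (∀ ts → Good us ts → f ts ≤ g ts) → ∑T us f ≤ ∑T us g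
  ∑T-mono []       h = h [] ((λ _ ()) , refl)
  ∑T-mono (u ∷ us) h = ∑-mono∈ P (λ t t∈ → *-monoʳ-≤ (wt t u) (∑T-mono us (λ ts good → h (t ∷ ts) (Good-∷ {u} {us} t∈ good))))

  ∑T-+ : ∀ us f g → ∑T us (λ ts → f ts + g ts) ≡ ∑T us f + ∑T us g
  ∑T-+ []       f g = refl
  ∑T-+ (u ∷ us) f g = trans (∑-cong P (λ t → trans (cong (λ w → wt t u * w) (∑T-+ us _ _)) (*-distribˡ-+ (wt t u) _ _))) (∑-+ P _ _)

  ∑T-*ˡ : ∀ us c f → ∑T us (λ ts → c * f ts) ≡ c * ∑T us f
  ∑T-*ˡ []       c f = refl
  ∑T-*ˡ (u ∷ us) c f = trans (∑-cong P (λ t → trans (cong (λ w → wt t u * w) (∑T-*ˡ us c _)) (*-swapˡ (wt t u) c _))) (∑-*ˡ P c _)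

  ∑T-swap : ∀ us {A : Set} (xs : List A) (f : A → List (Subset n) → ℕ) →
    ∑ xs (λ x → ∑T us (f x)) ≡ ∑T us (λ ts → ∑ xs (λ x → f x ts))
  ∑T-swap []       xs f = refl
  ∑T-swap (u ∷ us) xs f = trans (∑-swap xs P _) (∑-cong P (λ t →
    trans (∑-*ˡ xs (wt t u) _) (cong (λ w → wt t u * w) (∑T-swap us xs (λ x ts → f x (t ∷ ts))))))

  acc : Subset n → List (Fin n) → List (Subset n) → Subset n
  acc R (u ∷ us) (t ∷ ts) = acc (R ⊕ (t ⊕ ⁅ u ⁆)) us ts
  acc R _        _        = R

  N-∑T : ∀ us R → N us R ≡ ∑T us (λ ts → 𝟙 (empty (acc R us ts)))
  N-∑T []       R = refl
  N-∑T (u ∷ us) R = ∑-cong P (λ t → cong (λ w → wt t u * w) (N-∑T us (R ⊕ (t ⊕ ⁅ u ⁆))))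

  acc-⊕ : ∀ R S us ts → acc (R ⊕ S) us ts ≡ acc R us ts ⊕ S
  acc-⊕ R S []       ts       = refl
  acc-⊕ R S (u ∷ us) []       = refl
  acc-⊕ R S (u ∷ us) (t ∷ ts) = trans (cong (λ w → acc w us ts) (⊕-swapʳ R S (t ⊕ ⁅ u ⁆))) (acc-⊕ (R ⊕ (t ⊕ ⁅ u ⁆)) S us ts)

  ⋃ : List (Subset n) → Subset n
  ⋃ []       = ⊥
  ⋃ (t ∷ ts) = t ∪ ⋃ ts

  ∋-⊕ˡ : (r t : Subset n) (x : Fin n) → r ∋ x → lookup t x ≡ false → r ⊕ t ∋ x
  ∋-⊕ˡ r t x h₁ h₂ = trans (lookup-⊕ r t x) (cong₂ _xor_ h₁ h₂)

  lookup-⁅⁆-≢ : (u x : Fin n) → u ≢ x → lookup ⁅ u ⁆ x ≡ false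
  lookup-⁅⁆-≢ u x h with lookup ⁅ u ⁆ x in eq
  ... | false = refl
  ... | true  = contradiction (∋-⁅⁆ u x eq) h

  -- A point of `R` has to be cancelled by a later summand `t ⊕ ⁅ u ⁆`, so it lies in a later `t` or
  -- is one of the later `u`.
  acc-∋ : ∀ R us ts x → empty (acc R us ts) ≡ true → R ∋ x → (⋃ ts ∋ x) ⊎ (x ∈ us)
  acc-∋ R []       ts       x e h = contradiction (trans (sym e) (empty-∋ R x h)) λ ()
  acc-∋ R (u ∷ us) []       x e h = contradiction (trans (sym e) (empty-∋ R x h)) λ ()
  acc-∋ R (u ∷ us) (t ∷ ts) x e h with lookup t x in eq | u ≟ x
  ... | true  | _        = inj₁ (∋-∪ˡ t (⋃ ts) x eq)
  ... | false | yes refl = inj₂ (here refl)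
  ... | false | no u≢x with acc-∋ (R ⊕ (t ⊕ ⁅ u ⁆)) us ts x e
                (∋-⊕ˡ R (t ⊕ ⁅ u ⁆) x h (trans (lookup-⊕ t ⁅ u ⁆ x) (cong₂ _xor_ eq (lookup-⁅⁆-≢ u x u≢x))))
  ...   | inj₁ p = inj₁ (∋-∪ʳ t (⋃ ts) x p)
  ...   | inj₂ p = inj₂ (there p)

  meets : Subset n → Subset n → Bool
  meets K t = s₀ ≤ᵇ ∣ t ∩ K ∣

  -- The number of expensive members, those with up to `Δ` choices, when the tuple is read from the
  -- front; `bw` is the same from the back.
  fw : Subset n → List (Subset n) → ℕ
  fw K []       = 0
  fw K (t ∷ ts) = 𝟙 (not (meets K t)) + fw (K ∪ t) ts

  bw : List (Subset n) → ℕ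
  bw []       = 0
  bw (t ∷ ts) = 𝟙 (not (meets (⋃ ts) t)) + bw ts

  meets-false : ∀ K t → meets K t ≡ false → ∣ t ∩ K ∣ <ᴺ s₀
  meets-false K t h with s₀ ≤? ∣ t ∩ K ∣
  ... | yes p = contradiction (trans (sym h) (≤ᵇ-true p)) λ ()
  ... | no p = ≰⇒> p

  -- As the sum vanishes, each point of a member lies in what was read before, in `Z`, or in a later
  -- member. One of these holds `s₀` of its points, and it is not `Z`; so no member is expensive in
  -- both directions. The invariant that `K` contains `us` takes care of the points removed from the
  -- members.
  fw+bw≤ : ∀ K Z R us ts → Good us ts → (∀ x → R ∋ x → (K ∋ x) ⊎ (Z ∋ x)) → (∀ x → x ∈ us → K ∋ x) →
    empty (acc R us ts) ≡ true → (∀ t → t ∈ ts → meets Z t ≡ false) → fw K ts + bw ts ≤ length us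
  fw+bw≤ K Z R []       []       good hR hU e hZ = z≤n
  fw+bw≤ K Z R (u ∷ us) (t ∷ ts) (inP , len) hR hU e hZ =
    ≤-trans (≤-reflexive (+-interchange (𝟙 (not (meets K t))) _ (𝟙 (not (meets (⋃ ts) t))) _))
      (+-mono-≤ one (fw+bw≤ (K ∪ t) Z (R ⊕ (t ⊕ ⁅ u ⁆)) us ts ((λ x x∈ → inP x (there x∈)) , suc-injective len) hR′
        (λ x x∈ → ∋-∪ˡ K t x (hU x (there x∈))) e (λ x x∈ → hZ x (there x∈))))
    where
    hR′ : ∀ x → R ⊕ (t ⊕ ⁅ u ⁆) ∋ x → (K ∪ t ∋ x) ⊎ (Z ∋ x)
    hR′ x h with ∋-⊕⁻ R (t ⊕ ⁅ u ⁆) x h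
    ... | inj₁ p with hR x p
    ...   | inj₁ q = inj₁ (∋-∪ˡ K t x q)
    ...   | inj₂ q = inj₂ q
    hR′ x h | inj₂ p with ∋-⊕⁻ t ⁅ u ⁆ x p
    ...   | inj₁ q = inj₁ (∋-∪ʳ K t x q)
    ...   | inj₂ q = inj₁ (∋-∪ˡ K t x (subst (K ∋_) (∋-⁅⁆ u x q) (hU u (here refl))))
    cover : ∀ x → t ∋ x → (K ∋ x) ⊎ (Z ∋ x) ⊎ (⋃ ts ∋ x)
    cover x h with lookup K x in eqK | lookup Z x in eqZ | lookup R x in eqR
    ... | true  | _     | _     = inj₁ refl
    ... | false | true  | _     = inj₂ (inj₁ refl)
    ... | false | false | true  with hR x eqR
    ...   | inj₁ p = contradiction (trans (sym eqK) p) λ ()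
    ...   | inj₂ p = contradiction (trans (sym eqZ) p) λ ()
    cover x h | false | false | false with acc-∋ (R ⊕ (t ⊕ ⁅ u ⁆)) us ts x e
        (trans (lookup-⊕ R _ x) (cong₂ _xor_ eqR (∋-⊕ˡ t ⁅ u ⁆ x h
          (lookup-⁅⁆-≢ u x (λ { refl → contradiction (trans (sym eqK) (hU u (here refl))) λ () })))))
    ...   | inj₁ p = inj₂ (inj₂ p)
    ...   | inj₂ p = contradiction (trans (sym eqK) (hU x (there p))) λ ()
    one : 𝟙 (not (meets K t)) + 𝟙 (not (meets (⋃ ts) t)) ≤ 1
    one with meets K t in eq₁ | meets (⋃ ts) t in eq₂
    ... | true  | b     = 𝟙≤1 (not b)
    ... | false | true  = s≤s z≤n
    ... | false | false = contradiction (≤-trans (size≥ t (inP t (here refl))) (∣∣-cover₃ t K Z (⋃ ts) cover))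
      (<⇒≱ (+-mono-< (meets-false K t eq₁) (+-mono-< (meets-false Z t (hZ t (here refl))) (meets-false (⋃ ts) t eq₂))))

  -- The indicator of `x < h`: what remains of the budget `h` after one expensive member, none being
  -- possible at budget 0.
  pred≤ : ℕ → ℕ → ℕ
  pred≤ zero    x = 0
  pred≤ (suc h) x = 𝟙 (x ≤ᵇ h)

  step : ∀ b x h → 𝟙 ((𝟙 (not b) + x) ≤ᵇ h) ≤ 𝟙 b * 𝟙 (x ≤ᵇ h) + pred≤ h x
  step true  x h       = ≤-trans (≤-reflexive (sym (*-identityˡ _))) (m≤m+n _ _)
  step false x zero    = z≤n
  step false x (suc h) = 𝟙-mono (λ e → ≤ᵇ-true (≤-pred (true-≤ᵇ (suc x) (suc h) e)))

  step-wt : ∀ v b x h → 𝟙 v * 𝟙 ((𝟙 (not b) + x) ≤ᵇ h) ≤ 𝟙 b * 𝟙 (x ≤ᵇ h) + 𝟙 v * pred≤ h x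
  step-wt true  b x h = ≤-trans (≤-reflexive (*-identityˡ _)) (≤-trans (step b x h) (+-monoʳ-≤ (𝟙 b * 𝟙 (x ≤ᵇ h)) (≤-reflexive (sym (*-identityˡ _)))))
  step-wt false b x h = z≤n

  Zp : ℕ → ℕ → ℕ
  Zp j zero    = 0
  Zp j (suc h) = suc C ^ j * Δ ^ h

  ∑T-pred : ∀ us (x : List (Subset n) → ℕ) h →
    (∀ h → ∑T us (λ ts → 𝟙 (x ts ≤ᵇ h)) ≤ suc C ^ length us * Δ ^ h) → ∑T us (λ ts → pred≤ h (x ts)) ≤ Zp (length us) h
  ∑T-pred us x zero    ih = ≤-reflexive (∑T-*ˡ us 0 (λ _ → 0))
  ∑T-pred us x (suc h) ih = ih h

  Δ*Zp : ∀ j h → Δ * Zp j h ≤ suc C ^ j * Δ ^ h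
  Δ*Zp j zero    = ≤-trans (≤-reflexive (*-zeroʳ Δ)) z≤n
  Δ*Zp j (suc h) = ≤-reflexive (*-swapˡ Δ (suc C ^ j) (Δ ^ h))

  -- The induction step of both counts: a cheap member has `C` choices and keeps the budget, an
  -- expensive one has `Δ` choices and uses one unit of it. Together they give a factor `suc C`.
  C*+Δ*Zp : ∀ j h → C * (suc C ^ j * Δ ^ h) + Δ * Zp j h ≤ suc C ^ suc j * Δ ^ h
  C*+Δ*Zp j h = ≤-trans (+-monoʳ-≤ (C * (suc C ^ j * Δ ^ h)) (Δ*Zp j h)) (≤-reflexive (perm C (suc C ^ j) (Δ ^ h)))
    where
    perm : ∀ c x y → c * (x * y) + x * y ≡ (suc c * x) * y
    perm = ℕR.solve-∀

  1≤Δ^ : ∀ h → 1 ≤ Δ ^ h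
  1≤Δ^ h = m^n>0 Δ {{>-nonZero 1≤Δ}} h

  ∑T-fw : ∀ us K h → ∣ K ∣ + length us * s ≤ κ → ∑T us (λ ts → 𝟙 (fw K ts ≤ᵇ h)) ≤ suc C ^ length us * Δ ^ h
  ∑T-fw []       K h _  = ≤-trans (1≤Δ^ h) (≤-reflexive (sym (*-identityˡ _)))
  ∑T-fw (u ∷ us) K h hK = begin
    ∑ P (λ t → wt t u * ∑T us (λ ts → 𝟙 (fw K (t ∷ ts) ≤ᵇ h)))
      ≡⟨ ∑-cong P (λ t → sym (∑T-*ˡ us (wt t u) _)) ⟩
    ∑ P (λ t → ∑T us (λ ts → wt t u * 𝟙 (fw K (t ∷ ts) ≤ᵇ h)))
      -- For a cheap member the condition that it contains `u` is dropped, because `overlaps`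
      -- already bounds the number of choices.
      ≤⟨ ∑-mono P (λ t → ∑T-mono us (λ ts _ → step-wt (lookup t u) (meets K t) (fw (K ∪ t) ts) h)) ⟩
    ∑ P (λ t → ∑T us (λ ts → 𝟙 (meets K t) * 𝟙 (fw (K ∪ t) ts ≤ᵇ h) + wt t u * pred≤ h (fw (K ∪ t) ts)))
      ≡⟨ ∑-cong P (λ t → trans (∑T-+ us _ _) (cong₂ _+_ (∑T-*ˡ us (𝟙 (meets K t)) _) (∑T-*ˡ us (wt t u) _))) ⟩
    ∑ P (λ t → 𝟙 (meets K t) * ∑T us (λ ts → 𝟙 (fw (K ∪ t) ts ≤ᵇ h)) + wt t u * ∑T us (λ ts → pred≤ h (fw (K ∪ t) ts)))
      ≤⟨ ∑-mono∈ P (λ t t∈ → +-mono-≤ (*-monoʳ-≤ (𝟙 (meets K t)) (∑T-fw us (K ∪ t) h (hK′ t t∈)))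
           (*-monoʳ-≤ (wt t u) (∑T-pred us (fw (K ∪ t)) h (λ h → ∑T-fw us (K ∪ t) h (hK′ t t∈))))) ⟩
    ∑ P (λ t → 𝟙 (meets K t) * (suc C ^ j * Δ ^ h) + wt t u * Zp j h)
      ≡⟨ trans (∑-+ P _ _) (cong₂ _+_ (∑-*ʳ P (suc C ^ j * Δ ^ h) _) (∑-*ʳ P (Zp j h) _)) ⟩
    ∑ P (λ t → 𝟙 (meets K t)) * (suc C ^ j * Δ ^ h) + ∑ P (λ t → wt t u) * Zp j h
      ≤⟨ +-mono-≤ (*-monoˡ-≤ (suc C ^ j * Δ ^ h) (overlaps K (≤-trans (m≤m+n _ _) hK))) (*-monoˡ-≤ (Zp j h) (degree u)) ⟩
    C * (suc C ^ j * Δ ^ h) + Δ * Zp j h ≤⟨ C*+Δ*Zp j h ⟩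
    suc C ^ suc j * Δ ^ h ∎
    where
    open ≤-Reasoning
    j = length us
    hK′ : ∀ t → t ∈ P → ∣ K ∪ t ∣ + j * s ≤ κ
    hK′ t t∈ = ≤-trans (+-monoˡ-≤ (j * s) (≤-trans (∣∪∣≤ K t) (+-monoʳ-≤ ∣ K ∣ (size≤ t t∈)))) (≤-trans (≤-reflexive (+-assoc ∣ K ∣ s (j * s))) hK)

  ∣⋃∣≤ : ∀ ts → (∀ t → t ∈ ts → t ∈ P) → ∣ ⋃ ts ∣ ≤ length ts * s
  ∣⋃∣≤ []       h = ≤-reflexive (SubP.∣⊥∣≡0 n)
  ∣⋃∣≤ (t ∷ ts) h = ≤-trans (∣∪∣≤ t (⋃ ts)) (+-mono-≤ (size≤ t (h t (here refl))) (∣⋃∣≤ ts (λ x x∈ → h x (there x∈))))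

  -- Here the first member is compared with all later ones, so its sum has to become the innermost
  -- one.
  ∑T-bw : ∀ us h → length us * s ≤ κ → ∑T us (λ ts → 𝟙 (bw ts ≤ᵇ h)) ≤ suc C ^ length us * Δ ^ h
  ∑T-bw []       h _  = ≤-trans (1≤Δ^ h) (≤-reflexive (sym (*-identityˡ _)))
  ∑T-bw (u ∷ us) h hκ = begin
    ∑ P (λ t → wt t u * ∑T us (λ ts → 𝟙 (bw (t ∷ ts) ≤ᵇ h)))
      ≡⟨ trans (∑-cong P (λ t → sym (∑T-*ˡ us (wt t u) _))) (∑T-swap us P _) ⟩
    ∑T us (λ ts → ∑ P (λ t → wt t u * 𝟙 (bw (t ∷ ts) ≤ᵇ h)))
      ≤⟨ ∑T-mono us (λ ts good → ≤-trans (∑-mono P (λ t → step-wt (lookup t u) (meets (⋃ ts) t) (bw ts) h))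
           (≤-trans (≤-reflexive (trans (∑-+ P _ _) (cong₂ _+_ (∑-*ʳ P (𝟙 (bw ts ≤ᵇ h)) _) (∑-*ʳ P (pred≤ h (bw ts)) _))))
             (+-mono-≤ (*-monoˡ-≤ (𝟙 (bw ts ≤ᵇ h)) (overlaps (⋃ ts) (≤-trans (∣⋃∣≤ ts (proj₁ good))
                 (≤-trans (≤-reflexive (cong (_* s) (proj₂ good))) hκ′)))) (*-monoˡ-≤ (pred≤ h (bw ts)) (degree u))))) ⟩
    ∑T us (λ ts → C * 𝟙 (bw ts ≤ᵇ h) + Δ * pred≤ h (bw ts))
      ≡⟨ trans (∑T-+ us _ _) (cong₂ _+_ (∑T-*ˡ us C _) (∑T-*ˡ us Δ _)) ⟩
    C * ∑T us (λ ts → 𝟙 (bw ts ≤ᵇ h)) + Δ * ∑T us (λ ts → pred≤ h (bw ts))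
      ≤⟨ +-mono-≤ (*-monoʳ-≤ C (∑T-bw us h hκ′)) (*-monoʳ-≤ Δ (∑T-pred us bw h (λ h → ∑T-bw us h hκ′))) ⟩
    C * (suc C ^ j * Δ ^ h) + Δ * Zp j h ≤⟨ C*+Δ*Zp j h ⟩
    suc C ^ suc j * Δ ^ h ∎
    where
    open ≤-Reasoning
    j = length us
    hκ′ : j * s ≤ κ
    hκ′ = ≤-trans (m≤n+m _ s) hκ

  half : ∀ a b j h → a + b ≤ j → j ≤ suc (h + h) → 1 ≤ 𝟙 (a ≤ᵇ h) + 𝟙 (b ≤ᵇ h)
  half a b j h ab jh with a ≤? h | b ≤? h
  ... | yes p | _     = ≤-trans (𝟙≡1 (≤ᵇ-true p)) (m≤m+n _ _)
  ... | no _  | yes q = ≤-trans (𝟙≡1 (≤ᵇ-true q)) (m≤n+m _ (𝟙 (a ≤ᵇ h)))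
  ... | no p  | no q  = contradiction (≤-trans (+-mono-≤ (≰⇒> p) (≰⇒> q)) (≤-trans ab jh))
    (<⇒≱ (s≤s (≤-reflexive (sym (+-suc h h)))))

  ∑T-half : ∀ us K h → ∣ K ∣ + length us * s ≤ κ →
    ∑T us (λ ts → 𝟙 (fw K ts ≤ᵇ h) + 𝟙 (bw ts ≤ᵇ h)) ≤ 2 * (suc C ^ length us * Δ ^ h)
  ∑T-half us K h hK = ≤-trans (≤-reflexive (∑T-+ us _ _)) (≤-trans (+-mono-≤ (∑T-fw us K h hK) (∑T-bw us h (≤-trans (m≤n+m _ ∣ K ∣) hK)))
    (≤-reflexive (cong (λ w → suc C ^ length us * Δ ^ h + w) (sym (+-identityʳ _)))))

  -- With nothing held aside, one of the two directions has at most `h` expensive members. Each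
  -- factor thus costs about the square root of `Δ`.
  N-≤ : ∀ us R K h → length us ≤ suc (h + h) → R ⊆′ K → (∀ x → x ∈ us → K ∋ x) → ∣ K ∣ + length us * s ≤ κ →
    N us R ≤ 2 * (suc C ^ length us * Δ ^ h)
  N-≤ us R K h lh hR hU hK = ≤-trans (≤-reflexive (N-∑T us R)) (≤-trans (∑T-mono us bound) (∑T-half us K h hK))
    where
    bound : ∀ ts → Good us ts → 𝟙 (empty (acc R us ts)) ≤ 𝟙 (fw K ts ≤ᵇ h) + 𝟙 (bw ts ≤ᵇ h)
    bound ts good with empty (acc R us ts) in eq
    ... | false = z≤n
    ... | true  = half (fw K ts) (bw ts) (length us) h
      (fw+bw≤ K ⊥ R us ts good (λ x p → inj₁ (hR x p)) hU eq (λ t _ → no-meet t)) lh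
      where
      no-meet : ∀ t → meets ⊥ t ≡ false
      no-meet t with meets ⊥ t in eq
      ... | false = refl
      ... | true = contradiction (≤-trans 1≤s₀ (≤-trans (true-≤ᵇ s₀ _ eq) (≤-trans (SubP.∣p∩q∣≤∣q∣ t ⊥) (≤-reflexive (SubP.∣⊥∣≡0 n))))) λ ()

  -- A union bound over the position of a member satisfying `Q`. Once this member is moved in front,
  -- the other positions are counted by an ordinary `N`.
  ∑T-pick : (Q : Subset n → Bool) (us : List (Fin n)) (R : Subset n) →
    ∑T us (λ ts → 𝟙 (empty (acc R us ts)) * 𝟙 (any𝟚 Q ts)) ≤
    ∑ (picks us) (λ q → ∑ P (λ t → wt t (proj₁ q) * (𝟙 (Q t) * N (proj₂ q) (R ⊕ (t ⊕ ⁅ proj₁ q ⁆)))))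
  ∑T-pick Q []       R = ≤-reflexive (*-zeroʳ (𝟙 (empty R)))
  ∑T-pick Q (u ∷ us) R = begin
    ∑ P (λ t → wt t u * ∑T us (λ ts → 𝟙 (empty (acc (R ⊕ (t ⊕ ⁅ u ⁆)) us ts)) * 𝟙 (Q t ∨ any𝟚 Q ts)))
      ≤⟨ ∑-mono P (λ t → *-monoʳ-≤ (wt t u) (inner t)) ⟩
    ∑ P (λ t → wt t u * (𝟙 (Q t) * N us (R ⊕ (t ⊕ ⁅ u ⁆)) + rest (R ⊕ (t ⊕ ⁅ u ⁆))))
      ≡⟨ trans (∑-cong P (λ t → *-distribˡ-+ (wt t u) _ _)) (∑-+ P _ _) ⟩
    ∑ P (λ t → wt t u * (𝟙 (Q t) * N us (R ⊕ (t ⊕ ⁅ u ⁆)))) + ∑ P (λ t → wt t u * rest (R ⊕ (t ⊕ ⁅ u ⁆)))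
      ≡⟨ cong (λ w → ∑ P (λ t → wt t u * (𝟙 (Q t) * N us (R ⊕ (t ⊕ ⁅ u ⁆)))) + w) swap ⟩
    ∑ P (λ t → wt t u * (𝟙 (Q t) * N us (R ⊕ (t ⊕ ⁅ u ⁆)))) +
      ∑ (map (λ q → proj₁ q , u ∷ proj₂ q) (picks us)) (λ q → ∑ P (λ t → wt t (proj₁ q) * (𝟙 (Q t) * N (proj₂ q) (R ⊕ (t ⊕ ⁅ proj₁ q ⁆))))) ∎
    where
    open ≤-Reasoning
    rest : Subset n → ℕ
    rest R = ∑ (picks us) (λ q → ∑ P (λ t → wt t (proj₁ q) * (𝟙 (Q t) * N (proj₂ q) (R ⊕ (t ⊕ ⁅ proj₁ q ⁆)))))
    𝟙-∨ : ∀ x a b → x * 𝟙 (a ∨ b) ≤ 𝟙 a * x + x * 𝟙 b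
    𝟙-∨ x true  b = ≤-trans (≤-reflexive (trans (*-identityʳ x) (sym (*-identityˡ x)))) (m≤m+n _ _)
    𝟙-∨ x false b = ≤-refl
    inner : ∀ t → ∑T us (λ ts → 𝟙 (empty (acc (R ⊕ (t ⊕ ⁅ u ⁆)) us ts)) * 𝟙 (Q t ∨ any𝟚 Q ts)) ≤ 𝟙 (Q t) * N us (R ⊕ (t ⊕ ⁅ u ⁆)) + rest (R ⊕ (t ⊕ ⁅ u ⁆))
    inner t = ≤-trans (∑T-mono us (λ ts _ → 𝟙-∨ (𝟙 (empty (acc (R ⊕ (t ⊕ ⁅ u ⁆)) us ts))) (Q t) (any𝟚 Q ts)))
      (≤-trans (≤-reflexive (trans (∑T-+ us _ _) (cong (λ w → w + ∑T us (λ ts → 𝟙 (empty (acc (R ⊕ (t ⊕ ⁅ u ⁆)) us ts)) * 𝟙 (any𝟚 Q ts)))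
          (trans (∑T-*ˡ us (𝟙 (Q t)) _) (cong (λ w → 𝟙 (Q t) * w) (sym (N-∑T us (R ⊕ (t ⊕ ⁅ u ⁆)))))))))
        (+-monoʳ-≤ (𝟙 (Q t) * N us (R ⊕ (t ⊕ ⁅ u ⁆))) (∑T-pick Q us (R ⊕ (t ⊕ ⁅ u ⁆)))))
    perm : ∀ x y z w → x * (y * (z * w)) ≡ y * (z * (x * w))
    perm = ℕR.solve-∀
    swap : ∑ P (λ t → wt t u * rest (R ⊕ (t ⊕ ⁅ u ⁆))) ≡
      ∑ (map (λ q → proj₁ q , u ∷ proj₂ q) (picks us)) (λ q → ∑ P (λ t → wt t (proj₁ q) * (𝟙 (Q t) * N (proj₂ q) (R ⊕ (t ⊕ ⁅ proj₁ q ⁆)))))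
    swap = trans (trans (∑-cong P (λ t → sym (∑-*ˡ (picks us) (wt t u) _))) (∑-swap P (picks us) _))
      (trans (∑-cong (picks us) (λ q → trans (trans (∑-cong P (λ t → sym (∑-*ˡ P (wt t u) _))) (∑-swap P P _))
          (∑-cong P (λ t′ → trans (∑-cong P (λ t → trans (perm (wt t u) (wt t′ (proj₁ q)) (𝟙 (Q t′)) _)
              (cong (λ w → wt t′ (proj₁ q) * (𝟙 (Q t′) * (wt t u * N (proj₂ q) w))) (⊕-swapʳ R (t ⊕ ⁅ u ⁆) (t′ ⊕ ⁅ proj₁ q ⁆)))))
            (trans (∑-*ˡ P (wt t′ (proj₁ q)) _) (cong (λ w → wt t′ (proj₁ q) * w) (∑-*ˡ P (𝟙 (Q t′)) _)))))))
        (sym (∑-map _ (picks us) _)))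

  meeting : Fin n → Fin n → ℕ
  meeting u v = ∑ P (λ t → wt t u * ∑ P (λ t′ → wt t′ v * 𝟙 (meets t t′)))

  -- Either t₁ meets some other member in s₀ points, or it is determined by the others through the vanishing of the sum.
  N-odd-≤ : ∀ u us R K h → length us ≡ suc (h + h) → R ⊆′ K → (∀ x → x ∈ u ∷ us → K ∋ x) →
    ∣ K ∣ + (s + (s + length us * s)) ≤ κ →
    N (u ∷ us) R ≤ 2 * (suc C ^ suc (h + h) * Δ ^ h) + 2 * (suc C ^ (h + h) * Δ ^ h) * ∑ us (meeting u)
  N-odd-≤ u us R K h len hR hU hK = begin
    N (u ∷ us) R ≡⟨ ∑-cong P (λ t → cong (λ w → wt t u * w) (N-∑T us (R ⊕ (t ⊕ ⁅ u ⁆)))) ⟩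
    ∑ P (λ t → wt t u * ∑T us (E t)) ≡⟨ ∑-cong P (λ t → sym (∑T-*ˡ us (wt t u) _)) ⟩
    ∑ P (λ t → ∑T us (λ ts → wt t u * E t ts)) ≤⟨ ∑-mono P (λ t → ∑T-mono us (cases t)) ⟩
    ∑ P (λ t → ∑T us (λ ts → E t ts * hb ts + wt t u * (E t ts * 𝟙 (any𝟚 (meets t) ts))))
      ≡⟨ trans (∑-cong P (λ t → ∑T-+ us _ _)) (∑-+ P _ _) ⟩
    ∑ P (λ t → ∑T us (λ ts → E t ts * hb ts)) + ∑ P (λ t → ∑T us (λ ts → wt t u * (E t ts * 𝟙 (any𝟚 (meets t) ts))))
      ≤⟨ +-mono-≤ determined meet ⟩
    2 * (suc C ^ suc (h + h) * Δ ^ h) + 2 * (suc C ^ (h + h) * Δ ^ h) * ∑ us (meeting u) ∎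
    where
    open ≤-Reasoning
    E : Subset n → List (Subset n) → ℕ
    E t ts = 𝟙 (empty (acc (R ⊕ (t ⊕ ⁅ u ⁆)) us ts))
    hb : List (Subset n) → ℕ
    hb ts = 𝟙 (fw K ts ≤ᵇ h) + 𝟙 (bw ts ≤ᵇ h)
    cases : ∀ t ts → Good us ts → wt t u * E t ts ≤ E t ts * hb ts + wt t u * (E t ts * 𝟙 (any𝟚 (meets t) ts))
    cases t ts good with lookup t u in eqt
    ... | false = z≤n
    ... | true with empty (acc (R ⊕ (t ⊕ ⁅ u ⁆)) us ts) in eqE | any𝟚 (meets t) ts in eqA
    ...   | false | _     = z≤n
    ...   | true  | true  = m≤n+m 1 (1 * hb ts)
    -- `t` meets no other member and serves as the set `Z` held aside, so budget `h` suffices for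
    -- the other `2h + 1` members. For all `2h + 2` of them `N-≤` would cost one more factor `Δ`.
    ...   | true  | false = ≤-trans (half (fw K ts) (bw ts) (length us) h
            (fw+bw≤ K t (R ⊕ (t ⊕ ⁅ u ⁆)) us ts good sub (λ x x∈ → hU x (there x∈)) eqE (any𝟚-false (meets t) ts eqA)) (≤-reflexive len))
            (≤-trans (≤-reflexive (sym (*-identityˡ (hb ts)))) (m≤m+n _ _))
      where
      sub : ∀ x → R ⊕ (t ⊕ ⁅ u ⁆) ∋ x → (K ∋ x) ⊎ (t ∋ x)
      sub x p with ∋-⊕⁻ R (t ⊕ ⁅ u ⁆) x p
      ... | inj₁ q = inj₁ (hR x q)
      ... | inj₂ q with ∋-⊕⁻ t ⁅ u ⁆ x q
      ...   | inj₁ r = inj₂ r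
      ...   | inj₂ r = inj₁ (subst (K ∋_) (∋-⁅⁆ u x r) (hU u (here refl)))
    shift : ∀ t ts → acc (R ⊕ (t ⊕ ⁅ u ⁆)) us ts ≡ (acc R us ts ⊕ ⁅ u ⁆) ⊕ t
    shift t ts = trans (acc-⊕ R (t ⊕ ⁅ u ⁆) us ts) (trans (cong (acc R us ts ⊕_) (⊕-comm t ⁅ u ⁆)) (sym (⊕-assoc (acc R us ts) ⁅ u ⁆ t)))
    determined : ∑ P (λ t → ∑T us (λ ts → E t ts * hb ts)) ≤ 2 * (suc C ^ suc (h + h) * Δ ^ h)
    determined = begin
      ∑ P (λ t → ∑T us (λ ts → E t ts * hb ts)) ≡⟨ ∑T-swap us P _ ⟩
      ∑T us (λ ts → ∑ P (λ t → E t ts * hb ts))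
        ≤⟨ ∑T-mono us (λ ts _ → ≤-trans (≤-reflexive (∑-*ʳ P (hb ts) _)) (≤-trans (*-monoˡ-≤ (hb ts)
             (≤-trans (≤-reflexive (∑-cong P (λ t → cong (𝟙 ∘ empty) (shift t ts)))) (once (acc R us ts ⊕ ⁅ u ⁆)))) (≤-reflexive (*-identityˡ _)))) ⟩
      ∑T us hb ≤⟨ ∑T-half us K h (≤-trans (+-monoʳ-≤ ∣ K ∣ (≤-trans (m≤n+m _ s) (m≤n+m _ s))) hK) ⟩
      2 * (suc C ^ length us * Δ ^ h) ≡⟨ cong (λ l → 2 * (suc C ^ l * Δ ^ h)) len ⟩
      2 * (suc C ^ suc (h + h) * Δ ^ h) ∎
    Z : ℕ
    Z = 2 * (suc C ^ (h + h) * Δ ^ h)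
    rest≤ : ∀ q → q ∈ picks us → ∀ t → t ∈ P → ∀ t′ → t′ ∈ P →
      N (proj₂ q) (R ⊕ (t ⊕ ⁅ u ⁆) ⊕ (t′ ⊕ ⁅ proj₁ q ⁆)) ≤ Z
    -- Without the two meeting members `2h` positions remain. The known set grows by `t` and `t′`,
    -- for which `hK` reserves the two extra summands `s`.
    rest≤ (v , us′) q∈ t t∈ t′ t′∈ = ≤-trans (N-≤ us′ _ (K ∪ (t ∪ t′)) h (≤-trans (≤-reflexive len′) (n≤1+n _)) sub
        (λ x x∈ → ∋-∪ˡ K (t ∪ t′) x (hU x (there (picks-⊆ us q∈ x∈)))) size)
      (≤-reflexive (cong (λ l → 2 * (suc C ^ l * Δ ^ h)) len′))
      where
      len′ : length us′ ≡ h + h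
      len′ = suc-injective (trans (picks-length us q∈) len)
      size : ∣ K ∪ (t ∪ t′) ∣ + length us′ * s ≤ κ
      size = begin
        ∣ K ∪ (t ∪ t′) ∣ + length us′ * s
          ≤⟨ +-mono-≤ (≤-trans (∣∪∣≤ K (t ∪ t′)) (+-monoʳ-≤ ∣ K ∣ (≤-trans (∣∪∣≤ t t′) (+-mono-≤ (size≤ t t∈) (size≤ t′ t′∈)))))
               (*-monoˡ-≤ s (≤-trans (n≤1+n _) (≤-reflexive (picks-length us q∈)))) ⟩
        ∣ K ∣ + (s + s) + length us * s ≡⟨ rearr ∣ K ∣ s (length us * s) ⟩
        ∣ K ∣ + (s + (s + length us * s)) ≤⟨ hK ⟩
        κ ∎
        where
        rearr : ∀ a b c → a + (b + b) + c ≡ a + (b + (b + c))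
        rearr = ℕR.solve-∀
      in⁅⁆ : ∀ w x → w ∈ u ∷ us → ⁅ w ⁆ ∋ x → K ∪ (t ∪ t′) ∋ x
      in⁅⁆ w x w∈ r = ∋-∪ˡ K (t ∪ t′) x (subst (K ∋_) (∋-⁅⁆ w x r) (hU w w∈))
      sub : R ⊕ (t ⊕ ⁅ u ⁆) ⊕ (t′ ⊕ ⁅ v ⁆) ⊆′ K ∪ (t ∪ t′)
      sub x p with ∋-⊕⁻ (R ⊕ (t ⊕ ⁅ u ⁆)) (t′ ⊕ ⁅ v ⁆) x p
      sub x p | inj₁ q with ∋-⊕⁻ R (t ⊕ ⁅ u ⁆) x q
      ... | inj₁ r = ∋-∪ˡ K (t ∪ t′) x (hR x r)
      ... | inj₂ r with ∋-⊕⁻ t ⁅ u ⁆ x r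
      ...   | inj₁ w = ∋-∪ʳ K (t ∪ t′) x (∋-∪ˡ t t′ x w)
      ...   | inj₂ w = in⁅⁆ u x (here refl) w
      sub x p | inj₂ q with ∋-⊕⁻ t′ ⁅ v ⁆ x q
      ...   | inj₁ w = ∋-∪ʳ K (t ∪ t′) x (∋-∪ʳ t t′ x w)
      ...   | inj₂ w = in⁅⁆ v x (there (picks-∈ us q∈)) w
    perm : ∀ a b c → a * (b * c) ≡ c * (a * b)
    perm = ℕR.solve-∀
    meet : ∑ P (λ t → ∑T us (λ ts → wt t u * (E t ts * 𝟙 (any𝟚 (meets t) ts)))) ≤ Z * ∑ us (meeting u)
    meet = begin
      ∑ P (λ t → ∑T us (λ ts → wt t u * (E t ts * 𝟙 (any𝟚 (meets t) ts))))
        ≡⟨ ∑-cong P (λ t → ∑T-*ˡ us (wt t u) _) ⟩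
      ∑ P (λ t → wt t u * ∑T us (λ ts → E t ts * 𝟙 (any𝟚 (meets t) ts)))
        ≤⟨ ∑-mono P (λ t → *-monoʳ-≤ (wt t u) (∑T-pick (meets t) us (R ⊕ (t ⊕ ⁅ u ⁆)))) ⟩
      ∑ P (λ t → wt t u * ∑ (picks us) (λ q → ∑ P (λ t′ → wt t′ (proj₁ q) * (𝟙 (meets t t′) * N (proj₂ q) (R ⊕ (t ⊕ ⁅ u ⁆) ⊕ (t′ ⊕ ⁅ proj₁ q ⁆))))))
        ≤⟨ ∑-mono∈ P (λ t t∈ → *-monoʳ-≤ (wt t u) (∑-mono∈ (picks us) (λ q q∈ → ∑-mono∈ P (λ t′ t′∈ →
             ≤-trans (*-monoʳ-≤ (wt t′ (proj₁ q)) (*-monoʳ-≤ (𝟙 (meets t t′)) (rest≤ q q∈ t t∈ t′ t′∈)))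
               (≤-reflexive (perm (wt t′ (proj₁ q)) (𝟙 (meets t t′)) Z)))))) ⟩
      ∑ P (λ t → wt t u * ∑ (picks us) (λ q → ∑ P (λ t′ → Z * (wt t′ (proj₁ q) * 𝟙 (meets t t′)))))
        ≡⟨ ∑-cong P (λ t → trans (cong (λ w → wt t u * w) (trans (∑-cong (picks us) (λ q → ∑-*ˡ P Z _)) (∑-*ˡ (picks us) Z _)))
             (*-swapˡ (wt t u) Z _)) ⟩
      ∑ P (λ t → Z * (wt t u * ∑ (picks us) (λ q → ∑ P (λ t′ → wt t′ (proj₁ q) * 𝟙 (meets t t′)))))
        ≡⟨ ∑-*ˡ P Z _ ⟩
      Z * ∑ P (λ t → wt t u * ∑ (picks us) (λ q → ∑ P (λ t′ → wt t′ (proj₁ q) * 𝟙 (meets t t′))))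
        ≡⟨ cong (λ w → Z * w) (trans (∑-cong P (λ t → sym (∑-*ˡ (picks us) (wt t u) _))) (trans (∑-swap P (picks us) _) (∑-picks us (meeting u)))) ⟩
      Z * ∑ us (meeting u) ∎

-- The bound from one scale of spread-out sets

filterB : (A → Bool) → List A → List A
filterB p []       = []
filterB p (x ∷ xs) = if p x then x ∷ filterB p xs else filterB p xs

∑-filterB : (p : A → Bool) (xs : List A) (f : A → ℕ) → ∑ (filterB p xs) f ≡ ∑ xs (λ x → 𝟙 (p x) * f x)
∑-filterB p []       f = refl
∑-filterB p (x ∷ xs) f with p x
... | true  = cong₂ _+_ (sym (*-identityˡ (f x))) (∑-filterB p xs f)
... | false = ∑-filterB p xs f

∈-filterB⁻ : (p : A → Bool) (xs : List A) {x : A} → x ∈ filterB p xs → p x ≡ true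
∈-filterB⁻ p (y ∷ xs) x∈ with p y in eq | x∈
... | true  | here refl = eq
... | true  | there h   = ∈-filterB⁻ p xs h
... | false | h         = ∈-filterB⁻ p xs h

∈-filterB⁺ : (p : A → Bool) (xs : List A) {x : A} → x ∈ xs → p x ≡ true → x ∈ filterB p xs
∈-filterB⁺ p (y ∷ xs) (here refl) h rewrite h = here refl
∈-filterB⁺ p (y ∷ xs) (there x∈) h with p y
... | true  = there (∈-filterB⁺ p xs x∈ h)
... | false = ∈-filterB⁺ p xs x∈ h

∑-filterB≤ : (p : A → Bool) (xs : List A) (f : A → ℕ) → ∑ (filterB p xs) f ≤ ∑ xs f
∑-filterB≤ p xs f = ≤-trans (≤-reflexive (∑-filterB p xs f))
  (∑-mono xs (λ x → ≤-trans (*-monoˡ-≤ (f x) (𝟙≤1 (p x))) (≤-reflexive (*-identityˡ (f x)))))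

∑-els : (e : Subset n) (f : Fin n → ℕ) → ∑ (els e) f ≡ ∑ (allFin n) (λ u → 𝟙 (lookup e u) * f u)
∑-els []          f = refl
∑-els {suc n} (b ∷ e) f = trans (split b) (cong (λ w → 𝟙 b * f zero + w)
  (trans (sym (∑-map suc (allFin n) (λ u → 𝟙 (lookup (b ∷ e) u) * f u)))
    (cong (λ l → ∑ l (λ u → 𝟙 (lookup (b ∷ e) u) * f u)) (ListP.map-tabulate id suc))))
  where
  rest : ∑ (map suc (els e)) f ≡ ∑ (allFin n) (λ u → 𝟙 (lookup e u) * f (suc u))
  rest = trans (∑-map suc (els e) f) (∑-els e (f ∘ suc))
  split : ∀ b → ∑ (els (b ∷ e)) f ≡ 𝟙 b * f zero + ∑ (allFin n) (λ u → 𝟙 (lookup e u) * f (suc u))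
  split true  = cong₂ _+_ (sym (*-identityˡ (f zero))) rest
  split false = rest

∑-lookup : (e : Subset n) → ∑ (allFin n) (λ u → 𝟙 (lookup e u)) ≡ ∣ e ∣
∑-lookup {n} e = trans (∑-cong (allFin n) (λ u → sym (*-identityʳ _))) (trans (sym (∑-els e (λ _ → 1)))
  (trans (∑-const (els e) 1) (trans (*-identityʳ _) (length-els e))))

isEven⇒odd-tail : (us : List A) → isEven us ≡ false → ∃[ h ] (length us ≡ suc (h + h))
isEven⇒odd-tail (u ∷ [])     e = 0 , refl
isEven⇒odd-tail (u ∷ v ∷ us) e with isEven us in eq
... | false with isEven⇒odd-tail us eq
...   | h , l = suc h , cong (λ w → suc (suc w)) (trans l (sym (+-suc h h)))

argmax : (Λ : ℕ) (f : Fin n → ℕ) → (∀ v → f v ≤ Λ) ⊎ ∃[ w ] (Λ ≤ f w × (∀ v → f v ≤ f w))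
argmax {zero}  Λ f = inj₁ (λ ())
argmax {suc n} Λ f with argmax Λ (f ∘ suc) | f zero ≤? Λ
... | inj₁ h | yes p = inj₁ (λ { zero → p ; (suc v) → h v })
... | inj₁ h | no p  = inj₂ (zero , <⇒≤ (≰⇒> p) , λ { zero → ≤-refl ; (suc v) → ≤-trans (h v) (<⇒≤ (≰⇒> p)) })
... | inj₂ (w , Λ≤ , h) | _ with f zero ≤? f (suc w)
...   | yes p = inj₂ (suc w , Λ≤ , λ { zero → p ; (suc v) → h v })
...   | no p  = inj₂ (zero , ≤-trans Λ≤ (<⇒≤ (≰⇒> p)) , λ { zero → ≤-refl ; (suc v) → ≤-trans (h v) (<⇒≤ (≰⇒> p)) })

∣prod∣≤ : (Y : A → ℤ) (x : ℕ) (S : List A) → (∀ v → ℤ.∣ Y v ∣ ≤ x) → ℤ.∣ prod Y S ∣ ≤ x ^ length S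
∣prod∣≤ Y x []      h = ≤-refl
∣prod∣≤ Y x (v ∷ S) h = ≤-trans (≤-reflexive (ℤP.abs-* (Y v) (prod Y S))) (*-mono-≤ (h v) (∣prod∣≤ Y x S h))

-- A crude estimate for points outside the cube, where no cut is available.
∣cutPoly∣≤ : (cf : ℕ → ℕ) (Cw : ℕ) (es : List (List (Fin n))) (k M x : ℕ) (Y : Fin n → ℤ) → (∀ s → cf s ≤ Cw) →
  (∀ e → e ∈ es → length e ≡ k) → M ≤ x → (∀ v → ℤ.∣ Y v ∣ ≤ x) →
  ℤ.∣ cutPoly cf es M Y ∣ ≤ length es * (2 ^ k * (Cw * x ^ k))
∣cutPoly∣≤ cf Cw es k M x Y cf≤ len M≤ Y≤ = ≤-trans (∣∑ᶻ∣≤ es _ _ (λ e → ≤-refl)) (∑-bound es _ edge)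
  where
  open ≤-Reasoning
  edge : ∀ e → e ∈ es → ℤ.∣ ∑ᶻ (splits e) (λ p → + (cf (length (proj₁ p)) * M ^ length (proj₂ p)) ℤ.* prod Y (proj₁ p)) ∣ ≤ 2 ^ k * (Cw * x ^ k)
  edge e e∈ = ≤-trans (∣∑ᶻ∣≤ (splits e) _ _ (λ _ → ≤-refl)) (≤-trans (∑-bound (splits e) (Cw * x ^ k) term)
      (≤-reflexive (cong (_* (Cw * x ^ k)) (trans (length-splits e) (cong (2 ^_) (len e e∈))))))
    where
    term : ∀ p → p ∈ splits e → ℤ.∣ + (cf (length (proj₁ p)) * M ^ length (proj₂ p)) ℤ.* prod Y (proj₁ p) ∣ ≤ Cw * x ^ k
    term (S , R) p∈ = begin
      ℤ.∣ + (cf (length S) * M ^ length R) ℤ.* prod Y S ∣ ≡⟨ ℤP.abs-* (+ (cf (length S) * M ^ length R)) (prod Y S) ⟩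
      cf (length S) * M ^ length R * ℤ.∣ prod Y S ∣
        ≤⟨ *-mono-≤ (*-mono-≤ (cf≤ (length S)) (^-monoˡ-≤ (length R) M≤)) (∣prod∣≤ Y x S Y≤) ⟩
      Cw * x ^ length R * x ^ length S ≡⟨ trans (*-assoc Cw _ _) (cong (λ w → Cw * w) (trans (sym (^-distribˡ-+-* x (length R) (length S)))
            (cong (x ^_) (trans (+-comm (length R) (length S)) (trans (splits-length e p∈) (len e e∈)))))) ⟩
      Cw * x ^ k ∎

prod-replicate : (a : A → ℤ) (m : ℕ) (v : A) → prod a (List.replicate (m + m) v) ≡ + (ℤ.∣ a v ∣ ^ (m + m))
prod-replicate a zero    v = refl
prod-replicate a (suc m) v rewrite +-suc m m = trans (cong (λ w → a v ℤ.* (a v ℤ.* w)) (prod-replicate a m v))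
  (trans (sym (ℤP.*-assoc (a v) (a v) _)) (trans (cong (λ w → w ℤ.* + (ℤ.∣ a v ∣ ^ (m + m))) (square (a v)))
    (trans (sym (ℤP.pos-* (ℤ.∣ a v ∣ * ℤ.∣ a v ∣) _)) (cong +_ (*-assoc ℤ.∣ a v ∣ ℤ.∣ a v ∣ _)))))
  where
  square : ∀ i → i ℤ.* i ≡ + (ℤ.∣ i ∣ * ℤ.∣ i ∣)
  square (+ zero)  = refl
  square (+ suc m) = refl
  square -[1+ m ]  = refl

deg : List (Subset n) → Subset n → ℕ
deg es Y = ∑ es (λ e → 𝟙 (Y ⊆ᵇ e))

codeg : List (Subset n) → Fin n → Fin n → ℕ
codeg es u v = ∑ es (λ e → 𝟙 (lookup e u) * 𝟙 (lookup e v))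

module Level {n : ℕ} (k : ℕ) (2≤k : 2 ≤ k) (es : List (Subset n)) (uni : ∀ e → e ∈ es → ∣ e ∣ ≡ k)
  (cf : ℕ → ℕ) (cf0 : cf 0 ≡ 0) (Cw : ℕ) (cf≤ : ∀ s → cf s ≤ Cw) (σ : ℕ) (bounded : CutBound k cf es σ)
  (s₀ : ℕ) (1≤s₀ : 1 ≤ s₀) (1≤cfs : 1 ≤ cf (4 * s₀)) (mem : Subset n → Bool)
  (B D D₁ β : ℕ) (1≤B : 1 ≤ B) (1≤D : 1 ≤ D) (1≤D₁ : 1 ≤ D₁) (1≤β : 1 ≤ β)
  (size : ∀ t → mem t ≡ true → ∣ t ∣ ≡ 4 * s₀)
  (rich : ∀ t → mem t ≡ true → D ≤ deg es t)
  (spread : ∀ t Y → mem t ≡ true → Y ⊆′ t → s₀ ≤ ∣ Y ∣ → deg es Y ≤ B * D)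
  (degree-≤ : ∀ t u → mem t ≡ true → t ∋ u → deg es ⁅ u ⁆ ≤ D₁)
  (codegree-≤ : ∀ t t′ u v → mem t ≡ true → mem t′ ≡ true → t ∋ u → t′ ∋ v → u ≢ v → codeg es u v ≤ β)
  (κ p p′ : ℕ) (p+p≡ : p + p ≡ p′ + k)
  (κ-rest : k + (4 * s₀ + (4 * s₀ + k * (4 * s₀))) ≤ κ) (κ-moment : 1 + (p + p) * (4 * s₀) ≤ κ) where

  private
    m s C Δ c₀ : ℕ
    m = length es
    s = 4 * s₀
    C = 2 ^ κ * (2 ^ k * B)
    Δ = 2 ^ k * D₁
    c₀ = 2 ^ k * (2 ^ k * (Cw * 2 ^ k))
    P : List (Subset n)
    P = filterB mem (allS n)

    mem! : ∀ {t} → t ∈ P → mem t ≡ true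
    mem! = ∈-filterB⁻ mem (allS n)

    1≤Δ : 1 ≤ Δ
    1≤Δ = *-mono-≤ (m^n>0 2 k) 1≤D₁

    once : ∀ r → ∑ P (λ t → 𝟙 (empty (r ⊕ t))) ≤ 1
    once r = ≤-trans (∑-filterB≤ mem (allS n) _) (≤-reflexive (∑-empty-⊕ r))

    𝟙-* : ∀ {a b c} → (a ≡ true → b ≡ true → c ≡ true) → 𝟙 a * 𝟙 b ≤ 𝟙 c * 𝟙 b
    𝟙-* {true}  {true}  h rewrite h refl refl = ≤-refl
    𝟙-* {true}  {false} h = z≤n
    𝟙-* {false} h = z≤n

    -- Double counting of pairs `t ⊆ e` with `I ⊆ t`: a member lies in at least `D` edges, and an
    -- edge has only `2 ^ k` subsets.
    star : ∀ I → D * ∑ P (λ t → 𝟙 (I ⊆ᵇ t)) ≤ deg es I * 2 ^ k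
    star I = begin
      D * ∑ P (λ t → 𝟙 (I ⊆ᵇ t)) ≡⟨ trans (*-comm D _) (sym (∑-*ʳ P D _)) ⟩
      ∑ P (λ t → 𝟙 (I ⊆ᵇ t) * D) ≤⟨ ∑-mono∈ P (λ t t∈ → *-monoʳ-≤ (𝟙 (I ⊆ᵇ t)) (rich t (mem! t∈))) ⟩
      ∑ P (λ t → 𝟙 (I ⊆ᵇ t) * deg es t) ≡⟨ trans (∑-cong P (λ t → sym (∑-*ˡ es (𝟙 (I ⊆ᵇ t)) _))) (∑-swap P es _) ⟩
      ∑ es (λ e → ∑ P (λ t → 𝟙 (I ⊆ᵇ t) * 𝟙 (t ⊆ᵇ e)))
        ≤⟨ ∑-mono es (λ e → ∑-mono P (λ t → 𝟙-* (λ a b → ⊆ᵇ-complete I e (λ x h → ⊆ᵇ-sound t e b x (⊆ᵇ-sound I t a x h))))) ⟩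
      ∑ es (λ e → ∑ P (λ t → 𝟙 (I ⊆ᵇ e) * 𝟙 (t ⊆ᵇ e)))
        ≤⟨ ∑-mono∈ es (λ e e∈ → ≤-trans (≤-reflexive (∑-*ˡ P (𝟙 (I ⊆ᵇ e)) _)) (*-monoʳ-≤ (𝟙 (I ⊆ᵇ e))
             (≤-trans (∑-filterB≤ mem (allS n) _) (≤-reflexive (trans (#subsets e) (cong (2 ^_) (uni e e∈))))))) ⟩
      ∑ es (λ e → 𝟙 (I ⊆ᵇ e) * 2 ^ k) ≡⟨ ∑-*ʳ es (2 ^ k) _ ⟩
      deg es I * 2 ^ k ∎
      where open ≤-Reasoning

    -- Unless the sum is 0, some member contains `I`. Then `spread` bounds the degree of `I`, and
    -- `D` cancels.
    star-≤ : ∀ I → s₀ ≤ ∣ I ∣ → ∑ P (λ t → 𝟙 (I ⊆ᵇ t)) ≤ 2 ^ k * B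
    star-≤ I hI with ∑ P (λ t → 𝟙 (I ⊆ᵇ t)) in eq
    ... | zero = z≤n
    ... | suc c with ∑-≢0 P _ (λ z → contradiction (trans (sym eq) z) λ ())
    ...   | t , t∈ , h = *-cancelˡ-≤ D {{>-nonZero 1≤D}} (≤-trans (≤-trans (≤-reflexive (cong (λ w → D * w) (sym eq))) (star I))
              (≤-trans (*-monoˡ-≤ (2 ^ k) (spread t I (mem! t∈) (⊆ᵇ-sound I t (𝟙-≢0 h)) hI)) (≤-reflexive (perm B D (2 ^ k)))))
      where
      perm : ∀ b d p → b * d * p ≡ d * (p * b)
      perm = ℕR.solve-∀

    -- The trace `t ∩ K` is one of at most `2 ^ κ` subsets of `K`, and each trace with at least `s₀`
    -- points belongs to few members.
    overlaps : ∀ K → ∣ K ∣ ≤ κ → ∑ P (λ t → 𝟙 (s₀ ≤ᵇ ∣ t ∩ K ∣)) ≤ C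
    overlaps K hK = begin
      ∑ P (λ t → 𝟙 (s₀ ≤ᵇ ∣ t ∩ K ∣)) ≤⟨ ∑-mono P trace ⟩
      ∑ P (λ t → ∑ (allS n) (λ I → 𝟙 (I ⊆ᵇ K) * (𝟙 (s₀ ≤ᵇ ∣ I ∣) * 𝟙 (I ⊆ᵇ t)))) ≡⟨ ∑-swap P (allS n) _ ⟩
      ∑ (allS n) (λ I → ∑ P (λ t → 𝟙 (I ⊆ᵇ K) * (𝟙 (s₀ ≤ᵇ ∣ I ∣) * 𝟙 (I ⊆ᵇ t)))) ≤⟨ ∑-mono (allS n) each ⟩
      ∑ (allS n) (λ I → 𝟙 (I ⊆ᵇ K) * (2 ^ k * B)) ≡⟨ trans (∑-*ʳ (allS n) (2 ^ k * B) _) (cong (_* (2 ^ k * B)) (#subsets K)) ⟩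
      2 ^ ∣ K ∣ * (2 ^ k * B) ≤⟨ *-monoˡ-≤ (2 ^ k * B) (^-monoʳ-≤ 2 hK) ⟩
      C ∎
      where
      open ≤-Reasoning
      trace : ∀ t → 𝟙 (s₀ ≤ᵇ ∣ t ∩ K ∣) ≤ ∑ (allS n) (λ I → 𝟙 (I ⊆ᵇ K) * (𝟙 (s₀ ≤ᵇ ∣ I ∣) * 𝟙 (I ⊆ᵇ t)))
      trace t with s₀ ≤ᵇ ∣ t ∩ K ∣ in eq
      ... | false = z≤n
      ... | true  = ≤-trans (*-mono-≤ (𝟙≡1 (⊆ᵇ-complete (t ∩ K) K (λ x h → proj₂ (∋-∩⁻ t K x h))))
              (*-mono-≤ (𝟙≡1 eq) (𝟙≡1 (⊆ᵇ-complete (t ∩ K) t (λ x h → proj₁ (∋-∩⁻ t K x h))))))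
            (∑-≥ (λ I → 𝟙 (I ⊆ᵇ K) * (𝟙 (s₀ ≤ᵇ ∣ I ∣) * 𝟙 (I ⊆ᵇ t))) (∈-allS (t ∩ K)))
      each : ∀ I → ∑ P (λ t → 𝟙 (I ⊆ᵇ K) * (𝟙 (s₀ ≤ᵇ ∣ I ∣) * 𝟙 (I ⊆ᵇ t))) ≤ 𝟙 (I ⊆ᵇ K) * (2 ^ k * B)
      each I = ≤-trans (≤-reflexive (trans (∑-*ˡ P (𝟙 (I ⊆ᵇ K)) _) (cong (λ w → 𝟙 (I ⊆ᵇ K) * w) (∑-*ˡ P (𝟙 (s₀ ≤ᵇ ∣ I ∣)) _))))
        (*-monoʳ-≤ (𝟙 (I ⊆ᵇ K)) big)
        where
        big : 𝟙 (s₀ ≤ᵇ ∣ I ∣) * ∑ P (λ t → 𝟙 (I ⊆ᵇ t)) ≤ 2 ^ k * B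
        big with s₀ ≤ᵇ ∣ I ∣ in eq
        ... | false = z≤n
        ... | true  = ≤-trans (≤-reflexive (*-identityˡ _)) (star-≤ I (true-≤ᵇ s₀ _ eq))

    ∋⇒⁅⁆⊆ : ∀ (t : Subset n) u → t ∋ u → ⁅ u ⁆ ⊆′ t
    ∋⇒⁅⁆⊆ t u h x p = subst (t ∋_) (∋-⁅⁆ u x p) h

    degree : ∀ u → ∑ P (λ t → 𝟙 (lookup t u)) ≤ Δ
    degree u with ∑ P (λ t → 𝟙 (lookup t u)) in eq
    ... | zero = z≤n
    ... | suc c with ∑-≢0 P _ (λ z → contradiction (trans (sym eq) z) λ ())
    ...   | t , t∈ , h = begin
      suc c ≡⟨ sym eq ⟩
      ∑ P (λ t → 𝟙 (lookup t u)) ≤⟨ ∑-mono P (λ t → 𝟙-mono (λ h → ⊆ᵇ-complete ⁅ u ⁆ t (∋⇒⁅⁆⊆ t u h))) ⟩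
      ∑ P (λ t → 𝟙 (⁅ u ⁆ ⊆ᵇ t)) ≤⟨ m≤n*m _ D {{>-nonZero 1≤D}} ⟩
      D * ∑ P (λ t → 𝟙 (⁅ u ⁆ ⊆ᵇ t)) ≤⟨ star ⁅ u ⁆ ⟩
      deg es ⁅ u ⁆ * 2 ^ k ≤⟨ *-monoˡ-≤ (2 ^ k) (degree-≤ t u (mem! t∈) (𝟙-≢0 h)) ⟩
      D₁ * 2 ^ k ≡⟨ *-comm D₁ (2 ^ k) ⟩
      Δ ∎
      where open ≤-Reasoning

    #P≤ : length P ≤ 2 ^ k * m
    #P≤ = begin
      length P ≡⟨ trans (sym (*-identityʳ _)) (sym (∑-const P 1)) ⟩
      ∑ P (λ _ → 1) ≤⟨ ∑-mono P (λ t → 𝟙≡1 (⊆ᵇ-complete ⊥ t (λ x h → ∋-⊥ x h))) ⟩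
      ∑ P (λ t → 𝟙 (⊥ ⊆ᵇ t)) ≤⟨ m≤n*m _ D {{>-nonZero 1≤D}} ⟩
      D * ∑ P (λ t → 𝟙 (⊥ ⊆ᵇ t)) ≤⟨ star ⊥ ⟩
      deg es ⊥ * 2 ^ k ≤⟨ *-monoˡ-≤ (2 ^ k) (≤-trans (∑-bound es 1 (λ e _ → 𝟙≤1 (⊥ ⊆ᵇ e))) (≤-reflexive (*-identityʳ m))) ⟩
      m * 2 ^ k ≡⟨ *-comm m (2 ^ k) ⟩
      2 ^ k * m ∎
      where open ≤-Reasoning

    four : ∀ x → x + (x + (x + x)) ≡ 4 * x
    four = ℕR.solve-∀

  open Tuples P s₀ s C Δ κ 1≤s₀ 1≤Δ once (λ t t∈ → ≤-reflexive (size t (mem! t∈)))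
    (λ t t∈ → ≤-trans (≤-trans (m≤n+m _ s₀) (≤-reflexive (four s₀))) (≤-reflexive (sym (size t (mem! t∈)))))
    overlaps degree
    using (wt; at; N-≤; N-odd-≤; meeting; meets)
  open Chaos P wt at
  open ChaosSize P wt at

  private
    F : List (Fin n)
    F = allFin n

    distinct? : Fin n → Fin n → Bool
    distinct? u v = not (does (u ≟ v))

    me : Subset n → ℕ
    me e = ∑ (els e) λ u → ∑ (els e) λ v → 𝟙 (distinct? u v) * meeting u v

    ∑P-members : ∑ F (λ v → ∑ P (λ t → wt t v)) ≡ length P * s
    ∑P-members = trans (∑-swap F P (λ v t → wt t v)) (trans (≤-antisym
        (∑-mono∈ P (λ t t∈ → ≤-reflexive (trans (∑-lookup t) (size t (mem! t∈)))))
        (∑-mono∈ P (λ t t∈ → ≤-reflexive (sym (trans (∑-lookup t) (size t (mem! t∈))))))) (∑-const P s))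

    s≤κ : s ≤ κ
    s≤κ = ≤-trans (≤-trans (m≤m+n s _) (m≤n+m _ k)) κ-rest

    -- A member has `s` points, and it meets at most `C` members, which have `s` points each.
    ∑-meeting : ∑ F (λ u → ∑ F (meeting u)) ≤ length P * s * (s * C)
    ∑-meeting = begin
      ∑ F (λ u → ∑ F (meeting u)) ≤⟨ ∑-mono F row ⟩
      ∑ F (λ u → ∑ P (λ t → wt t u) * (s * C)) ≡⟨ trans (∑-*ʳ F (s * C) _) (cong (_* (s * C)) ∑P-members) ⟩
      length P * s * (s * C) ∎
      where
      open ≤-Reasoning
      col : ∀ t → t ∈ P → ∑ F (λ v → ∑ P (λ t′ → wt t′ v * 𝟙 (meets t t′))) ≤ s * C
      col t t∈ = begin
        ∑ F (λ v → ∑ P (λ t′ → wt t′ v * 𝟙 (meets t t′))) ≡⟨ ∑-swap F P _ ⟩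
        ∑ P (λ t′ → ∑ F (λ v → wt t′ v * 𝟙 (meets t t′)))
          ≤⟨ ∑-mono∈ P (λ t′ t′∈ → ≤-reflexive (trans (∑-*ʳ F (𝟙 (meets t t′)) _) (cong (_* 𝟙 (meets t t′)) (trans (∑-lookup t′) (size t′ (mem! t′∈)))))) ⟩
        ∑ P (λ t′ → s * 𝟙 (meets t t′)) ≡⟨ ∑-*ˡ P s _ ⟩
        s * ∑ P (λ t′ → 𝟙 (meets t t′)) ≤⟨ *-monoʳ-≤ s (overlaps t (≤-trans (≤-reflexive (size t (mem! t∈))) s≤κ)) ⟩
        s * C ∎
      row : ∀ u → ∑ F (meeting u) ≤ ∑ P (λ t → wt t u) * (s * C)
      row u = begin
        ∑ F (meeting u) ≡⟨ trans (∑-swap F P _) (∑-cong P (λ t → ∑-*ˡ F (wt t u) _)) ⟩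
        ∑ P (λ t → wt t u * ∑ F (λ v → ∑ P (λ t′ → wt t′ v * 𝟙 (meets t t′)))) ≤⟨ ∑-mono∈ P (λ t t∈ → *-monoʳ-≤ (wt t u) (col t t∈)) ⟩
        ∑ P (λ t → wt t u * (s * C)) ≡⟨ ∑-*ʳ P (s * C) _ ⟩
        ∑ P (λ t → wt t u) * (s * C) ∎

    meeting-codeg : ∀ u v → codeg es u v * (𝟙 (distinct? u v) * meeting u v) ≤ β * meeting u v
    meeting-codeg u v with u ≟ v | meeting u v in eq
    ... | yes _ | _ = ≤-trans (≤-reflexive (*-zeroʳ (codeg es u v))) z≤n
    ... | no _ | zero = ≤-trans (≤-reflexive (*-zeroʳ (codeg es u v))) z≤n
    ... | no u≢v | suc c with ∑-≢0 P _ (λ z → contradiction (trans (sym eq) z) λ ())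
    ...   | t , t∈ , h with ∑-≢0 P _ (*≢0ʳ (wt t u) h)
    ...     | t′ , t′∈ , h′ = *-mono-≤ (codegree-≤ t t′ u v (mem! t∈) (mem! t′∈) (𝟙-≢0 (*≢0ˡ (wt t u) h)) (𝟙-≢0 (*≢0ˡ (wt t′ v) h′)) u≢v)
              (≤-reflexive (*-identityˡ _))

    -- A pair of distinct vertices is counted once for each edge through both. Where `meeting` is
    -- not 0 both vertices belong to members, so there are at most `β` such edges. On average over
    -- the edges the meeting tuples therefore cost `O(β C)`.
    ∑-me : ∑ es me ≤ β * (s * (s * (2 ^ k * C))) * m
    ∑-me = begin
      ∑ es me ≡⟨ ∑-cong es (λ e → trans (∑-els e _) (∑-cong F (λ u → cong (λ w → 𝟙 (lookup e u) * w) (∑-els e _)))) ⟩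
      ∑ es (λ e → ∑ F (λ u → 𝟙 (lookup e u) * ∑ F (λ v → 𝟙 (lookup e v) * (𝟙 (distinct? u v) * meeting u v))))
        ≡⟨ ∑-swap es F _ ⟩
      ∑ F (λ u → ∑ es (λ e → 𝟙 (lookup e u) * ∑ F (λ v → 𝟙 (lookup e v) * (𝟙 (distinct? u v) * meeting u v))))
        ≡⟨ ∑-cong F (λ u → trans (∑-cong es (λ e → sym (∑-*ˡ F (𝟙 (lookup e u)) _))) (∑-swap es F _)) ⟩
      ∑ F (λ u → ∑ F (λ v → ∑ es (λ e → 𝟙 (lookup e u) * (𝟙 (lookup e v) * (𝟙 (distinct? u v) * meeting u v)))))
        ≡⟨ ∑-cong F (λ u → ∑-cong F (λ v → trans (∑-cong es (λ e → sym (*-assoc (𝟙 (lookup e u)) (𝟙 (lookup e v)) _))) (∑-*ʳ es (𝟙 (distinct? u v) * meeting u v) _))) ⟩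
      ∑ F (λ u → ∑ F (λ v → codeg es u v * (𝟙 (distinct? u v) * meeting u v)))
        ≤⟨ ∑-mono F (λ u → ∑-mono F (meeting-codeg u)) ⟩
      ∑ F (λ u → ∑ F (λ v → β * meeting u v)) ≡⟨ trans (∑-cong F (λ u → ∑-*ˡ F β _)) (∑-*ˡ F β _) ⟩
      β * ∑ F (λ u → ∑ F (meeting u)) ≤⟨ *-monoʳ-≤ β (≤-trans ∑-meeting (*-monoˡ-≤ (s * C) (*-monoˡ-≤ s #P≤))) ⟩
      β * (2 ^ k * m * s * (s * C)) ≡⟨ perm β (2 ^ k) m s C ⟩
      β * (s * (s * (2 ^ k * C))) * m ∎
      where
      open ≤-Reasoning
      perm : ∀ b p m s c → b * (p * m * s * (s * c)) ≡ b * (s * (s * (p * c))) * m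
      perm = ℕR.solve-∀

  -- `req₁` lets two factors `Λ` pay for two further members of a tuple. After normalisation, `req₂`
  -- keeps the even terms, and `req₃` the points outside the cube, below `m / T`.
  module Conclude (Λ : ℕ) (1≤Λ : 1 ≤ Λ) (T : ℕ)
    (req₁ : suc C * suc C * Δ ≤ Λ * Λ)
    (req₂ : T * (2 * (c₀ * (2 * suc C + 2 * (k * (β * (s * (s * (2 ^ k * C)))))))) ≤ Λ)
    (req₃ : T * (2 * (m * (2 ^ k * (Cw * 2 ^ k))) * (2 ^ k * m * s * (2 * (suc C * suc C * Δ) ^ p))) * Λ ≤ Λ ^ (p + p) * m)
    (hasMem : Subset n → Bool) (hasMem⁻ : ∀ e → hasMem e ≡ true → ∃[ t ] (mem t ≡ true × t ⊆′ e)) where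

    open EdgeBounds P wt at Λ cf cf0 Cw cf≤

    private
      Q G c₆ : ℕ
      Q = suc C * suc C * Δ
      G = ∑ es (𝟙 ∘ hasMem)
      c₆ = 2 * (m * (2 ^ k * (Cw * 2 ^ k)))

      Q^ : ∀ h → suc C ^ (h + h) * Δ ^ h ≡ Q ^ h
      Q^ h = sym (trans (*-^ (suc C * suc C) Δ h) (cong (_* Δ ^ h) (trans (*-^ (suc C) (suc C) h) (sym (^-distribˡ-+-* (suc C) h h)))))

      gain≥ : Λ ^ (k ∸ 1) * G ≤ gain Λ cf (map els es) (2 * Λ)
      gain≥ = ≤-trans (≤-reflexive (sym (∑-*ˡ es (Λ ^ (k ∸ 1)) (𝟙 ∘ hasMem))))
        (≤-trans (∑-mono∈ es edge) (≤-reflexive (sym (∑-map els es edgeGain))))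
        where
        edge : ∀ e → e ∈ es → Λ ^ (k ∸ 1) * 𝟙 (hasMem e) ≤ edgeGain (els e)
        edge e e∈ with hasMem e in eq
        ... | false = ≤-trans (≤-reflexive (*-zeroʳ (Λ ^ (k ∸ 1)))) z≤n
        ... | true with hasMem⁻ e eq
        ...   | t , mt , t⊆e with els t in eqt | splits-els t e t⊆e
        ...     | [] | R , R∈ = contradiction (≤-trans (m≤m+n 1 _) (*-monoʳ-≤ 4 1≤s₀)) (<⇒≱ (subst (_<ᴺ 1) (trans (sym (cong length eqt)) (trans (length-els t) (size t mt))) (s≤s z≤n)))
        ...     | u ∷ W | R , R∈ = ≤-trans (≤-reflexive (trans (*-identityʳ _) (cong (λ l → Λ ^ (l ∸ 1)) (sym (trans (length-els e) (uni e e∈))))))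
                  (edgeGain-≥ {els e} R∈ (subst (λ l → 1 ≤ cf l) (sym (trans (sym (cong length eqt)) (trans (length-els t) (size t mt)))) 1≤cfs)
                    (splits-consˡ W (splits-∅ˡ W)) one)
          where
          t∈P : t ∈ P
          t∈P = ∈-filterB⁺ mem (allS n) (∈-allS t) mt
          u∈t : t ∋ u
          u∈t = ∈-els⁻ t u (subst (u ∈_) (sym eqt) (here refl))
          vanish : set W ⊕ (t ⊕ ⁅ u ⁆) ≡ ⊥
          vanish = trans (cong (set W ⊕_) (⊕-comm t ⁅ u ⁆)) (trans (sym (⊕-assoc (set W) ⁅ u ⁆ t))
            (trans (cong (_⊕ t) (trans (⊕-comm (set W) ⁅ u ⁆) (trans (cong set (sym eqt)) (set-els t)))) (⊕-self t)))
          one : 1 ≤ N (u ∷ []) (set W)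
          one = ≤-trans (*-mono-≤ (𝟙≡1 u∈t) (𝟙≡1 (trans (cong empty vanish) (empty-⊥ n)))) (∑-≥ (λ x → wt x u * N [] (set W ⊕ at x u)) t∈P)

      -- For `2h + 2` members, `Q ^ h ≤ Λ ^ (h + h)` restores all but two of the missing factors
      -- `Λ`. The gain misses only one, so the even terms are smaller by a full factor `Λ`, against
      -- `C` and the meetings.
      X : Subset n → ℕ
      X e = Λ ^ (k ∸ 2) * (2 * suc C + 2 * (k * me e))

      edge-loss : ∀ e → e ∈ es → edgeLoss (els e) ≤ c₀ * X e
      edge-loss e e∈ = ≤-trans (edgeLoss-≤ (els e) (X e) (Unique-els e) bnd)
          (≤-reflexive (trans (cong (λ l → 2 ^ l * (2 ^ l * (Cw * (2 ^ l * X e)))) len) (perm (2 ^ k) Cw (X e))))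
        where
        open ≤-Reasoning
        perm : ∀ p c x → p * (p * (c * (p * x))) ≡ p * (p * (c * p)) * x
        perm = ℕR.solve-∀
        len : length (els e) ≡ k
        len = trans (length-els e) (uni e e∈)
        bnd : ∀ u us W → isEven (u ∷ us) ≡ true → Unique (u ∷ us) → (∀ {x} → x ∈ u ∷ us → x ∈ els e) → (∀ {x} → x ∈ W → x ∈ els e) →
          length (u ∷ us) ≤ length (els e) → Λ ^ (length (els e) ∸ length (u ∷ us)) * N (u ∷ us) (set W) ≤ X e
        bnd u us W ev (u∉ ∷ _) us⊆ W⊆ l≤ rewrite len with isEven⇒odd-tail us (not-true ev)
          where
          not-true : ∀ {b} → not b ≡ true → b ≡ false
          not-true {false} _ = refl
        ... | h , lh = begin
          Λ ^ (k ∸ suc (length us)) * N (u ∷ us) (set W)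
            ≤⟨ *-monoʳ-≤ (Λ ^ (k ∸ suc (length us))) (N-odd-≤ u us (set W) e h lh (λ x p → ∈-els⁻ e x (W⊆ (set-∈ W x p))) (λ x p → ∈-els⁻ e x (us⊆ p))
                 (≤-trans (+-mono-≤ (≤-reflexive (uni e e∈)) (+-monoʳ-≤ s (+-monoʳ-≤ s (*-monoˡ-≤ s (≤-trans (n≤1+n _) l≤))))) κ-rest)) ⟩
          Λ ^ (k ∸ suc (length us)) * (2 * (suc C ^ suc (h + h) * Δ ^ h) + 2 * (suc C ^ (h + h) * Δ ^ h) * ∑ us (meeting u))
            ≡⟨ cong (λ w → Λ ^ (k ∸ suc (length us)) * w) (factor (suc C) (suc C ^ (h + h)) (Δ ^ h) (∑ us (meeting u))) ⟩
          Λ ^ (k ∸ suc (length us)) * (suc C ^ (h + h) * Δ ^ h * (2 * suc C + 2 * ∑ us (meeting u)))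
            ≤⟨ *-monoʳ-≤ (Λ ^ (k ∸ suc (length us))) (*-mono-≤ (≤-trans (≤-reflexive (Q^ h)) (≤-trans (^-monoˡ-≤ h req₁)
                 (≤-reflexive (trans (*-^ Λ Λ h) (sym (^-distribˡ-+-* Λ h h)))))) (+-monoʳ-≤ (2 * suc C) (*-monoʳ-≤ 2 tail≤))) ⟩
          Λ ^ (k ∸ suc (length us)) * (Λ ^ (h + h) * (2 * suc C + 2 * (k * me e)))
            ≡⟨ trans (sym (*-assoc (Λ ^ (k ∸ suc (length us))) (Λ ^ (h + h)) _)) (cong (_* (2 * suc C + 2 * (k * me e)))
                 (trans (sym (^-distribˡ-+-* Λ (k ∸ suc (length us)) (h + h))) (cong (Λ ^_) exps))) ⟩
          X e ∎
          where
          factor : ∀ c a d x → 2 * (c * a * d) + 2 * (a * d) * x ≡ a * d * (2 * c + 2 * x)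
          factor = ℕR.solve-∀
          exps : k ∸ suc (length us) + (h + h) ≡ k ∸ 2
          exps = trans (cong (λ l → k ∸ suc l + (h + h)) lh) (trans (cong (_+ (h + h)) (sym (∸-+-assoc k 2 (h + h))))
            (m∸n+n≡m (∸-monoˡ-≤ 2 (subst (λ l → suc l ≤ k) lh l≤))))
          tail≤ : ∑ us (meeting u) ≤ k * me e
          tail≤ = ≤-trans (∑-bound us (me e) (λ v v∈ → ≤-trans (neq v v∈)
              (≤-trans (∑-≥ (λ v → 𝟙 (distinct? u v) * meeting u v) (us⊆ (there v∈))) (∑-≥ (λ u → ∑ (els e) λ v → 𝟙 (distinct? u v) * meeting u v) (us⊆ (here refl))))))
            (*-monoˡ-≤ (me e) (≤-trans (n≤1+n _) l≤))
            where
            neq : ∀ v → v ∈ us → meeting u v ≤ 𝟙 (distinct? u v) * meeting u v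
            neq v v∈ with u ≟ v
            ... | yes u≡v = contradiction u≡v (All.lookup u∉ v∈)
            ... | no _ = ≤-reflexive (sym (*-identityˡ _))

      ℓ : ℕ
      ℓ = c₀ * (2 * suc C + 2 * (k * (β * (s * (s * (2 ^ k * C))))))

      loss≤ : loss Λ cf (map els es) (2 * Λ) ≤ Λ ^ (k ∸ 2) * (ℓ * m)
      loss≤ = begin
        loss Λ cf (map els es) (2 * Λ) ≡⟨ ∑-map els es edgeLoss ⟩
        ∑ es (λ e → edgeLoss (els e)) ≤⟨ ∑-mono∈ es edge-loss ⟩
        ∑ es (λ e → c₀ * X e) ≡⟨ trans (∑-*ˡ es c₀ X) (cong (λ w → c₀ * w) (trans (∑-*ˡ es (Λ ^ (k ∸ 2)) _) (cong (λ w → Λ ^ (k ∸ 2) * w)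
             (trans (∑-+ es _ _) (cong₂ _+_ (∑-const es (2 * suc C)) (trans (∑-*ˡ es 2 _) (cong (λ w → 2 * w) (∑-*ˡ es k me)))))))) ⟩
        c₀ * (Λ ^ (k ∸ 2) * (m * (2 * suc C) + 2 * (k * ∑ es me)))
          ≤⟨ *-monoʳ-≤ c₀ (*-monoʳ-≤ (Λ ^ (k ∸ 2)) (+-monoʳ-≤ (m * (2 * suc C)) (*-monoʳ-≤ 2 (*-monoʳ-≤ k ∑-me)))) ⟩
        c₀ * (Λ ^ (k ∸ 2) * (m * (2 * suc C) + 2 * (k * (β * (s * (s * (2 ^ k * C))) * m)))) ≡⟨ perm c₀ (Λ ^ (k ∸ 2)) m (suc C) k (β * (s * (s * (2 ^ k * C)))) ⟩
        Λ ^ (k ∸ 2) * (ℓ * m) ∎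
        where
        open ≤-Reasoning
        perm : ∀ c l m a k b → c * (l * (m * (2 * a) + 2 * (k * (b * m)))) ≡ l * (c * (2 * a + 2 * (k * b)) * m)
        perm = ℕR.solve-∀

      2≤p+p : 1 ≤ p + p
      2≤p+p = ≤-trans (≤-trans (s≤s z≤n) 2≤k) (≤-trans (m≤n+m k p′) (≤-reflexive (sym p+p≡)))

      moment : Fin n → ℕ
      moment v = N (List.replicate (p + p) v) ⊥

      -- The factor counting the members at `v` makes the bound 0 at vertices that no member
      -- contains. Summed over `v` it gives `length P * s` and does not involve the number of
      -- vertices.
      moment≤ : ∀ v → moment v ≤ ∑ P (λ t → wt t v) * (2 * Q ^ p)
      moment≤ v with ∑ P (λ t → wt t v) in eq
      ... | zero = ≤-reflexive (none (p + p) 2≤p+p)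
        where
        none : ∀ j → 1 ≤ j → N (List.replicate j v) ⊥ ≡ 0
        none (suc j) _ = ∑-0 P (λ t t∈ → cong (λ w → w * N (List.replicate j v) (⊥ ⊕ at t v)) (n≤0⇒n≡0 (≤-trans (∑-≥ (λ t → wt t v) t∈) (≤-reflexive eq))))
      ... | suc c = ≤-trans (N-≤ (List.replicate (p + p) v) ⊥ ⁅ v ⁆ p (≤-trans (≤-reflexive (ListP.length-replicate (p + p))) (n≤1+n _)) (λ x → ∋-⊥ x) in-rep
            (≤-trans (≤-reflexive (cong₂ (λ a b → a + b * s) (SubP.∣⁅x⁆∣≡1 v) (ListP.length-replicate (p + p)))) κ-moment))
          (≤-trans (≤-reflexive (cong (λ w → 2 * w) (trans (cong (λ l → suc C ^ l * Δ ^ p) (ListP.length-replicate (p + p))) (Q^ p)))) (m≤m+n _ _))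
        where
        in-rep : ∀ x → x ∈ List.replicate (p + p) v → ⁅ v ⁆ ∋ x
        in-rep x x∈ = go (p + p) x∈
          where
          go : ∀ j → x ∈ List.replicate j v → ⁅ v ⁆ ∋ x
          go (suc j) (here refl) = lookup-⁅⁆ v
          go (suc j) (there h) = go j h

      ∑-L^ : ∀ v → ∑ (allS n) (λ z → ℤ.∣ L v z ∣ ^ (p + p)) ≡ 2 ^ n * moment v
      ∑-L^ v = ℤP.+-injective (trans (sym (∑ᶻ-+∑ (allS n) _)) (trans (∑ᶻ-cong (allS n) (λ z →
          sym (trans (cong₂ ℤ._*_ (χ-⊥ z) (prod-replicate (λ u → L u z) p v)) (ℤP.*-identityˡ _))))
        (∑-χ-prod (List.replicate (p + p) v) ⊥)))

      E : Subset n → ℕ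
      E z = c₆ * ∑ F (λ v → ℤ.∣ L v z ∣ ^ (p + p))

      Ē : ℕ
      Ē = c₆ * (2 ^ k * m * s * (2 * Q ^ p))

      ∑E≤ : ∑ (allS n) E ≤ 2 ^ n * Ē
      ∑E≤ = begin
        ∑ (allS n) E ≡⟨ trans (∑-*ˡ (allS n) c₆ _) (cong (λ w → c₆ * w) (trans (∑-swap (allS n) F _) (trans (∑-cong F ∑-L^) (∑-*ˡ F (2 ^ n) moment)))) ⟩
        c₆ * (2 ^ n * ∑ F moment)
          ≤⟨ *-monoʳ-≤ c₆ (*-monoʳ-≤ (2 ^ n) (≤-trans (∑-mono F moment≤) (≤-trans (≤-reflexive (trans (∑-*ʳ F (2 * Q ^ p) _) (cong (_* (2 * Q ^ p)) ∑P-members)))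
               (*-monoˡ-≤ (2 * Q ^ p) (*-monoˡ-≤ s #P≤))))) ⟩
        c₆ * (2 ^ n * (2 ^ k * m * s * (2 * Q ^ p))) ≡⟨ *-swapˡ c₆ (2 ^ n) _ ⟩
        2 ^ n * Ē ∎
        where
        open ≤-Reasoning

      a K : ℕ
      a = Λ ^ p′
      K = (2 * Λ) ^ k * σ

      dbl : ∀ x → x + x ≡ 2 * x
      dbl = ℕR.solve-∀

      hyp : ∀ z → ℤ.- (+ (2 * a) ℤ.* cutPoly cf (map els es) (2 * Λ) (point Λ z)) ℤ.≤ + (a * K + E z)
      hyp z with argmax Λ (λ v → ℤ.∣ L v z ∣)
      ... | inj₁ small = begin
        ℤ.- (+ (2 * a) ℤ.* f) ≡⟨ trans (cong (λ w → ℤ.- (w ℤ.* f)) (trans (cong +_ (*-comm 2 a)) (ℤP.pos-* a 2))) (perm (+ a) (+ 2) f) ⟩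
        + a ℤ.* (ℤ.- (+ 2 ℤ.* f)) ≤⟨ ℤP.*-monoˡ-≤-nonNeg (+ a) (bounded (2 * Λ) (≤-trans 1≤Λ (m≤m+n Λ _)) (point Λ z) (λ v → ≤-trans (∣point∣≤ Λ z v) (≤-trans (+-monoˡ-≤ Λ (small v)) (≤-reflexive (dbl Λ))))) ⟩
        + a ℤ.* + K ≡⟨ sym (ℤP.pos-* a K) ⟩
        + (a * K) ≤⟨ ℤ.+≤+ (m≤m+n (a * K) (E z)) ⟩
        + (a * K + E z) ∎
        where
        open ℤP.≤-Reasoning
        f : ℤ
        f = cutPoly cf (map els es) (2 * Λ) (point Λ z)
        perm : ∀ a t f → ℤ.- (a ℤ.* t ℤ.* f) ≡ a ℤ.* (ℤ.- (t ℤ.* f))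
        perm = ℤR.solve-∀
      -- The largest value `x` of `L` is now at least `Λ`, so `a = Λ ^ p′` is at most `x ^ p′`. As
      -- `p′ + k = p + p`, the crude bound becomes the summand of `E z` at `w`.
      ... | inj₂ (w , Λ≤x , max) = ℤP.≤-trans (-i≤∣i∣ (+ (2 * a) ℤ.* f)) (ℤ.+≤+ (≤-trans (≤-reflexive (ℤP.abs-* (+ (2 * a)) f)) (≤-trans big (m≤n+m (E z) (a * K)))))
        where
        open ≤-Reasoning
        f : ℤ
        f = cutPoly cf (map els es) (2 * Λ) (point Λ z)
        x : ℕ
        x = ℤ.∣ L w z ∣
        -i≤∣i∣ : ∀ i → ℤ.- i ℤ.≤ + ℤ.∣ i ∣
        -i≤∣i∣ (+ m) = ℤP.neg-≤-pos {m} {m}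
        -i≤∣i∣ -[1+ m ] = ℤP.≤-refl
        perm : ∀ l m q c r y → 2 * l * (m * (q * (c * (r * y)))) ≡ 2 * (m * (q * (c * r))) * (l * y)
        perm = ℕR.solve-∀
        big : 2 * a * ℤ.∣ f ∣ ≤ E z
        big = begin
          2 * a * ℤ.∣ f ∣ ≤⟨ *-monoʳ-≤ (2 * a) (∣cutPoly∣≤ cf Cw (map els es) k (2 * Λ) (2 * x) (point Λ z) cf≤ lens (*-monoʳ-≤ 2 Λ≤x)
              (λ v → ≤-trans (∣point∣≤ Λ z v) (≤-trans (+-mono-≤ (max v) Λ≤x) (≤-reflexive (dbl x))))) ⟩
          2 * a * (length (map els es) * (2 ^ k * (Cw * (2 * x) ^ k))) ≡⟨ cong₂ (λ l y → 2 * a * (l * (2 ^ k * (Cw * y)))) (length-map els es) (*-^ 2 x k) ⟩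
          2 * a * (m * (2 ^ k * (Cw * (2 ^ k * x ^ k)))) ≡⟨ perm a m (2 ^ k) Cw (2 ^ k) (x ^ k) ⟩
          c₆ * (a * x ^ k) ≤⟨ *-monoʳ-≤ c₆ (*-monoˡ-≤ (x ^ k) (^-monoˡ-≤ p′ Λ≤x)) ⟩
          c₆ * (x ^ p′ * x ^ k) ≡⟨ cong (λ y → c₆ * y) (trans (sym (^-distribˡ-+-* x p′ k)) (cong (x ^_) (sym p+p≡))) ⟩
          c₆ * x ^ (p + p) ≤⟨ *-monoʳ-≤ c₆ (∑-≥ (λ v → ℤ.∣ L v z ∣ ^ (p + p)) (∈-allFin w)) ⟩
          E z ∎
          where
          lens : ∀ e → e ∈ map els es → length e ≡ k
          lens e e∈ with ∈-map⁻ els e∈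
          ... | e′ , e′∈ , refl = trans (length-els e′) (uni e′ e′∈)

    -- Of the two summands `m` on the right, one pays for the even terms and one for the points
    -- outside the cube.
    level-≤ : 2 * T * G ≤ T * (2 ^ k * Λ * σ) + 2 * m
    level-≤ = *-cancelˡ-≤ Λq {{>-nonZero (m^n>0 Λ {{>-nonZero 1≤Λ}} (p + p))}} (begin
      Λq * (2 * T * G) ≡⟨ trans (cong (_* (2 * T * G)) Λq≡) (perm₁ a Λ (Λ ^ (k ∸ 1)) T G) ⟩
      T * Λ * (2 * a * (Λ ^ (k ∸ 1) * G)) ≤⟨ *-monoʳ-≤ (T * Λ) (*-monoʳ-≤ (2 * a) gain≥) ⟩
      T * Λ * (2 * a * gain Λ cf (map els es) (2 * Λ)) ≤⟨ *-monoʳ-≤ (T * Λ) (gain-≤ Λ cf (map els es) (2 * Λ) a K Ē E hyp ∑E≤) ⟩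
      T * Λ * (a * K + Ē + 2 * a * loss Λ cf (map els es) (2 * Λ)) ≤⟨ *-monoʳ-≤ (T * Λ) (+-monoʳ-≤ (a * K + Ē) (*-monoʳ-≤ (2 * a) loss≤)) ⟩
      T * Λ * (a * K + Ē + 2 * a * (Λ ^ (k ∸ 2) * (ℓ * m))) ≡⟨ perm₂ T Λ (a * K) Ē a (Λ ^ (k ∸ 2)) ℓ m ⟩
      T * Λ * (a * K) + T * Ē * Λ + T * (2 * ℓ) * (a * (Λ * Λ ^ (k ∸ 2))) * m
        ≤⟨ +-mono-≤ (+-monoʳ-≤ (T * Λ * (a * K)) req₃) (*-monoˡ-≤ m (*-monoˡ-≤ (a * (Λ * Λ ^ (k ∸ 2))) req₂)) ⟩
      T * Λ * (a * K) + Λq * m + Λ * (a * (Λ * Λ ^ (k ∸ 2))) * m ≡⟨ cong₂ (λ x y → x + Λq * m + y * m) main-term last-term ⟩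
      Λq * (T * (2 ^ k * Λ * σ)) + Λq * m + Λq * m ≡⟨ perm₄ Λq (T * (2 ^ k * Λ * σ)) m ⟩
      Λq * (T * (2 ^ k * Λ * σ) + 2 * m) ∎)
      where
      open ≤-Reasoning
      Λq : ℕ
      Λq = Λ ^ (p + p)
      Λk : ∀ j → suc j ≤ k → Λ ^ (k ∸ j) ≡ Λ * Λ ^ (k ∸ suc j)
      Λk j h = cong (Λ ^_) (sym (trans (sym (+-∸-assoc 1 h)) refl))
      Λq≡ : Λq ≡ a * (Λ * Λ ^ (k ∸ 1))
      Λq≡ = trans (cong (Λ ^_) p+p≡) (trans (^-distribˡ-+-* Λ p′ k) (cong (a *_) (Λk 0 (≤-trans (s≤s z≤n) 2≤k))))
      perm₁ : ∀ a l x t g → a * (l * x) * (2 * t * g) ≡ t * l * (2 * a * (x * g))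
      perm₁ = ℕR.solve-∀
      perm₂ : ∀ t l ak e a x b m → t * l * (ak + e + 2 * a * (x * (b * m))) ≡ t * l * ak + t * e * l + t * (2 * b) * (a * (l * x)) * m
      perm₂ = ℕR.solve-∀
      perm₄ : ∀ l x m → l * x + l * m + l * m ≡ l * (x + 2 * m)
      perm₄ = ℕR.solve-∀
      perm₅ : ∀ t l a p x s → t * l * (a * (p * x * s)) ≡ a * x * (t * (p * l * s))
      perm₅ = ℕR.solve-∀
      main-term : T * Λ * (a * K) ≡ Λq * (T * (2 ^ k * Λ * σ))
      main-term = trans (cong (λ w → T * Λ * (a * (w * σ))) (*-^ 2 Λ k)) (trans (perm₅ T Λ a (2 ^ k) (Λ ^ k) σ)
        (cong (_* (T * (2 ^ k * Λ * σ))) (sym (trans (cong (Λ ^_) p+p≡) (^-distribˡ-+-* Λ p′ k)))))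
      last-term : Λ * (a * (Λ * Λ ^ (k ∸ 2))) ≡ Λq
      last-term = trans (*-swapˡ Λ a (Λ * Λ ^ (k ∸ 2))) (trans (cong (λ w → a * (Λ * w)) (sym (Λk 1 2≤k))) (sym Λq≡))

-- Boolean tests, pairs inside edges, maximal matchings

_≠ᵇ_ : Fin n → Fin n → Bool
u ≠ᵇ v = not (does (u ≟ v))

≠ᵇ-sound : (u v : Fin n) → (u ≠ᵇ v) ≡ true → u ≢ v
≠ᵇ-sound u v h e with u ≟ v
≠ᵇ-sound u v () e | yes _
... | no ne = ne e

≠ᵇ-complete : (u v : Fin n) → u ≢ v → (u ≠ᵇ v) ≡ true
≠ᵇ-complete u v h with u ≟ v
... | yes e = contradiction e h
... | no _  = refl

∧-true : ∀ a {b} → (a ∧ b) ≡ true → a ≡ true × b ≡ true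
∧-true true h = refl , h

∧-intro : ∀ {a b} → a ≡ true → b ≡ true → (a ∧ b) ≡ true
∧-intro refl refl = refl

all𝟚 : (A → Bool) → List A → Bool
all𝟚 Q []       = true
all𝟚 Q (x ∷ xs) = Q x ∧ all𝟚 Q xs

all𝟚-sound : (Q : A → Bool) (xs : List A) → all𝟚 Q xs ≡ true → ∀ {x} → x ∈ xs → Q x ≡ true
all𝟚-sound Q (y ∷ xs) h (here refl) = proj₁ (∧-true (Q y) h)
all𝟚-sound Q (y ∷ xs) h (there x∈)  = all𝟚-sound Q xs (proj₂ (∧-true (Q y) h)) x∈

all𝟚-false : (Q : A → Bool) (xs : List A) → all𝟚 Q xs ≡ false → ∃[ x ] (Q x ≡ false)
all𝟚-false Q (y ∷ xs) h with Q y in eq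
... | false = y , eq
... | true  = all𝟚-false Q xs h

subset-of-size : (s : Subset n) (j : ℕ) → j ≤ ∣ s ∣ → ∃[ t ] (t ⊆′ s × ∣ t ∣ ≡ j)
subset-of-size {n} s zero h = ⊥ , (λ x → ∋-⊥ x) , SubP.∣⊥∣≡0 n
subset-of-size (true ∷ s) (suc j) (s≤s h) with subset-of-size s j h
... | t , t⊆ , e = true ∷ t , (λ { zero _ → refl ; (suc x) p → t⊆ x p }) , cong suc e
subset-of-size (false ∷ s) (suc j) h with subset-of-size s (suc j) h
... | t , t⊆ , e = false ∷ t , (λ { (suc x) p → t⊆ x p }) , e

deg-anti : (es : List (Subset n)) (s t : Subset n) → s ⊆′ t → deg es t ≤ deg es s
deg-anti es s t h = ∑-mono es (λ e → 𝟙-mono (λ p → ⊆ᵇ-complete s e (λ x q → ⊆ᵇ-sound t e p x (h x q))))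

deg≤length : (es : List (Subset n)) (s : Subset n) → deg es s ≤ length es
deg≤length es s = ≤-trans (∑-bound es 1 (λ e _ → 𝟙≤1 (s ⊆ᵇ e))) (≤-reflexive (*-identityʳ _))

codeg-comm : (es : List (Subset n)) (u v : Fin n) → codeg es u v ≡ codeg es v u
codeg-comm es u v = ∑-cong es (λ e → *-comm (𝟙 (lookup e u)) (𝟙 (lookup e v)))

hasPair : (Fin n → Fin n → Bool) → Subset n → Bool
hasPair {n} adj e = 1 ≤ᵇ ∑ (allFin n) (λ u → ∑ (allFin n) (λ w → 𝟙 (lookup e u) * (𝟙 (lookup e w) * 𝟙 (adj u w))))

hasPair⁻ : (adj : Fin n → Fin n → Bool) (e : Subset n) → hasPair adj e ≡ true → ∃[ u ] ∃[ w ] ((e ∋ u) × (e ∋ w) × adj u w ≡ true)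
hasPair⁻ {n} adj e h with ∑-≢0 (allFin n) _ (λ z → contradiction (≤-trans (true-≤ᵇ 1 _ h) (≤-reflexive z)) λ ())
... | u , _ , hu with ∑-≢0 (allFin n) _ hu
...   | w , _ , hw = u , w , 𝟙-≢0 (*≢0ˡ (𝟙 (lookup e u)) hw) , 𝟙-≢0 (*≢0ˡ (𝟙 (lookup e w)) (*≢0ʳ (𝟙 (lookup e u)) hw))
        , 𝟙-≢0 (*≢0ʳ (𝟙 (lookup e w)) (*≢0ʳ (𝟙 (lookup e u)) hw))

hasPair⁺ : (adj : Fin n → Fin n → Bool) (e : Subset n) (u w : Fin n) → e ∋ u → e ∋ w → adj u w ≡ true → hasPair adj e ≡ true
hasPair⁺ {n} adj e u w hu hw a = ≤ᵇ-true (≤-trans (*-mono-≤ (𝟙≡1 hu) (*-mono-≤ (𝟙≡1 hw) (𝟙≡1 a)))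
  (≤-trans (∑-≥ (λ w → 𝟙 (lookup e u) * (𝟙 (lookup e w) * 𝟙 (adj u w))) (∈-allFin w))
    (∑-≥ (λ u → ∑ (allFin n) (λ w → 𝟙 (lookup e u) * (𝟙 (lookup e w) * 𝟙 (adj u w)))) (∈-allFin u))))

-- A matching, encoded as the involution exchanging matched vertices.
record Matching {n : ℕ} (heavy : Fin n → Fin n → Bool) (ps : List (Fin n × Fin n)) : Set where
  field
    π       : Fin n → Fin n
    π-invol : ∀ x → π (π x) ≡ x
    π-heavy : ∀ x → π x ≢ x → heavy x (π x) ≡ true
    maximal : ∀ u v → (u , v) ∈ ps → heavy u v ≡ true → u ≢ v → π u ≢ u ⊎ π v ≢ v

-- Greedy: a heavy pair is added when both its ends are still fixed by the involution.
maximal-matching : (heavy : Fin n → Fin n → Bool) → (∀ u v → heavy u v ≡ true → heavy v u ≡ true) →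
  (ps : List (Fin n × Fin n)) → Matching heavy ps
maximal-matching heavy hsym [] = record { π = id ; π-invol = λ _ → refl ; π-heavy = λ x h → contradiction refl h ; maximal = λ _ _ () }
maximal-matching heavy hsym ((a , b) ∷ ps) with maximal-matching heavy hsym ps
... | M with Matching.π M a ≟ a | Matching.π M b ≟ b | heavy a b in hab | a ≟ b
...   | no p | _ | _ | _ = record { Matching M ; maximal = λ { u v (here refl) _ _ → inj₁ p ; u v (there h) → Matching.maximal M u v h } }
...   | yes _ | no p | _ | _ = record { Matching M ; maximal = λ { u v (here refl) _ _ → inj₂ p ; u v (there h) → Matching.maximal M u v h } }
...   | yes _ | yes _ | false | _ = record { Matching M ; maximal = λ { u v (here refl) h _ → contradiction (trans (sym hab) h) λ () ; u v (there h) → Matching.maximal M u v h } }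
...   | yes _ | yes _ | true | yes a≡b = record { Matching M ; maximal = λ { u v (here refl) _ ne → contradiction a≡b ne ; u v (there h) → Matching.maximal M u v h } }
...   | yes πa | yes πb | true | no a≢b = record { π = π′ ; π-invol = invol ; π-heavy = hv ; maximal = mx }
  where
  open Matching M
  π′ : Fin _ → Fin _
  π′ x with x ≟ a | x ≟ b
  ... | yes _ | _     = b
  ... | no _  | yes _ = a
  ... | no _  | no _  = π x
  π′a : π′ a ≡ b
  π′a with a ≟ a
  ... | yes _ = refl
  ... | no h  = contradiction refl h
  π′b : π′ b ≡ a
  π′b with b ≟ a | b ≟ b
  ... | yes e | _     = e
  ... | no _  | yes _ = refl
  ... | no _  | no h  = contradiction refl h
  π′x : ∀ x → x ≢ a → x ≢ b → π′ x ≡ π x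
  π′x x h₁ h₂ with x ≟ a | x ≟ b
  ... | yes e | _     = contradiction e h₁
  ... | no _  | yes e = contradiction e h₂
  ... | no _  | no _  = refl
  invol : ∀ x → π′ (π′ x) ≡ x
  invol x with x ≟ a | x ≟ b
  ... | yes e | _     = trans π′b (sym e)
  ... | no _  | yes e = trans π′a (sym e)
  ... | no h₁ | no h₂ = trans (π′x (π x) (λ e → h₁ (trans (sym (π-invol x)) (trans (cong π e) πa)))
                                          (λ e → h₂ (trans (sym (π-invol x)) (trans (cong π e) πb)))) (π-invol x)
  hv : ∀ x → π′ x ≢ x → heavy x (π′ x) ≡ true
  hv x h with x ≟ a | x ≟ b
  ... | yes refl | _        = hab
  ... | no _     | yes refl = hsym a b hab
  ... | no _     | no _     = π-heavy x h
  moved : ∀ x → π x ≢ x → π′ x ≢ x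
  moved x h e with x ≟ a | x ≟ b
  ... | yes refl | _        = h πa
  ... | no _     | yes refl = h πb
  ... | no _     | no _     = h e
  mx : ∀ u v → (u , v) ∈ (a , b) ∷ ps → heavy u v ≡ true → u ≢ v → π′ u ≢ u ⊎ π′ v ≢ v
  mx u v (here refl) _ _ = inj₁ (λ e → a≢b (trans (sym e) π′a))
  mx u v (there h) hh ne with maximal u v h hh ne
  ... | inj₁ p = inj₁ (moved u p)
  ... | inj₂ p = inj₂ (moved v p)

allPairs : ∀ n → List (Fin n × Fin n)
allPairs n = List.cartesianProduct (allFin n) (allFin n)

∈-allPairs : (u v : Fin n) → (u , v) ∈ allPairs n
∈-allPairs u v = ∈-cartesianProduct⁺ (∈-allFin u) (∈-allFin v)

-- Choice of the constants

module Constants (k b′ Cw : ℕ) where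

  b Q p p′ κ c₀ c₃ T K₂ c₇ K₁ K C₁ c-X C* : ℕ
  b  = suc b′
  Q  = 3 * b
  -- Twice `p` exceeds `4b + 2`, the exponent of `B` in the product of `m` and `Λ` that the moment
  -- bound has to beat.
  p  = k + suc (b + b)
  p′ = k + (2 + ((b + b) + (b + b)))
  -- Bounds the size of every known set: an edge with the members attached to it, plus a single
  -- vertex with the `p + p` members of its moment.
  κ  = (k + (k + (k + k * k))) + (1 + (p + p) * k)
  c₀ = 2 ^ k * (2 ^ k * (Cw * 2 ^ k))
  c₃ = suc (2 ^ κ * (2 ^ k * 2))
  -- The errors `m / T` of the `suc Q` scales then add up to `m / 4`, half of what these scales must
  -- cover.
  T  = 4 * suc Q
  K₂ = T * (2 * (c₀ * (2 * c₃ + 2 * (k * (k * (k * (2 ^ k * c₃)))))))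
  c₇ = T * (2 * (2 ^ k * (Cw * 2 ^ k))) * (2 ^ k * k * 2)
  K₁ = suc (K₂ + c₇ * 2 ^ Q * (c₃ * 2 ^ k))
  K  = c₃ * 2 ^ k * K₁
  C₁ = 2 ^ k * (2 * suc c₀)
  c-X = suc (k * 2 ^ Q)
  C* = k * C₁ + (2 * (C₁ * c-X) + T * (2 ^ k * K))

  p+p≡p′+k : p + p ≡ p′ + k
  p+p≡p′+k = lemma k b
    where
    lemma : ∀ k b → (k + suc (b + b)) + (k + suc (b + b)) ≡ (k + (2 + ((b + b) + (b + b)))) + k
    lemma = ℕR.solve-∀

  module Requirements (B : ℕ) (1≤B : 1 ≤ B) where

    -- `β`, `D₁` and `Λ` are `B^(b-1)`, `B^(2b)` and `K B^(b+2)`. In `Λ`, the factor `B^b` is the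
    -- square root of `D₁`, one `B` outweighs `suc C`, and the other `B` is slack.
    β D₁ C Δ Λ : ℕ
    β = B ^ b′
    D₁ = (B * β) * (B * β)
    C = 2 ^ κ * (2 ^ k * (2 * B))
    Δ = 2 ^ k * D₁
    Λ = K * (B * (B * (B * β)))

    1≤β : 1 ≤ β
    1≤β = m^n>0 B {{>-nonZero 1≤B}} b′

    1≤D₁ : 1 ≤ D₁
    1≤D₁ = *-mono-≤ (*-mono-≤ 1≤B 1≤β) (*-mono-≤ 1≤B 1≤β)

    1≤2^k : 1 ≤ 2 ^ k
    1≤2^k = m^n>0 2 k

    1≤K : 1 ≤ K
    1≤K = *-mono-≤ {1} {c₃ * 2 ^ k} {1} {K₁} (*-mono-≤ {1} {c₃} (s≤s z≤n) 1≤2^k) (s≤s z≤n)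

    1≤Λ : 1 ≤ Λ
    1≤Λ = *-mono-≤ 1≤K (*-mono-≤ 1≤B (*-mono-≤ 1≤B (*-mono-≤ 1≤B 1≤β)))

    C≤ : suc C ≤ c₃ * B
    C≤ = ≤-trans (+-monoˡ-≤ C 1≤B) (≤-reflexive (lemma (2 ^ κ) (2 ^ k) B))
      where
      lemma : ∀ x y b → b + x * (y * (2 * b)) ≡ suc (x * (y * 2)) * b
      lemma = ℕR.solve-∀

    q : ℕ
    q = suc C * suc C * Δ

    -- The slack in `req₁`: raised to the power `p`, it outweighs `m`, `Λ` and the constants of
    -- `req₃`.
    strong : (K₁ * B) * (K₁ * B) * q ≤ Λ * Λ
    strong = begin
      (K₁ * B) * (K₁ * B) * q ≤⟨ *-monoʳ-≤ ((K₁ * B) * (K₁ * B)) (*-monoˡ-≤ Δ (*-mono-≤ C≤ C≤)) ⟩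
      (K₁ * B) * (K₁ * B) * ((c₃ * B) * (c₃ * B) * Δ)
        ≤⟨ *-monoʳ-≤ ((K₁ * B) * (K₁ * B)) (*-monoʳ-≤ ((c₃ * B) * (c₃ * B)) (*-monoˡ-≤ D₁ (≤-trans (≤-reflexive (sym (*-identityˡ _))) (*-monoˡ-≤ (2 ^ k) 1≤2^k)))) ⟩
      (K₁ * B) * (K₁ * B) * ((c₃ * B) * (c₃ * B) * (2 ^ k * 2 ^ k * D₁)) ≡⟨ lemma K₁ B c₃ (2 ^ k) β ⟩
      Λ * Λ ∎
      where
      open ≤-Reasoning
      lemma : ∀ a b c d e → (a * b) * (a * b) * ((c * b) * (c * b) * (d * d * ((b * e) * (b * e)))) ≡ c * d * a * (b * (b * (b * e))) * (c * d * a * (b * (b * (b * e))))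
      lemma = ℕR.solve-∀

    req₁ : q ≤ Λ * Λ
    req₁ = ≤-trans (≤-trans (≤-reflexive (sym (*-identityˡ q))) (*-monoˡ-≤ q (*-mono-≤ {1} {K₁ * B} (*-mono-≤ {1} {K₁} (s≤s z≤n) 1≤B) (*-mono-≤ {1} {K₁} (s≤s z≤n) 1≤B)))) strong

    req₂ : ∀ s → s ≤ k → T * (2 * (c₀ * (2 * suc C + 2 * (k * (β * (s * (s * (2 ^ k * C)))))))) ≤ Λ
    req₂ s s≤k = begin
      T * (2 * (c₀ * (2 * suc C + 2 * (k * (β * (s * (s * (2 ^ k * C))))))))
        ≤⟨ *-monoʳ-≤ T (*-monoʳ-≤ 2 (*-monoʳ-≤ c₀ (+-mono-≤ (*-monoʳ-≤ 2 (≤-trans C≤ (≤-trans (≤-reflexive (sym (*-identityʳ (c₃ * B)))) (*-monoʳ-≤ (c₃ * B) 1≤β))))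
             (*-monoʳ-≤ 2 (*-monoʳ-≤ k (*-monoʳ-≤ β (*-mono-≤ s≤k (*-mono-≤ s≤k (*-monoʳ-≤ (2 ^ k) (≤-trans (n≤1+n C) C≤)))))))))) ⟩
      T * (2 * (c₀ * (2 * (c₃ * B * β) + 2 * (k * (β * (k * (k * (2 ^ k * (c₃ * B)))))))))
        ≡⟨ lemma T c₀ c₃ k (2 ^ k) B β ⟩
      K₂ * (1 * (1 * (B * β))) ≤⟨ *-mono-≤ K₂≤K (*-mono-≤ 1≤B (*-mono-≤ 1≤B ≤-refl)) ⟩
      Λ ∎
      where
      open ≤-Reasoning
      lemma : ∀ t c a k d b e → t * (2 * (c * (2 * (a * b * e) + 2 * (k * (e * (k * (k * (d * (a * b)))))))))
        ≡ t * (2 * (c * (2 * a + 2 * (k * (k * (k * (d * a))))))) * (1 * (1 * (b * e)))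
      lemma = ℕR.solve-∀
      K₂≤K : K₂ ≤ K
      K₂≤K = ≤-trans (≤-trans (m≤m+n K₂ _) (n≤1+n _)) (≤-trans (≤-reflexive (sym (*-identityˡ K₁))) (*-monoˡ-≤ K₁ (*-mono-≤ {1} {c₃} (s≤s z≤n) 1≤2^k)))

    req₃ : ∀ s m → s ≤ k → m ≤ (2 * B) ^ Q →
      T * (2 * (m * (2 ^ k * (Cw * 2 ^ k))) * (2 ^ k * m * s * (2 * q ^ p))) * Λ ≤ Λ ^ (p + p) * m
    req₃ s m s≤k hm = begin
      T * (2 * (m * (2 ^ k * (Cw * 2 ^ k))) * (2 ^ k * m * s * (2 * q ^ p))) * Λ
        ≤⟨ *-monoˡ-≤ Λ (*-monoʳ-≤ T (*-monoʳ-≤ (2 * (m * (2 ^ k * (Cw * 2 ^ k)))) (*-monoˡ-≤ (2 * q ^ p) (*-monoʳ-≤ (2 ^ k * m) s≤k)))) ⟩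
      T * (2 * (m * (2 ^ k * (Cw * 2 ^ k))) * (2 ^ k * m * k * (2 * q ^ p))) * Λ ≡⟨ lemma T m (2 ^ k) Cw k (q ^ p) Λ ⟩
      c₇ * m * Λ * q ^ p * m ≤⟨ *-monoˡ-≤ m (*-monoˡ-≤ (q ^ p) slack) ⟩
      (K₁ * B) ^ (p + p) * q ^ p * m ≡⟨ cong (_* m) (trans (cong (_* q ^ p) (trans (^-distribˡ-+-* (K₁ * B) p p) (sym (*-^ (K₁ * B) (K₁ * B) p)))) (sym (*-^ ((K₁ * B) * (K₁ * B)) q p))) ⟩
      ((K₁ * B) * (K₁ * B) * q) ^ p * m ≤⟨ *-monoˡ-≤ m (^-monoˡ-≤ p strong) ⟩
      (Λ * Λ) ^ p * m ≡⟨ cong (_* m) (trans (*-^ Λ Λ p) (sym (^-distribˡ-+-* Λ p p))) ⟩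
      Λ ^ (p + p) * m ∎
      where
      open ≤-Reasoning
      lemma : ∀ t m d c k x l → t * (2 * (m * (d * (c * d))) * (d * m * k * (2 * x))) * l ≡ t * (2 * (d * (c * d))) * (d * k * 2) * m * l * x * m
      lemma = ℕR.solve-∀
      lemma₂ : ∀ c t x a d k b e → c * (t * x) * (a * d * k * (b * (b * (b * e)))) ≡ c * t * (a * d) * k * (x * (b * (b * (b * e))))
      lemma₂ = ℕR.solve-∀
      j : ℕ
      j = (b + b) + (b + b)
      exps : B ^ Q * (B * (B * (B * β))) ≡ B ^ (2 + j)
      exps = trans (sym (^-distribˡ-+-* B Q (3 + b′))) (cong (B ^_) (arith b′))
        where
        arith : ∀ x → 3 * suc x + (3 + x) ≡ 2 + ((suc x + suc x) + (suc x + suc x))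
        arith = ℕR.solve-∀
      1≤K₁B : 1 ≤ K₁ * B
      1≤K₁B = *-mono-≤ {1} {K₁} (s≤s z≤n) 1≤B
      slack : c₇ * m * Λ ≤ (K₁ * B) ^ (p + p)
      slack = begin
        c₇ * m * Λ ≤⟨ *-monoˡ-≤ Λ (*-monoʳ-≤ c₇ (≤-trans hm (≤-reflexive (*-^ 2 B Q)))) ⟩
        c₇ * (2 ^ Q * B ^ Q) * (c₃ * 2 ^ k * K₁ * (B * (B * (B * β)))) ≡⟨ lemma₂ c₇ (2 ^ Q) (B ^ Q) c₃ (2 ^ k) K₁ B β ⟩
        c₇ * 2 ^ Q * (c₃ * 2 ^ k) * K₁ * (B ^ Q * (B * (B * (B * β))))
          ≤⟨ *-mono-≤ (*-monoˡ-≤ K₁ (≤-trans (m≤n+m _ K₂) (n≤1+n _))) (≤-reflexive exps) ⟩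
        K₁ * K₁ * B ^ (2 + j) ≤⟨ *-monoˡ-≤ (B ^ (2 + j)) (≤-trans (≤-reflexive (cong (K₁ *_) (sym (*-identityʳ K₁)))) (^-monoʳ-≤ K₁ (m≤m+n 2 j))) ⟩
        K₁ ^ (2 + j) * B ^ (2 + j) ≡⟨ sym (*-^ K₁ B (2 + j)) ⟩
        (K₁ * B) ^ (2 + j) ≤⟨ ^-monoʳ-≤ (K₁ * B) {{>-nonZero 1≤K₁B}} (≤-trans (≤-trans (m≤n+m (2 + j) k) (m≤m+n p′ k)) (≤-reflexive (sym p+p≡p′+k))) ⟩
        (K₁ * B) ^ (p + p) ∎

-- Exceptional vertices and the descent through the scales

module Core {n : ℕ} (k : ℕ) (2≤k : 2 ≤ k) (es : List (Subset n)) (uni : ∀ e → e ∈ es → ∣ e ∣ ≡ k)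
  (cf : ℕ → ℕ) (cf0 : cf 0 ≡ 0) (1≤cf2 : 1 ≤ cf 2) (Cw : ℕ) (cf≤ : ∀ s → cf s ≤ Cw) (σ : ℕ) (bounded : CutBound k cf es σ)
  (b′ B : ℕ) (1≤B : 1 ≤ B) where

  open Constants k b′ Cw
  open Requirements B 1≤B

  private
    F : List (Fin n)
    F = allFin n
    m y : ℕ
    m = length es
    y = B * β

    heavy : Fin n → Fin n → Bool
    heavy u v = not (codeg es u v ≤ᵇ β)

    M : Matching heavy (allPairs n)
    M = maximal-matching heavy (λ u v h → subst (λ w → not (w ≤ᵇ β) ≡ true) (codeg-comm es u v) h) (allPairs n)

    open Matching M

    heavy⇒β≤ : ∀ u v → heavy u v ≡ true → β ≤ codeg es u v
    heavy⇒β≤ u v h with codeg es u v ≤? β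
    ... | no p  = <⇒≤ (≰⇒> p)
    ... | yes p rewrite ≤ᵇ-true p = contradiction h λ ()

    moved : Fin n → Bool
    moved u = π u ≠ᵇ u

    partner : Fin n → Fin n → Bool
    partner u w = (u ≠ᵇ w) ∧ does (π u ≟ w)

    partner-π : ∀ u w → partner u w ≡ true → u ≢ w × π u ≡ w
    partner-π u w h with π u ≟ w | ∧-true (u ≠ᵇ w) h
    ... | yes e | p , _ = ≠ᵇ-sound u w p , e

    π-partner : ∀ u w → u ≢ w → π u ≡ w → partner u w ≡ true
    π-partner u w ne e with π u ≟ w
    ... | yes _ = ∧-intro (≠ᵇ-complete u w ne) refl
    ... | no h  = contradiction e h

    partner-sym : ∀ u w → partner u w ≡ true → partner w u ≡ true
    partner-sym u w h with partner-π u w h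
    ... | ne , refl = π-partner (π u) u (λ e → ne (sym e)) (π-invol u)

    -- A matching is the case `Δ = 1`. Distinct vertices have distinct partners because `π` is an
    -- involution, so the transitivity condition is vacuous.
    matchedPairs-≤ : ∑ es (𝟙 ∘ hasPair partner) ≤ C₁ * (1 * σ)
    matchedPairs-≤ = Pairs.pairs-≤ k 2≤k es uni cf cf0 1≤cf2 Cw cf≤ σ bounded partner partner-sym
      (λ u w h → proj₁ (partner-π u w h))
      (λ u v w hu hv ne → contradiction (trans (sym (π-invol u)) (trans (cong π (trans (proj₂ (partner-π u w hu)) (sym (proj₂ (partner-π v w hv))))) (π-invol v))) ne)
      1 ≤-refl (λ u → ∑-at-most-one F _ (UniqueP.allFin⁺ n) (λ w → 𝟙≤1 (partner u w))
        (λ x z hx hz → trans (sym (proj₂ (partner-π u x (𝟙-≢0 hx)))) (proj₂ (partner-π u z (𝟙-≢0 hz)))))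
      (hasPair partner) (hasPair⁻ partner) (hasPair⁺ partner)

    ∣W∣ ∣U∣ : ℕ
    ∣W∣ = ∑ F (𝟙 ∘ moved)

    large : Fin n → Bool
    large u = not (deg es ⁅ u ⁆ ≤ᵇ D₁)

    ∣U∣ = ∑ F (𝟙 ∘ large)

    -- Each matched vertex shares at least `β` edges with its partner. All of these contain a
    -- matched pair, and none is counted for more than `k` vertices.
    ∣W∣-≤ : ∣W∣ * β ≤ k * (C₁ * (1 * σ))
    ∣W∣-≤ = begin
      ∣W∣ * β ≡⟨ sym (∑-*ʳ F β _) ⟩
      ∑ F (λ u → 𝟙 (moved u) * β) ≤⟨ ∑-mono F each ⟩
      ∑ F (λ u → ∑ es (λ e → 𝟙 (moved u) * (𝟙 (lookup e u) * 𝟙 (lookup e (π u))))) ≡⟨ ∑-swap F es _ ⟩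
      ∑ es (λ e → ∑ F (λ u → 𝟙 (moved u) * (𝟙 (lookup e u) * 𝟙 (lookup e (π u))))) ≤⟨ ∑-mono∈ es edge ⟩
      ∑ es (λ e → k * 𝟙 (hasPair partner e)) ≡⟨ ∑-*ˡ es k _ ⟩
      k * ∑ es (𝟙 ∘ hasPair partner) ≤⟨ *-monoʳ-≤ k matchedPairs-≤ ⟩
      k * (C₁ * (1 * σ)) ∎
      where
      open ≤-Reasoning
      each : ∀ u → 𝟙 (moved u) * β ≤ ∑ es (λ e → 𝟙 (moved u) * (𝟙 (lookup e u) * 𝟙 (lookup e (π u))))
      each u with moved u in eq
      ... | false = z≤n
      ... | true  = ≤-trans (≤-reflexive (*-identityˡ β)) (≤-trans (heavy⇒β≤ u (π u) (π-heavy u (≠ᵇ-sound (π u) u eq)))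
            (≤-reflexive (∑-cong es (λ e → sym (*-identityˡ _)))))
      edge : ∀ e → e ∈ es → ∑ F (λ u → 𝟙 (moved u) * (𝟙 (lookup e u) * 𝟙 (lookup e (π u)))) ≤ k * 𝟙 (hasPair partner e)
      edge e e∈ = ≤-trans (∑-mono F vertex) (≤-reflexive (trans (∑-*ʳ F _ _) (cong (_* 𝟙 (hasPair partner e)) (trans (∑-lookup e) (uni e e∈)))))
        where
        vertex : ∀ u → 𝟙 (moved u) * (𝟙 (lookup e u) * 𝟙 (lookup e (π u))) ≤ 𝟙 (lookup e u) * 𝟙 (hasPair partner e)
        vertex u with moved u in eq₁ | lookup e u in eq₂ | lookup e (π u) in eq₃
        ... | false | _     | _     = z≤n
        ... | true  | false | _     = z≤n
        ... | true  | true  | false = z≤n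
        ... | true  | true  | true  = ≤-trans (𝟙≡1 (hasPair⁺ partner e u (π u) eq₂ eq₃
              (π-partner u (π u) (λ e → ≠ᵇ-sound (π u) u eq₁ (sym e)) refl))) (≤-reflexive (sym (*-identityˡ _)))

    ∣U∣-≤ : ∣U∣ * D₁ ≤ m * k
    ∣U∣-≤ = begin
      ∣U∣ * D₁ ≡⟨ sym (∑-*ʳ F D₁ _) ⟩
      ∑ F (λ u → 𝟙 (large u) * D₁) ≤⟨ ∑-mono F each ⟩
      ∑ F (λ u → deg es ⁅ u ⁆) ≡⟨ ∑-swap F es _ ⟩
      ∑ es (λ e → ∑ F (λ u → 𝟙 (⁅ u ⁆ ⊆ᵇ e))) ≤⟨ ∑-bound es k (λ e e∈ → ≤-trans (∑-mono F (λ u → 𝟙-mono (λ h → ⊆ᵇ-sound ⁅ u ⁆ e h u (lookup-⁅⁆ u))))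
          (≤-reflexive (trans (∑-lookup e) (uni e e∈)))) ⟩
      m * k ∎
      where
      open ≤-Reasoning
      each : ∀ u → 𝟙 (large u) * D₁ ≤ deg es ⁅ u ⁆
      each u with deg es ⁅ u ⁆ ≤? D₁
      ... | yes p rewrite ≤ᵇ-true p = z≤n
      ... | no p = ≤-trans (*-monoˡ-≤ D₁ (𝟙≤1 (large u))) (≤-trans (≤-reflexive (*-identityˡ D₁)) (<⇒≤ (≰⇒> p)))

    exceptional : Fin n → Bool
    exceptional u = large u ∨ moved u

    not-exceptional : ∀ u → exceptional u ≡ false → deg es ⁅ u ⁆ ≤ D₁ × π u ≡ u
    not-exceptional u h with deg es ⁅ u ⁆ ≤ᵇ D₁ in eq | π u ≟ u
    ... | true | yes e = true-≤ᵇ _ _ eq , e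

    light : ∀ u v → exceptional u ≡ false → exceptional v ≡ false → u ≢ v → codeg es u v ≤ β
    light u v hu hv ne with heavy u v in eq
    ... | true with maximal u v (∈-allPairs u v) eq ne
    ...   | inj₁ p = contradiction (proj₂ (not-exceptional u hu)) p
    ...   | inj₂ p = contradiction (proj₂ (not-exceptional v hv)) p
    light u v hu hv ne | false with codeg es u v ≤ᵇ β in eq′
    ... | true = true-≤ᵇ _ _ eq′

    clique : Fin n → Fin n → Bool
    clique u w = (exceptional u ∧ exceptional w) ∧ (u ≠ᵇ w)

    clique⁻ : ∀ u w → clique u w ≡ true → exceptional u ≡ true × exceptional w ≡ true × u ≢ w
    clique⁻ u w h with ∧-true (exceptional u ∧ exceptional w) h
    ... | p , ne with ∧-true (exceptional u) p
    ...   | hu , hw = hu , hw , ≠ᵇ-sound u w ne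

    clique⁺ : ∀ u w → exceptional u ≡ true → exceptional w ≡ true → u ≢ w → clique u w ≡ true
    clique⁺ u w hu hw ne = ∧-intro (∧-intro hu hw) (≠ᵇ-complete u w ne)

    exceptionalPairs-≤ : ∀ Δ′ → 1 ≤ Δ′ → ∑ F (𝟙 ∘ exceptional) ≤ Δ′ → ∑ es (𝟙 ∘ hasPair clique) ≤ C₁ * (Δ′ * σ)
    exceptionalPairs-≤ Δ′ 1≤ hΔ = Pairs.pairs-≤ k 2≤k es uni cf cf0 1≤cf2 Cw cf≤ σ bounded clique
      (λ u w h → let (p , q , r) = clique⁻ u w h in clique⁺ w u q p (λ e → r (sym e)))
      (λ u w h → proj₂ (proj₂ (clique⁻ u w h)))
      (λ u v w hu hv ne → clique⁺ u v (proj₁ (clique⁻ u w hu)) (proj₁ (clique⁻ v w hv)) ne)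
      Δ′ 1≤ (λ u → ≤-trans (∑-mono F (λ w → 𝟙-mono (λ h → proj₁ (proj₂ (clique⁻ u w h))))) hΔ)
      (hasPair clique) (hasPair⁻ clique) (hasPair⁺ clique)

    ordinary : Subset n
    ordinary = Vec.tabulate (not ∘ exceptional)

    ordinary⁻ : ∀ u → ordinary ∋ u → exceptional u ≡ false
    ordinary⁻ u h with exceptional u in eq | trans (sym (VecP.lookup∘tabulate (not ∘ exceptional) u)) h
    ... | false | _ = refl
    ... | true  | ()

    B₂ : ℕ
    B₂ = 2 * B

    1≤B₂ : 1 ≤ B₂
    1≤B₂ = ≤-trans 1≤B (m≤m+n B _)

    -- When `c` drops by one, sizes are divided by 4 and degrees multiplied by `B₂`. Scale `Q` asks
    -- for a single edge; at scale 0 the threshold is `B₂ ^ Q`, the assumed upper bound for `m`.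
    s₀ D : ℕ → ℕ
    s₀ c = 2 * 4 ^ c
    D c = B₂ ^ (Q ∸ c)

    test : ℕ → Subset n → Subset n → Bool
    test c t Y = not ((Y ⊆ᵇ t) ∧ (s₀ c ≤ᵇ ∣ Y ∣)) ∨ (deg es Y ≤ᵇ B₂ * D c)

    mem : ℕ → Subset n → Bool
    mem c t = (∣ t ∣ ≤ᵇ 4 * s₀ c) ∧ ((4 * s₀ c ≤ᵇ ∣ t ∣) ∧ ((t ⊆ᵇ ordinary) ∧ ((D c ≤ᵇ deg es t) ∧ all𝟚 (test c t) (allS n))))

    mem⁻ : ∀ c t → mem c t ≡ true → ∣ t ∣ ≡ 4 * s₀ c × t ⊆′ ordinary × D c ≤ deg es t × (∀ Y → Y ⊆′ t → s₀ c ≤ ∣ Y ∣ → deg es Y ≤ B₂ * D c)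
    mem⁻ c t h with ∧-true (∣ t ∣ ≤ᵇ 4 * s₀ c) h
    ... | h₁ , r₁ with ∧-true (4 * s₀ c ≤ᵇ ∣ t ∣) r₁
    ...   | h₂ , r₂ with ∧-true (t ⊆ᵇ ordinary) r₂
    ...     | h₃ , r₃ with ∧-true (D c ≤ᵇ deg es t) r₃
    ...       | h₄ , h₅ = ≤-antisym (true-≤ᵇ _ _ h₁) (true-≤ᵇ _ _ h₂) , ⊆ᵇ-sound t ordinary h₃ , true-≤ᵇ _ _ h₄ , spread
      where
      spread : ∀ Y → Y ⊆′ t → s₀ c ≤ ∣ Y ∣ → deg es Y ≤ B₂ * D c
      spread Y Y⊆ sz with all𝟚-sound (test c t) (allS n) h₅ (∈-allS Y)
      ... | p rewrite ⊆ᵇ-complete Y t Y⊆ | ≤ᵇ-true sz = true-≤ᵇ _ _ p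

    hasMem : ℕ → Subset n → Bool
    hasMem c e = 1 ≤ᵇ ∑ (allS n) (λ t → 𝟙 (mem c t) * 𝟙 (t ⊆ᵇ e))

    hasMem⁻ : ∀ c e → hasMem c e ≡ true → ∃[ t ] (mem c t ≡ true × t ⊆′ e)
    hasMem⁻ c e h with ∑-≢0 (allS n) _ (λ z → contradiction (≤-trans (true-≤ᵇ 1 _ h) (≤-reflexive z)) λ ())
    ... | t , _ , ht = t , 𝟙-≢0 (*≢0ˡ (𝟙 (mem c t)) ht) , ⊆ᵇ-sound t e (𝟙-≢0 (*≢0ʳ (𝟙 (mem c t)) ht))

    hasMem⁺ : ∀ c e t → mem c t ≡ true → t ⊆′ e → hasMem c e ≡ true
    hasMem⁺ c e t mt t⊆ = ≤ᵇ-true (≤-trans (*-mono-≤ (𝟙≡1 mt) (𝟙≡1 (⊆ᵇ-complete t e t⊆)))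
      (∑-≥ (λ t → 𝟙 (mem c t) * 𝟙 (t ⊆ᵇ e)) (∈-allS t)))

  module _ (m-lower : y * (y * y) ≤ m) (m-upper : m ≤ (2 * B) ^ Q)
    (1≤cf-level : ∀ c → c ≤ Q → 1 ≤ cf (4 * (2 * 4 ^ c))) (k-large : 4 * (2 * 4 ^ Q) <ᴺ k) where

    -- If t is not spread out at level c, some quarter of it lies in B₂ times as many edges; by the
    -- upper bound on m this cannot go on beyond level 0.
    descend : ∀ c → c ≤ Q → ∀ t → ∣ t ∣ ≡ 4 * s₀ c → t ⊆′ ordinary → D c ≤ deg es t →
      ∃[ c′ ] ∃[ t′ ] (c′ ≤ Q × t′ ⊆′ t × mem c′ t′ ≡ true)
    descend c c≤Q t sz ord dg with all𝟚 (test c t) (allS n) in eq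
    ... | true  = c , t , c≤Q , (λ x h → h) , ∧-intro (≤ᵇ-true (≤-reflexive sz)) (∧-intro (≤ᵇ-true (≤-reflexive (sym sz)))
          (∧-intro (⊆ᵇ-complete t ordinary ord) (∧-intro (≤ᵇ-true dg) eq)))
    ... | false with all𝟚-false (test c t) (allS n) eq
    ...   | Y , hY = next c c≤Q sz hY
      where
      unpack : ∀ c → test c t Y ≡ false → Y ⊆′ t × s₀ c ≤ ∣ Y ∣ × B₂ * D c <ᴺ deg es Y
      unpack c h with Y ⊆ᵇ t in e₁ | s₀ c ≤ᵇ ∣ Y ∣ in e₂ | deg es Y ≤? B₂ * D c
      ... | true | true | no p = ⊆ᵇ-sound Y t e₁ , true-≤ᵇ _ _ e₂ , ≰⇒> p
      ... | true | true | yes p = contradiction (trans (sym h) (≤ᵇ-true p)) λ ()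
      next : ∀ c → c ≤ Q → ∣ t ∣ ≡ 4 * s₀ c → test c t Y ≡ false → ∃[ c′ ] ∃[ t′ ] (c′ ≤ Q × t′ ⊆′ t × mem c′ t′ ≡ true)
      -- At scale 0, `Y` would lie in more than `B₂ * B₂ ^ Q` edges, which exceeds `m`.
      next zero c≤Q sz h with unpack zero h
      ... | _ , _ , lt = contradiction (≤-trans (≤-trans (s≤s (≤-trans m-upper (m≤n*m _ B₂ {{>-nonZero 1≤B₂}}))) lt) (deg≤length es Y)) 1+n≰n
      next (suc c) c≤Q sz h with unpack (suc c) h
      ... | Y⊆ , szY , lt with subset-of-size Y (s₀ (suc c)) szY
      -- `Y` may be larger than a quarter. Cutting it down to `s₀ (suc c) = 4 * s₀ c` points gives
      -- the exact size of scale `c` and can only increase the degree.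
      ...   | t′ , t′⊆Y , sz′ with descend c (≤-trans (n≤1+n c) c≤Q) t′ (trans sz′ (perm (4 ^ c))) (λ x h → ord x (Y⊆ x (t′⊆Y x h)))
                (≤-trans (≤-trans (≤-reflexive (cong (B₂ ^_) (sym (trans (sym (+-∸-assoc 1 c≤Q)) refl)))) (<⇒≤ lt)) (deg-anti es t′ Y t′⊆Y))
        where
        perm : ∀ x → 2 * (4 * x) ≡ 4 * (2 * x)
        perm = ℕR.solve-∀
      ...     | c′ , t″ , c′≤ , t″⊆ , mt = c′ , t″ , c′≤ , (λ x h → Y⊆ x (t′⊆Y x (t″⊆ x h))) , mt

    levels : List ℕ
    levels = upTo (suc Q)

    -- Without a pair from the clique an edge has at most one exceptional vertex; the strict
    -- inequality in `k-large` pays for it.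
    ordinary-part : ∀ e → e ∈ es → hasPair clique e ≡ false → 4 * s₀ Q ≤ ∣ e ∩ ordinary ∣
    ordinary-part e e∈ good = ≤-pred (≤-trans k-large (≤-trans (≤-reflexive (sym (uni e e∈))) (begin
      ∣ e ∣ ≡⟨ sym (∑-lookup e) ⟩
      ∑ F (λ u → 𝟙 (lookup e u)) ≤⟨ ∑-mono F split ⟩
      ∑ F (λ u → 𝟙 (lookup e u) * 𝟙 (exceptional u) + 𝟙 (lookup (e ∩ ordinary) u)) ≡⟨ trans (∑-+ F _ _) (cong (λ w → ∑ F (λ u → 𝟙 (lookup e u) * 𝟙 (exceptional u)) + w) (∑-lookup (e ∩ ordinary))) ⟩
      ∑ F (λ u → 𝟙 (lookup e u) * 𝟙 (exceptional u)) + ∣ e ∩ ordinary ∣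
        ≤⟨ +-monoˡ-≤ _ (∑-at-most-one F _ (UniqueP.allFin⁺ n) (λ u → *-mono-≤ (𝟙≤1 (lookup e u)) (𝟙≤1 (exceptional u))) same) ⟩
      1 + ∣ e ∩ ordinary ∣ ∎)))
      where
      open ≤-Reasoning
      split : ∀ u → 𝟙 (lookup e u) ≤ 𝟙 (lookup e u) * 𝟙 (exceptional u) + 𝟙 (lookup (e ∩ ordinary) u)
      split u rewrite lookup-zipWith _∧_ u e ordinary | VecP.lookup∘tabulate (not ∘ exceptional) u with lookup e u | exceptional u
      ... | true  | true  = s≤s z≤n
      ... | true  | false = s≤s z≤n
      ... | false | _     = z≤n
      same : ∀ u w → 𝟙 (lookup e u) * 𝟙 (exceptional u) ≢ 0 → 𝟙 (lookup e w) * 𝟙 (exceptional w) ≢ 0 → u ≡ w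
      same u w hu hw with u ≟ w
      ... | yes p = p
      ... | no ne = contradiction (trans (sym good) (hasPair⁺ clique e u w (𝟙-≢0 (*≢0ˡ (𝟙 (lookup e u)) hu)) (𝟙-≢0 (*≢0ˡ (𝟙 (lookup e w)) hw))
            (clique⁺ u w (𝟙-≢0 (*≢0ʳ (𝟙 (lookup e u)) hu)) (𝟙-≢0 (*≢0ʳ (𝟙 (lookup e w)) hw)) ne))) λ ()

    some-level : ∀ e → e ∈ es → 1 ≤ 𝟙 (hasPair clique e) + ∑ levels (λ c → 𝟙 (hasMem c e))
    some-level e e∈ with hasPair clique e in eq
    ... | true  = s≤s z≤n
    ... | false with subset-of-size (e ∩ ordinary) (4 * s₀ Q) (ordinary-part e e∈ eq)
    ...   | t , t⊆ , sz with descend Q ≤-refl t sz (λ x h → proj₂ (∋-∩⁻ e ordinary x (t⊆ x h))) deg≥1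
      where
      deg≥1 : D Q ≤ deg es t
      deg≥1 rewrite n∸n≡0 Q = ≤-trans (𝟙≡1 (⊆ᵇ-complete t e (λ x h → proj₁ (∋-∩⁻ e ordinary x (t⊆ x h))))) (∑-≥ (λ e → 𝟙 (t ⊆ᵇ e)) e∈)
    ...     | c , t′ , c≤ , t′⊆ , mt = ≤-trans (𝟙≡1 (hasMem⁺ c e t′ mt (λ x h → proj₁ (∋-∩⁻ e ordinary x (t⊆ x (t′⊆ x h))))))
              (∑-≥ (λ c → 𝟙 (hasMem c e)) (∈-upTo⁺ (s≤s c≤)))

    level : ∀ c → c ≤ Q → 2 * T * ∑ es (𝟙 ∘ hasMem c) ≤ T * (2 ^ k * Λ * σ) + 2 * m
    level c c≤Q = Level.Conclude.level-≤ k 2≤k es uni cf cf0 Cw cf≤ σ bounded (s₀ c) 1≤s₀ (1≤cf-level c c≤Q) (mem c)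
      B₂ (D c) D₁ β 1≤B₂ (m^n>0 B₂ {{>-nonZero 1≤B₂}} (Q ∸ c)) 1≤D₁ 1≤β
      (λ t h → proj₁ (mem⁻ c t h)) (λ t h → proj₁ (proj₂ (proj₂ (mem⁻ c t h)))) (λ t Y h → proj₂ (proj₂ (proj₂ (mem⁻ c t h))) Y)
      (λ t u h u∈ → proj₁ (not-exceptional u (ordinary⁻ u (proj₁ (proj₂ (mem⁻ c t h)) u u∈))))
      (λ t t′ u v h h′ u∈ v∈ ne → light u v (ordinary⁻ u (proj₁ (proj₂ (mem⁻ c t h)) u u∈)) (ordinary⁻ v (proj₁ (proj₂ (mem⁻ c t′ h′)) v v∈)) ne)
      κ p p′ p+p≡p′+k
      (≤-trans (+-monoʳ-≤ k (+-mono-≤ s≤k (+-mono-≤ s≤k (*-monoʳ-≤ k s≤k)))) (m≤m+n _ _))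
      (≤-trans (+-monoʳ-≤ 1 (*-monoʳ-≤ (p + p) s≤k)) (m≤n+m _ _))
      Λ 1≤Λ T req₁ (req₂ (4 * s₀ c) s≤k) (req₃ (4 * s₀ c) m s≤k m-upper) (hasMem c) (hasMem⁻ c)
      where
      1≤s₀ : 1 ≤ s₀ c
      1≤s₀ = *-mono-≤ {1} {2} (s≤s z≤n) (m^n>0 4 c)
      s≤k : 4 * s₀ c ≤ k
      s≤k = ≤-trans (*-monoʳ-≤ 4 (*-monoʳ-≤ 2 (^-monoʳ-≤ 4 c≤Q))) (<⇒≤ k-large)

    -- If the claim failed, `σ` would be so small that there are only `O(y)` exceptional vertices,
    -- with `y = B * β`, and at most half of the edges contain two of them. The scales then cover
    -- the other half, and the bounds for them give the claim after all.
    core : β * β ≤ C* * σ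
    core with β * β ≤? C* * σ
    ... | yes p = p
    ... | no ¬p = contradiction final ¬p
      where
      open ≤-Reasoning
      Cσ≤ : C* * σ ≤ β * β
      Cσ≤ = <⇒≤ (≰⇒> ¬p)
      1≤y : 1 ≤ y
      1≤y = *-mono-≤ 1≤B 1≤β
      W≤ : ∣W∣ ≤ β
      W≤ = *-cancelʳ-≤ ∣W∣ β β {{>-nonZero 1≤β}} (begin
        ∣W∣ * β ≤⟨ ∣W∣-≤ ⟩
        k * (C₁ * (1 * σ)) ≡⟨ lemma k C₁ σ ⟩
        k * C₁ * σ ≤⟨ *-monoˡ-≤ σ (m≤m+n (k * C₁) _) ⟩
        C* * σ ≤⟨ Cσ≤ ⟩
        β * β ∎)
        where
        lemma : ∀ k c s → k * (c * (1 * s)) ≡ k * c * s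
        lemma = ℕR.solve-∀
      U≤ : ∣U∣ ≤ k * 2 ^ Q * y
      U≤ = *-cancelʳ-≤ ∣U∣ (k * 2 ^ Q * y) D₁ {{>-nonZero 1≤D₁}} (begin
        ∣U∣ * D₁ ≤⟨ ∣U∣-≤ ⟩
        m * k ≤⟨ *-monoˡ-≤ k (≤-trans m-upper (≤-reflexive (trans (*-^ 2 B Q) (cong (2 ^ Q *_) cube)))) ⟩
        2 ^ Q * (y * (y * y)) * k ≡⟨ lemma (2 ^ Q) y k ⟩
        k * 2 ^ Q * y * D₁ ∎)
        where
        lemma : ∀ q y k → q * (y * (y * y)) * k ≡ k * q * y * (y * y)
        lemma = ℕR.solve-∀
        cube : B ^ Q ≡ y * (y * y)
        cube = trans (cong (B ^_) (three b)) (trans (^-distribˡ-+-* B b (b + b)) (cong (y *_) (^-distribˡ-+-* B b b)))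
          where
          three : ∀ b → 3 * b ≡ b + (b + b)
          three = ℕR.solve-∀
      X≤ : ∑ F (𝟙 ∘ exceptional) ≤ c-X * y
      X≤ = begin
        ∑ F (𝟙 ∘ exceptional) ≤⟨ ∑-mono F (λ u → 𝟙-∨ (large u) (moved u)) ⟩
        ∑ F (λ u → 𝟙 (large u) + 𝟙 (moved u)) ≡⟨ ∑-+ F _ _ ⟩
        ∣U∣ + ∣W∣ ≤⟨ +-mono-≤ U≤ (≤-trans W≤ (m≤n*m β B {{>-nonZero 1≤B}})) ⟩
        k * 2 ^ Q * y + y ≡⟨ +-comm _ y ⟩
        c-X * y ∎
        where
        𝟙-∨ : ∀ a b → 𝟙 (a ∨ b) ≤ 𝟙 a + 𝟙 b
        𝟙-∨ true  b = s≤s z≤n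
        𝟙-∨ false b = ≤-refl
      GX GS : ℕ
      GX = ∑ es (𝟙 ∘ hasPair clique)
      GS = ∑ levels (λ c → ∑ es (𝟙 ∘ hasMem c))
      GX≤ : 2 * GX ≤ m
      GX≤ = begin
        2 * GX ≤⟨ *-monoʳ-≤ 2 (exceptionalPairs-≤ (c-X * y) (*-mono-≤ {1} {c-X} (s≤s z≤n) 1≤y) X≤) ⟩
        2 * (C₁ * (c-X * y * σ)) ≡⟨ lemma C₁ c-X y σ ⟩
        2 * (C₁ * c-X) * σ * y ≤⟨ *-monoˡ-≤ y (≤-trans (*-monoˡ-≤ σ (≤-trans (m≤m+n (2 * (C₁ * c-X)) _) (m≤n+m _ (k * C₁)))) Cσ≤) ⟩
        β * β * y ≤⟨ *-monoˡ-≤ y (*-mono-≤ β≤y β≤y) ⟩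
        y * y * y ≡⟨ *-assoc y y y ⟩
        y * (y * y) ≤⟨ m-lower ⟩
        m ∎
        where
        lemma : ∀ c x y s → 2 * (c * (x * y * s)) ≡ 2 * (c * x) * s * y
        lemma = ℕR.solve-∀
        β≤y : β ≤ y
        β≤y = m≤n*m β B {{>-nonZero 1≤B}}
      m≤ : m ≤ GX + GS
      m≤ = begin
        m ≡⟨ trans (sym (*-identityʳ m)) (sym (∑-const es 1)) ⟩
        ∑ es (λ _ → 1) ≤⟨ ∑-mono∈ es some-level ⟩
        ∑ es (λ e → 𝟙 (hasPair clique e) + ∑ levels (λ c → 𝟙 (hasMem c e))) ≡⟨ trans (∑-+ es _ _) (cong (λ w → GX + w) (∑-swap es levels _)) ⟩
        GX + GS ∎
      GS≤ : 2 * T * GS ≤ suc Q * (T * (2 ^ k * Λ * σ) + 2 * m)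
      GS≤ = begin
        2 * T * GS ≡⟨ sym (∑-*ˡ levels (2 * T) (λ c → ∑ es (𝟙 ∘ hasMem c))) ⟩
        ∑ levels (λ c → 2 * T * ∑ es (𝟙 ∘ hasMem c)) ≤⟨ ∑-bound levels _ (λ c c∈ → level c (≤-pred (∈-upTo⁻ c∈))) ⟩
        length levels * (T * (2 ^ k * Λ * σ) + 2 * m) ≡⟨ cong (_* (T * (2 ^ k * Λ * σ) + 2 * m)) (ListP.length-upTo (suc Q)) ⟩
        suc Q * (T * (2 ^ k * Λ * σ) + 2 * m) ∎
      m≤2GS : m ≤ 2 * GS
      m≤2GS = +-cancelˡ-≤ m m (2 * GS) (begin
        m + m ≡⟨ dbl m ⟩
        2 * m ≤⟨ *-monoʳ-≤ 2 m≤ ⟩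
        2 * (GX + GS) ≡⟨ *-distribˡ-+ 2 GX GS ⟩
        2 * GX + 2 * GS ≤⟨ +-monoˡ-≤ (2 * GS) GX≤ ⟩
        m + 2 * GS ∎)
        where
        dbl : ∀ x → x + x ≡ 2 * x
        dbl = ℕR.solve-∀
      m≤TΛσ : 2 * m ≤ T * (2 ^ k * Λ * σ)
      m≤TΛσ = +-cancelʳ-≤ (2 * m) (2 * m) (T * (2 ^ k * Λ * σ)) (*-cancelˡ-≤ (suc Q) (begin
        suc Q * (2 * m + 2 * m) ≡⟨ lemma (suc Q) m ⟩
        T * m ≤⟨ *-monoʳ-≤ T m≤2GS ⟩
        T * (2 * GS) ≡⟨ lemma₂ T GS ⟩
        2 * T * GS ≤⟨ GS≤ ⟩
        suc Q * (T * (2 ^ k * Λ * σ) + 2 * m) ∎))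
        where
        lemma : ∀ q m → q * (2 * m + 2 * m) ≡ 4 * q * m
        lemma = ℕR.solve-∀
        lemma₂ : ∀ t g → t * (2 * g) ≡ 2 * t * g
        lemma₂ = ℕR.solve-∀
      final : β * β ≤ C* * σ
      -- `B * y * B` is `B^(b+2)`, the power of `B` in `Λ`; cancelled from `m ≥ B^(3b)` it leaves
      -- `B^(2b-2) = β * β`.
      final = ≤-trans (*-cancelˡ-≤ (B * y * B) {{>-nonZero (*-mono-≤ (*-mono-≤ 1≤B 1≤y) 1≤B)}} (begin
        B * y * B * (β * β) ≡⟨ lemma B β ⟩
        y * (y * y) ≤⟨ m-lower ⟩
        m ≤⟨ m≤m+n m _ ⟩
        2 * m ≤⟨ m≤TΛσ ⟩
        T * (2 ^ k * (K * (B * (B * (B * β)))) * σ) ≡⟨ lemma₂ T (2 ^ k) K B β σ ⟩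
        B * y * B * (T * (2 ^ k * K) * σ) ∎)) (*-monoˡ-≤ σ (≤-trans (m≤n+m (T * (2 ^ k * K)) (2 * (C₁ * c-X))) (m≤n+m _ (k * C₁))))
        where
        lemma : ∀ b e → b * (b * e) * b * (e * e) ≡ b * e * ((b * e) * (b * e))
        lemma = ℕR.solve-∀
        lemma₂ : ∀ t d k b e s → t * (d * (k * (b * (b * (b * e)))) * s) ≡ b * (b * e) * b * (t * (d * k) * s)
        lemma₂ = ℕR.solve-∀

-- Random cuts

remove : Subset n → Fin n → Subset n
remove H c = H Vec.[ c ]≔ false

-- `H` is the set of colours still missing. Updating it entry by entry lets weighted counts be
-- computed by recursion on the list.
covers : Subset n → List (Fin n) → Bool
covers H []      = empty H
covers H (c ∷ g) = covers (remove H c) g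

covers-sound : (H : Subset n) (g : List (Fin n)) → covers H g ≡ true → ∀ j → H ∋ j → j ∈ g
covers-sound H []      h j p = contradiction (trans (sym h) (empty-∋ H j p)) λ ()
covers-sound H (c ∷ g) h j p with j ≟ c
... | yes refl = here refl
... | no j≢c   = there (covers-sound (remove H c) g h j (trans (VecP.lookup∘update′ j≢c H false) p))

covers-complete : (H : Subset n) (g : List (Fin n)) → (∀ j → H ∋ j → j ∈ g) → covers H g ≡ true
covers-complete H []      h = none H (λ j p → case h j p of λ ())
  where
  none : ∀ {n} (H : Subset n) → (∀ j → H ∋ j → Absurd) → empty H ≡ true
  none []          h = refl
  none (true ∷ H)  h = ⊥-elim (h zero refl)
  none (false ∷ H) h = none H (λ j → h (suc j))
covers-complete H (c ∷ g) h = covers-complete (remove H c) g sub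
  where
  sub : ∀ j → remove H c ∋ j → j ∈ g
  sub j p with j ≟ c
  ... | yes refl = contradiction (trans (sym (VecP.lookup∘update j H false)) p) λ ()
  ... | no j≢c with h j (trans (sym (VecP.lookup∘update′ j≢c H false)) p)
  ...   | here e  = contradiction e j≢c
  ...   | there q = q

-- A colour outside `H` changes nothing, a colour in `H` lowers the size by one. Counts depending
-- only on the size therefore satisfy the recursion of `surj`.
∑-remove : (H : Subset n) (f : ℕ → ℕ) → ∑ (allFin n) (λ c → f (∣ remove H c ∣)) ≡ (n ∸ ∣ H ∣) * f (∣ H ∣) + ∣ H ∣ * f (∣ H ∣ ∸ 1)
∑-remove []                  f = refl
∑-remove {suc n} (b ∷ H) f = trans (cong (λ w → f (∣ false ∷ H ∣) + w) (trans (cong (λ l → ∑ l (λ c → f (∣ remove (b ∷ H) c ∣))) (sym (ListP.map-tabulate id suc))) (∑-map suc (allFin n) _))) (rest b)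
  where
  rest : ∀ b → f (∣ H ∣) + ∑ (allFin n) (λ c → f (∣ b ∷ remove H c ∣)) ≡ (suc n ∸ ∣ b ∷ H ∣) * f (∣ b ∷ H ∣) + ∣ b ∷ H ∣ * f (∣ b ∷ H ∣ ∸ 1)
  rest false = trans (cong (λ w → f (∣ H ∣) + w) (∑-remove H f)) (trans (sym (+-assoc (f (∣ H ∣)) ((n ∸ ∣ H ∣) * f (∣ H ∣)) _))
    (cong (λ w → w * f (∣ H ∣) + ∣ H ∣ * f (∣ H ∣ ∸ 1)) (sym (+-∸-assoc 1 (SubP.∣p∣≤n H)))))
  rest true  = trans (cong (λ w → f (∣ H ∣) + w) (∑-remove H (f ∘ suc))) (trans (swap (f (∣ H ∣)) ((n ∸ ∣ H ∣) * f (suc ∣ H ∣)) _)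
    (cong (λ w → (n ∸ ∣ H ∣) * f (suc ∣ H ∣) + (f (∣ H ∣) + w)) (lower ∣ H ∣)))
    where
    swap : ∀ a b c → a + (b + c) ≡ b + (a + c)
    swap = ℕR.solve-∀
    lower : ∀ h → h * f (suc (h ∸ 1)) ≡ h * f h
    lower zero    = refl
    lower (suc h) = refl

∣remove∣ : (H : Subset n) (c : Fin n) → H ∋ c → suc ∣ remove H c ∣ ≡ ∣ H ∣
∣remove∣ (true ∷ H)  zero    p = refl
∣remove∣ (true ∷ H)  (suc c) p = cong suc (∣remove∣ H c p)
∣remove∣ (false ∷ H) (suc c) p = ∣remove∣ H c p

-- Lists of length l over d + h colours that use all of the last h colours.
surj : ℕ → ℕ → ℕ → ℕ
surj d zero    zero    = 1
surj d (suc h) zero    = 0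
surj d h       (suc l) = d * surj d h l + h * surj (suc d) (h ∸ 1) l

-- The additional free colour is either absent from the list or occurs in it.
surj-free : ∀ d h l → surj (suc d) h l ≡ surj d h l + surj d (suc h) l
surj-free d zero    zero    = refl
surj-free d (suc h) zero    = refl
surj-free d zero    (suc l) = trans (cong (λ w → w + d * w + 0) (surj-free d 0 l)) (trans (lemma d (surj d 0 l) (surj d 1 l))
    (cong (λ w → d * surj d 0 l + 0 + (d * surj d 1 l + 1 * w)) (sym (surj-free d 0 l))))
  where
  lemma : ∀ d x y → (x + y) + d * (x + y) + 0 ≡ d * x + 0 + (d * y + 1 * (x + y))
  lemma = ℕR.solve-∀
surj-free d (suc h) (suc l) = trans (cong₂ (λ u w → u + d * u + suc h * w) (surj-free d (suc h) l) (surj-free (suc d) h l))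
  (trans (lemma d h (surj d (suc h) l) (surj d (suc (suc h)) l) (surj (suc d) h l) (surj (suc d) (suc h) l) (surj-free d (suc h) l)) refl)
  where
  lemma : ∀ d h x y z w → w ≡ x + y → x + y + d * (x + y) + suc h * (z + w) ≡ d * x + suc h * z + (d * y + suc (suc h) * w)
  lemma d h x y z .(x + y) refl = ring d h x y z
    where
    ring : ∀ d h x y z → x + y + d * (x + y) + suc h * (z + (x + y)) ≡ d * x + suc h * z + (d * y + suc (suc h) * (x + y))
    ring = ℕR.solve-∀

surj≡stirling2 : ∀ h l → surj 0 h l ≡ stirling2 l h * h !
surj≡stirling2 zero    zero    = refl
surj≡stirling2 (suc h) zero    = refl
surj≡stirling2 zero    (suc l) = refl
surj≡stirling2 (suc h) (suc l) = trans (cong (λ w → suc h * w) (trans (surj-free 0 h l) (cong₂ _+_ (surj≡stirling2 h l) (surj≡stirling2 (suc h) l))))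
  (ring h (stirling2 l h) (stirling2 l (suc h)) (h !))
  where
  ring : ∀ h s t f → suc h * (s * f + t * (suc h * f)) ≡ (suc h * t + s) * (suc h * f)
  ring = ℕR.solve-∀

-- Expectations over independent random colours

module _ {r : ℕ} where

  -- An unnormalised expectation: the entries are independent, with the given weights. `TV` is the
  -- same for colourings of all vertices.
  TS : List (Fin r → ℤ) → (List (Fin r) → ℤ) → ℤ
  TS []       φ = φ []
  TS (w ∷ ws) φ = ∑ᶻ (allFin r) (λ c → w c ℤ.* TS ws (φ ∘ (c ∷_)))

  TV : (Fin n → Fin r → ℤ) → (Vec (Fin r) n → ℤ) → ℤ
  TV {zero}  W Φ = Φ []
  TV {suc n} W Φ = ∑ᶻ (allFin r) (λ c → W zero c ℤ.* TV (W ∘ suc) (Φ ∘ (c ∷_)))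

  TV-mono : (W : Fin n → Fin r → ℤ) {Φ Ψ : Vec (Fin r) n → ℤ} → (∀ v c → 0ℤ ℤ.≤ W v c) → (∀ f → Φ f ℤ.≤ Ψ f) → TV W Φ ℤ.≤ TV W Ψ
  TV-mono {zero}  W hW h = h []
  TV-mono {suc n} W hW h = ∑ᶻ-mono (allFin r) (λ c → ℤP.*-monoˡ-≤-nonNeg (W zero c) {{ℤ.nonNegative (hW zero c)}} (TV-mono (W ∘ suc) (λ v → hW (suc v)) (λ f → h (c ∷ f))))

  TV-const : (W : Fin n → Fin r → ℤ) (R : ℤ) → (∀ v → ∑ᶻ (allFin r) (W v) ≡ R) → (x : ℤ) → TV W (λ _ → x) ≡ R ℤ.^ n ℤ.* x
  TV-const {zero}  W R hW x = sym (ℤP.*-identityˡ x)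
  TV-const {suc n} W R hW x = trans (∑ᶻ-cong (allFin r) (λ c → cong (λ w → W zero c ℤ.* w) (TV-const (W ∘ suc) R (λ v → hW (suc v)) x)))
    (trans (∑ᶻ-*ʳ (allFin r) (R ℤ.^ n ℤ.* x) (W zero)) (trans (cong (λ w → w ℤ.* (R ℤ.^ n ℤ.* x)) (hW zero)) (sym (ℤP.*-assoc R (R ℤ.^ n) x))))

  TV-∑ : {A : Set} (W : Fin n → Fin r → ℤ) (xs : List A) (Φ : A → Vec (Fin r) n → ℤ) →
    TV W (λ f → ∑ᶻ xs (λ x → Φ x f)) ≡ ∑ᶻ xs (λ x → TV W (Φ x))
  TV-∑ {zero}  W xs Φ = refl
  TV-∑ {suc n} W xs Φ = trans (∑ᶻ-cong (allFin r) (λ c → trans (cong (λ w → W zero c ℤ.* w) (TV-∑ (W ∘ suc) xs (λ x → Φ x ∘ (c ∷_)))) (sym (∑ᶻ-*ˡ xs (W zero c) _))))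
    (∑ᶻ-swap (allFin r) xs _)

  restrict : Subset n → Vec (Fin r) n → List (Fin r)
  restrict []          []      = []
  restrict (true ∷ e)  (c ∷ f) = c ∷ restrict e f
  restrict (false ∷ e) (c ∷ f) = restrict e f

  -- A vertex outside `e` contributes only its total weight `R`. The factor `R ℤ.^ ∣ e ∣` on the
  -- left avoids the exponent `n - ∣ e ∣`.
  TV-restrict : (W : Fin n → Fin r → ℤ) (R : ℤ) → (∀ v → ∑ᶻ (allFin r) (W v) ≡ R) → (e : Subset n) (φ : List (Fin r) → ℤ) →
    R ℤ.^ ∣ e ∣ ℤ.* TV W (φ ∘ restrict e) ≡ R ℤ.^ n ℤ.* TS (map W (els e)) φ
  TV-restrict W R hW []         φ = refl
  TV-restrict {suc n} W R hW (false ∷ e) φ = begin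
    R ℤ.^ ∣ e ∣ ℤ.* ∑ᶻ (allFin r) (λ c → W zero c ℤ.* TV (W ∘ suc) (φ ∘ restrict e))
      ≡⟨ cong (λ w → R ℤ.^ ∣ e ∣ ℤ.* w) (trans (∑ᶻ-*ʳ (allFin r) (TV (W ∘ suc) (φ ∘ restrict e)) (W zero)) (cong (λ w → w ℤ.* TV (W ∘ suc) (φ ∘ restrict e)) (hW zero))) ⟩
    R ℤ.^ ∣ e ∣ ℤ.* (R ℤ.* TV (W ∘ suc) (φ ∘ restrict e)) ≡⟨ *ᶻ-swapˡ (R ℤ.^ ∣ e ∣) R (TV (W ∘ suc) (φ ∘ restrict e)) ⟩
    R ℤ.* (R ℤ.^ ∣ e ∣ ℤ.* TV (W ∘ suc) (φ ∘ restrict e)) ≡⟨ cong (λ w → R ℤ.* w) (TV-restrict (W ∘ suc) R (λ v → hW (suc v)) e φ) ⟩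
    R ℤ.* (R ℤ.^ n ℤ.* TS (map (W ∘ suc) (els e)) φ) ≡⟨ sym (ℤP.*-assoc R (R ℤ.^ n) _) ⟩
    R ℤ.^ suc n ℤ.* TS (map (W ∘ suc) (els e)) φ ≡⟨ cong (λ l → R ℤ.^ suc n ℤ.* TS l φ) (map-∘ (els e)) ⟩
    R ℤ.^ suc n ℤ.* TS (map W (map suc (els e))) φ ∎
    where
    open ≡-Reasoning
  TV-restrict {suc n} W R hW (true ∷ e) φ = begin
    R ℤ.* R ℤ.^ ∣ e ∣ ℤ.* ∑ᶻ (allFin r) (λ c → W zero c ℤ.* TV (W ∘ suc) (φ ∘ (c ∷_) ∘ restrict e))
      ≡⟨ trans (ℤP.*-assoc R (R ℤ.^ ∣ e ∣) _) (cong (λ w → R ℤ.* w) (sym (∑ᶻ-*ˡ (allFin r) (R ℤ.^ ∣ e ∣) _))) ⟩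
    R ℤ.* ∑ᶻ (allFin r) (λ c → R ℤ.^ ∣ e ∣ ℤ.* (W zero c ℤ.* TV (W ∘ suc) (φ ∘ (c ∷_) ∘ restrict e)))
      ≡⟨ cong (λ w → R ℤ.* w) (trans (∑ᶻ-cong (allFin r) each) (∑ᶻ-*ˡ (allFin r) (R ℤ.^ n) _)) ⟩
    R ℤ.* (R ℤ.^ n ℤ.* TS (map W (zero ∷ map suc (els e))) φ) ≡⟨ sym (ℤP.*-assoc R (R ℤ.^ n) _) ⟩
    R ℤ.^ suc n ℤ.* TS (map W (zero ∷ map suc (els e))) φ ∎
    where
    open ≡-Reasoning
    each : ∀ c → R ℤ.^ ∣ e ∣ ℤ.* (W zero c ℤ.* TV (W ∘ suc) (φ ∘ (c ∷_) ∘ restrict e)) ≡ R ℤ.^ n ℤ.* (W zero c ℤ.* TS (map W (map suc (els e))) (φ ∘ (c ∷_)))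
    each c = trans (*ᶻ-swapˡ (R ℤ.^ ∣ e ∣) (W zero c) _) (trans (cong (λ w → W zero c ℤ.* w)
      (trans (TV-restrict (W ∘ suc) R (λ v → hW (suc v)) e (φ ∘ (c ∷_))) (cong (λ l → R ℤ.^ n ℤ.* TS l (φ ∘ (c ∷_))) (map-∘ (els e)))))
      (*ᶻ-swapˡ (W zero c) (R ℤ.^ n) _))

  restrict-∈⁺ : (e : Subset n) (f : Vec (Fin r) n) (v : Fin n) → e ∋ v → lookup f v ∈ restrict e f
  restrict-∈⁺ (true ∷ e)  (c ∷ f) zero    h = here refl
  restrict-∈⁺ (true ∷ e)  (c ∷ f) (suc v) h = there (restrict-∈⁺ e f v h)
  restrict-∈⁺ (false ∷ e) (c ∷ f) (suc v) h = restrict-∈⁺ e f v h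

  restrict-∈⁻ : (e : Subset n) (f : Vec (Fin r) n) {j : Fin r} → j ∈ restrict e f → ∃[ v ] (e ∋ v × lookup f v ≡ j)
  restrict-∈⁻ []          []      ()
  restrict-∈⁻ (true ∷ e)  (c ∷ f) (here refl) = zero , refl , refl
  restrict-∈⁻ (true ∷ e)  (c ∷ f) (there h) with restrict-∈⁻ e f h
  ... | v , p , q = suc v , p , q
  restrict-∈⁻ (false ∷ e) (c ∷ f) h with restrict-∈⁻ e f h
  ... | v , p , q = suc v , p , q

  𝟙-cut : (f : Vec (Fin r) n) (e : Subset n) → 𝟙 (does (isCutEdge? (lookup f) e)) ≡ 𝟙 (covers (replicate r true) (restrict e f))
  𝟙-cut f e = 𝟙-does (isCutEdge? (lookup f) e) _
    (λ h → covers-complete _ _ (λ j _ → let (v , v∈ , fv) = h j in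
        subst (_∈ restrict e f) fv (restrict-∈⁺ e f v (VecP.[]=⇒lookup v∈))))
    (λ eq j → let (v , v∈ , fv) = restrict-∈⁻ e f (covers-sound _ _ eq j (lookup-replicate j true)) in
        v , VecP.lookup⇒[]= v e v∈ , fv)
    where
    𝟙-does : {X : Set} (d : Dec X) (b : Bool) → (X → b ≡ true) → (b ≡ true → X) → 𝟙 (does d) ≡ 𝟙 b
    𝟙-does (yes x) b h₁ h₂ rewrite h₁ x = refl
    𝟙-does (no ¬x) true  h₁ h₂ = contradiction (h₂ refl) ¬x
    𝟙-does (no ¬x) false h₁ h₂ = refl

best : {r : ℕ} → (g : Vec (Fin (suc r)) n → ℕ) → ∃[ f ] (∀ f′ → g f′ ≤ g f)
best {zero}  g = [] , λ { [] → ≤-refl }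
best {suc n} g with argmax 0 (λ c → g (c ∷ proj₁ (best (g ∘ (c ∷_)))))
-- All values are 0 in this case, so any first colour will do.
... | inj₁ h = zero ∷ proj₁ (best (g ∘ (zero ∷_))) , λ { (c ∷ f) → ≤-trans (proj₂ (best (g ∘ (c ∷_))) f) (≤-trans (h c) z≤n) }
... | inj₂ (c₀ , _ , h) = c₀ ∷ proj₁ (best (g ∘ (c₀ ∷_))) , λ { (c ∷ f) → ≤-trans (proj₂ (best (g ∘ (c ∷_))) f) (h c) }

∑ᶻ-allFin : (f : Fin (suc n) → ℤ) → ∑ᶻ (allFin (suc n)) f ≡ f zero ℤ.+ ∑ᶻ (allFin n) (f ∘ suc)
∑ᶻ-allFin {n} f = cong (λ w → f zero ℤ.+ w) (trans (cong (λ l → ∑ᶻ l f) (sym (ListP.map-tabulate id suc))) (∑ᶻ-map suc (allFin n) f))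

isEvenℕ : ℕ → Bool
isEvenℕ zero    = true
isEvenℕ (suc s) = not (isEvenℕ s)

isEven-length : (S : List A) → isEven S ≡ isEvenℕ (length S)
isEven-length []      = refl
isEven-length (x ∷ S) = cong not (isEven-length S)

-- The number of lists of length l over c + r colours that contain every colour of H ⊆ Fin r.
#covering : {r : ℕ} → ℕ → ℕ → Subset r → ℕ
#covering c zero    H = 𝟙 (empty H)
#covering c (suc l) H = c * #covering c l H + ∑ (allFin _) (λ x → #covering c l (remove H x))

#covering-≤ : {r : ℕ} (l : ℕ) (H : Subset r) → #covering 1 l H ≤ suc r ^ l
#covering-≤ zero    H = 𝟙≤1 (empty H)
#covering-≤ {r} (suc l) H = +-mono-≤ (≤-trans (≤-reflexive (*-identityˡ _)) (#covering-≤ l H))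
  (≤-trans (∑-bound (allFin r) (suc r ^ l) (λ x _ → #covering-≤ l (remove H x))) (≤-reflexive (cong (_* suc r ^ l) (ListP.length-tabulate {n = r} id))))

-- The first entries can run through the colours of `H`, and the extra colour fills the rest.
#covering-≥ : {r : ℕ} (l : ℕ) (H : Subset r) → ∣ H ∣ ≤ l → 1 ≤ #covering 1 l H
#covering-≥ l H h with empty H in eq
#covering-≥ zero    H h | true rewrite eq = ≤-refl
#covering-≥ {r} (suc l) H h | true = ≤-trans (#covering-≥ l H (≤-trans (≤-reflexive (trans (cong ∣_∣ (empty-≡⊥ H eq)) (SubP.∣⊥∣≡0 r))) z≤n))
  (≤-trans (≤-reflexive (sym (*-identityˡ _))) (m≤m+n _ _))
... | false with nonempty H eq
  where
  nonempty : ∀ {r} (H : Subset r) → empty H ≡ false → ∃[ x ] (H ∋ x)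
  nonempty (true ∷ H)  e = zero , refl
  nonempty (false ∷ H) e with nonempty H e
  ... | x , p = suc x , p
#covering-≥ zero    H h | false | x , p = contradiction (≤-trans (≤-reflexive (∣remove∣ H x p)) h) λ ()
#covering-≥ (suc l) H h | false | x , p = ≤-trans (#covering-≥ l (remove H x) (≤-pred (≤-trans (≤-reflexive (∣remove∣ H x p)) h)))
  (≤-trans (∑-≥ (λ x → #covering 1 l (remove H x)) (∈-allFin x)) (m≤n+m _ (1 * #covering 1 l H)))

-- The probability that an edge is cut

module Expansion {V : Set} {r : ℕ} (M : ℕ) (Y : V → ℤ) where

  -- Vertex v gets colour c with probability colourWt v c / ((r + 2) M).
  colourWt : V → Fin (2 + r) → ℤ
  colourWt v zero          = + M ℤ.+ Y v
  colourWt v (suc zero)    = + M ℤ.+ ℤ.- Y v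
  colourWt v (suc (suc _)) = + M

  ∑-colourWt : ∀ v → ∑ᶻ (allFin (2 + r)) (colourWt v) ≡ + ((2 + r) * M)
  ∑-colourWt v = trans (∑ᶻ-allFin (colourWt v)) (trans (cong (λ w → + M ℤ.+ Y v ℤ.+ w) (trans (∑ᶻ-allFin (colourWt v ∘ suc))
      (cong (λ w → + M ℤ.+ ℤ.- Y v ℤ.+ w) (trans (∑ᶻ-+∑ (allFin r) (λ _ → M)) (cong +_ (trans (∑-const (allFin r) M) (cong (_* M) (ListP.length-tabulate {n = r} id))))))))
    (cancel (+ M) (Y v) (+ (r * M))))
    where
    cancel : ∀ a y c → a ℤ.+ y ℤ.+ (a ℤ.+ ℤ.- y ℤ.+ c) ≡ a ℤ.+ (a ℤ.+ c)
    cancel = ℤR.solve-∀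

  -- The flags tell which of the first two colours are still required, in addition to the colours of
  -- `H`.
  G : Bool → Bool → Subset r → List V → ℤ
  G a b H l = TS (map colourWt l) (λ g → + 𝟙 (covers (a ∷ b ∷ H) g))

  G-∷ : ∀ a b H v l → G a b H (v ∷ l) ≡ (+ M ℤ.+ Y v) ℤ.* G false b H l ℤ.+
    ((+ M ℤ.+ ℤ.- Y v) ℤ.* G a false H l ℤ.+ + M ℤ.* ∑ᶻ (allFin r) (λ c → G a b (remove H c) l))
  G-∷ a b H v l = trans (∑ᶻ-allFin g) (cong (λ w → (+ M ℤ.+ Y v) ℤ.* G false b H l ℤ.+ w)
    (trans (∑ᶻ-allFin (g ∘ suc)) (cong (λ w → (+ M ℤ.+ ℤ.- Y v) ℤ.* G a false H l ℤ.+ w) (∑ᶻ-*ˡ (allFin r) (+ M) (λ c → G a b (remove H c) l)))))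
    where
    g : Fin (2 + r) → ℤ
    g c = colourWt v c ℤ.* TS (map colourWt l) (λ g → + 𝟙 (covers (remove (a ∷ b ∷ H) c) g))

  -- The first two colours are merged into one symbol of weight `a v`: `plus` allows only the first,
  -- `minus` only the second, `twice` both and `none` neither.
  Rec : (V → ℤ) → Subset r → List V → ℤ
  Rec a H []      = + 𝟙 (empty H)
  Rec a H (v ∷ l) = a v ℤ.* Rec a H l ℤ.+ + M ℤ.* ∑ᶻ (allFin r) (λ c → Rec a (remove H c) l)

  plus minus twice none : V → ℤ
  plus  v = + M ℤ.+ Y v
  minus v = + M ℤ.+ ℤ.- Y v
  twice v = + M ℤ.+ + M
  none  v = 0ℤ

  -- Inclusion-exclusion over the presence of the first two colours.
  G-ff : ∀ l H → G false false H l ≡ Rec twice H l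
  G-ff []      H = refl
  G-ff (v ∷ l) H = trans (G-∷ false false H v l) (trans (cong₂ (λ x z → (+ M ℤ.+ Y v) ℤ.* x ℤ.+ ((+ M ℤ.+ ℤ.- Y v) ℤ.* x ℤ.+ + M ℤ.* z)) (G-ff l H)
      (∑ᶻ-cong (allFin r) (λ c → G-ff l (remove H c)))) (ring (+ M) (Y v) (Rec twice H l) _))
    where
    ring : ∀ m y a s → (m ℤ.+ y) ℤ.* a ℤ.+ ((m ℤ.+ ℤ.- y) ℤ.* a ℤ.+ m ℤ.* s) ≡ (m ℤ.+ m) ℤ.* a ℤ.+ m ℤ.* s
    ring = ℤR.solve-∀

  G-tf : ∀ l H → G true false H l ℤ.+ Rec minus H l ≡ Rec twice H l
  G-tf []      H = ℤP.+-identityˡ _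
  G-tf (v ∷ l) H = begin
    G true false H (v ∷ l) ℤ.+ Rec minus H (v ∷ l) ≡⟨ cong (λ w → w ℤ.+ Rec minus H (v ∷ l)) (G-∷ true false H v l) ⟩
    m+ ℤ.* G false false H l ℤ.+ (m- ℤ.* G true false H l ℤ.+ + M ℤ.* ∑ᶻ F (λ c → G true false (remove H c) l)) ℤ.+ (m- ℤ.* Rec minus H l ℤ.+ + M ℤ.* ∑ᶻ F (λ c → Rec minus (remove H c) l))
      ≡⟨ ring m+ m- (+ M) (G false false H l) (G true false H l) (∑ᶻ F (λ c → G true false (remove H c) l)) (Rec minus H l) (∑ᶻ F (λ c → Rec minus (remove H c) l)) ⟩
    m+ ℤ.* G false false H l ℤ.+ m- ℤ.* (G true false H l ℤ.+ Rec minus H l) ℤ.+ + M ℤ.* (∑ᶻ F (λ c → G true false (remove H c) l) ℤ.+ ∑ᶻ F (λ c → Rec minus (remove H c) l))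
      ≡⟨ cong₂ (λ x z → m+ ℤ.* G false false H l ℤ.+ m- ℤ.* x ℤ.+ + M ℤ.* z) (G-tf l H) (trans (sym (∑ᶻ-+ F _ _)) (∑ᶻ-cong F (λ c → G-tf l (remove H c)))) ⟩
    m+ ℤ.* G false false H l ℤ.+ m- ℤ.* Rec twice H l ℤ.+ + M ℤ.* ∑ᶻ F (λ c → Rec twice (remove H c) l)
      ≡⟨ cong (λ x → m+ ℤ.* x ℤ.+ m- ℤ.* Rec twice H l ℤ.+ + M ℤ.* ∑ᶻ F (λ c → Rec twice (remove H c) l)) (G-ff l H) ⟩
    m+ ℤ.* Rec twice H l ℤ.+ m- ℤ.* Rec twice H l ℤ.+ + M ℤ.* ∑ᶻ F (λ c → Rec twice (remove H c) l) ≡⟨ ring₂ (+ M) (Y v) (Rec twice H l) _ ⟩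
    Rec twice H (v ∷ l) ∎
    where
    open ≡-Reasoning
    F = allFin r
    m+ = + M ℤ.+ Y v
    m- = + M ℤ.+ ℤ.- Y v
    ring : ∀ p q m x y s u t → p ℤ.* x ℤ.+ (q ℤ.* y ℤ.+ m ℤ.* s) ℤ.+ (q ℤ.* u ℤ.+ m ℤ.* t) ≡ p ℤ.* x ℤ.+ q ℤ.* (y ℤ.+ u) ℤ.+ m ℤ.* (s ℤ.+ t)
    ring = ℤR.solve-∀
    ring₂ : ∀ m y a s → (m ℤ.+ y) ℤ.* a ℤ.+ (m ℤ.+ ℤ.- y) ℤ.* a ℤ.+ m ℤ.* s ≡ (m ℤ.+ m) ℤ.* a ℤ.+ m ℤ.* s
    ring₂ = ℤR.solve-∀

  G-ft : ∀ l H → G false true H l ℤ.+ Rec plus H l ≡ Rec twice H l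
  G-ft []      H = ℤP.+-identityˡ _
  G-ft (v ∷ l) H = begin
    G false true H (v ∷ l) ℤ.+ Rec plus H (v ∷ l) ≡⟨ cong (λ w → w ℤ.+ Rec plus H (v ∷ l)) (G-∷ false true H v l) ⟩
    m+ ℤ.* G false true H l ℤ.+ (m- ℤ.* G false false H l ℤ.+ + M ℤ.* ∑ᶻ F (λ c → G false true (remove H c) l)) ℤ.+ (m+ ℤ.* Rec plus H l ℤ.+ + M ℤ.* ∑ᶻ F (λ c → Rec plus (remove H c) l))
      ≡⟨ ring m+ m- (+ M) (G false true H l) (G false false H l) (∑ᶻ F (λ c → G false true (remove H c) l)) (Rec plus H l) (∑ᶻ F (λ c → Rec plus (remove H c) l)) ⟩
    m+ ℤ.* (G false true H l ℤ.+ Rec plus H l) ℤ.+ m- ℤ.* G false false H l ℤ.+ + M ℤ.* (∑ᶻ F (λ c → G false true (remove H c) l) ℤ.+ ∑ᶻ F (λ c → Rec plus (remove H c) l))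
      ≡⟨ cong₂ (λ x z → m+ ℤ.* x ℤ.+ m- ℤ.* G false false H l ℤ.+ + M ℤ.* z) (G-ft l H) (trans (sym (∑ᶻ-+ F _ _)) (∑ᶻ-cong F (λ c → G-ft l (remove H c)))) ⟩
    m+ ℤ.* Rec twice H l ℤ.+ m- ℤ.* G false false H l ℤ.+ + M ℤ.* ∑ᶻ F (λ c → Rec twice (remove H c) l)
      ≡⟨ cong (λ x → m+ ℤ.* Rec twice H l ℤ.+ m- ℤ.* x ℤ.+ + M ℤ.* ∑ᶻ F (λ c → Rec twice (remove H c) l)) (G-ff l H) ⟩
    m+ ℤ.* Rec twice H l ℤ.+ m- ℤ.* Rec twice H l ℤ.+ + M ℤ.* ∑ᶻ F (λ c → Rec twice (remove H c) l) ≡⟨ ring₂ (+ M) (Y v) (Rec twice H l) _ ⟩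
    Rec twice H (v ∷ l) ∎
    where
    open ≡-Reasoning
    F = allFin r
    m+ = + M ℤ.+ Y v
    m- = + M ℤ.+ ℤ.- Y v
    ring : ∀ p q m x y s u t → p ℤ.* x ℤ.+ (q ℤ.* y ℤ.+ m ℤ.* s) ℤ.+ (p ℤ.* u ℤ.+ m ℤ.* t) ≡ p ℤ.* (x ℤ.+ u) ℤ.+ q ℤ.* y ℤ.+ m ℤ.* (s ℤ.+ t)
    ring = ℤR.solve-∀
    ring₂ : ∀ m y a s → (m ℤ.+ y) ℤ.* a ℤ.+ (m ℤ.+ ℤ.- y) ℤ.* a ℤ.+ m ℤ.* s ≡ (m ℤ.+ m) ℤ.* a ℤ.+ m ℤ.* s
    ring₂ = ℤR.solve-∀

  G-tt : ∀ l H → G true true H l ℤ.+ (Rec plus H l ℤ.+ Rec minus H l) ≡ Rec twice H l ℤ.+ Rec none H l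
  G-tt []      H = ℤP.+-identityˡ _
  G-tt (v ∷ l) H = begin
    G true true H (v ∷ l) ℤ.+ (Rec plus H (v ∷ l) ℤ.+ Rec minus H (v ∷ l)) ≡⟨ cong (λ w → w ℤ.+ (Rec plus H (v ∷ l) ℤ.+ Rec minus H (v ∷ l))) (G-∷ true true H v l) ⟩
    m+ ℤ.* G false true H l ℤ.+ (m- ℤ.* G true false H l ℤ.+ + M ℤ.* s₁) ℤ.+ ((m+ ℤ.* Rec plus H l ℤ.+ + M ℤ.* s₂) ℤ.+ (m- ℤ.* Rec minus H l ℤ.+ + M ℤ.* s₃))
      ≡⟨ ring m+ m- (+ M) (G false true H l) (G true false H l) s₁ (Rec plus H l) s₂ (Rec minus H l) s₃ ⟩
    m+ ℤ.* (G false true H l ℤ.+ Rec plus H l) ℤ.+ m- ℤ.* (G true false H l ℤ.+ Rec minus H l) ℤ.+ + M ℤ.* (s₁ ℤ.+ (s₂ ℤ.+ s₃))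
      ≡⟨ cong₂ (λ x z → m+ ℤ.* x ℤ.+ m- ℤ.* z ℤ.+ + M ℤ.* (s₁ ℤ.+ (s₂ ℤ.+ s₃))) (G-ft l H) (G-tf l H) ⟩
    m+ ℤ.* Rec twice H l ℤ.+ m- ℤ.* Rec twice H l ℤ.+ + M ℤ.* (s₁ ℤ.+ (s₂ ℤ.+ s₃))
      ≡⟨ cong (λ z → m+ ℤ.* Rec twice H l ℤ.+ m- ℤ.* Rec twice H l ℤ.+ + M ℤ.* z)
           (trans (trans (cong (λ w → s₁ ℤ.+ w) (sym (∑ᶻ-+ F _ _))) (sym (∑ᶻ-+ F _ _))) (trans (∑ᶻ-cong F (λ c → G-tt l (remove H c))) (∑ᶻ-+ F _ _))) ⟩
    m+ ℤ.* Rec twice H l ℤ.+ m- ℤ.* Rec twice H l ℤ.+ + M ℤ.* (s₄ ℤ.+ s₅) ≡⟨ ring₂ (+ M) (Y v) (Rec twice H l) s₄ s₅ (Rec none H l) ⟩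
    Rec twice H (v ∷ l) ℤ.+ Rec none H (v ∷ l) ∎
    where
    open ≡-Reasoning
    F = allFin r
    m+ = + M ℤ.+ Y v
    m- = + M ℤ.+ ℤ.- Y v
    s₁ = ∑ᶻ F (λ c → G true true (remove H c) l)
    s₂ = ∑ᶻ F (λ c → Rec plus (remove H c) l)
    s₃ = ∑ᶻ F (λ c → Rec minus (remove H c) l)
    s₄ = ∑ᶻ F (λ c → Rec twice (remove H c) l)
    s₅ = ∑ᶻ F (λ c → Rec none (remove H c) l)
    ring : ∀ p q m x y s u t a b → p ℤ.* x ℤ.+ (q ℤ.* y ℤ.+ m ℤ.* s) ℤ.+ ((p ℤ.* u ℤ.+ m ℤ.* t) ℤ.+ (q ℤ.* a ℤ.+ m ℤ.* b))
      ≡ p ℤ.* (x ℤ.+ u) ℤ.+ q ℤ.* (y ℤ.+ a) ℤ.+ m ℤ.* (s ℤ.+ (t ℤ.+ b))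
    ring = ℤR.solve-∀
    ring₂ : ∀ m y a s t x → (m ℤ.+ y) ℤ.* a ℤ.+ (m ℤ.+ ℤ.- y) ℤ.* a ℤ.+ m ℤ.* (s ℤ.+ t) ≡ ((m ℤ.+ m) ℤ.* a ℤ.+ m ℤ.* s) ℤ.+ (0ℤ ℤ.* x ℤ.+ m ℤ.* t)
    ring₂ = ℤR.solve-∀

  Rec-const : ∀ c x → x ≡ + (c * M) → ∀ l H → Rec (λ _ → x) H l ≡ + (M ^ length l * #covering c (length l) H)
  Rec-const c x hx []      H = cong +_ (sym (*-identityˡ _))
  Rec-const c x hx (v ∷ l) H = begin
    x ℤ.* Rec (λ _ → x) H l ℤ.+ + M ℤ.* ∑ᶻ (allFin r) (λ z → Rec (λ _ → x) (remove H z) l)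
      ≡⟨ cong₂ (λ w z → w ℤ.+ + M ℤ.* z) (cong₂ ℤ._*_ hx (Rec-const c x hx l H)) (trans (∑ᶻ-cong (allFin r) (λ z → Rec-const c x hx l (remove H z)))
           (trans (∑ᶻ-+∑ (allFin r) _) (cong +_ (∑-*ˡ (allFin r) (M ^ length l) _)))) ⟩
    + (c * M) ℤ.* + (M ^ length l * #covering c (length l) H) ℤ.+ + M ℤ.* + (M ^ length l * ∑ (allFin r) (λ z → #covering c (length l) (remove H z)))
      ≡⟨ cong₂ ℤ._+_ (sym (ℤP.pos-* (c * M) _)) (sym (ℤP.pos-* M _)) ⟩
    + (c * M * (M ^ length l * #covering c (length l) H) + M * (M ^ length l * ∑ (allFin r) (λ z → #covering c (length l) (remove H z))))
      ≡⟨ cong +_ (ring c M (M ^ length l) (#covering c (length l) H) _) ⟩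
    + (M ^ suc (length l) * #covering c (suc (length l)) H) ∎
    where
    open ≡-Reasoning
    ring : ∀ c m p x s → c * m * (p * x) + m * (p * s) ≡ m * p * (c * x + s)
    ring = ℕR.solve-∀

  -- Expanding `M + y v`: the vertices with `y v` form the first half, and at the others `M` is the
  -- weight of one extra colour beside the `r` remaining ones. Hence `#covering 1`.
  Rec-splits : ∀ (y : V → ℤ) l H → Rec (λ v → + M ℤ.+ y v) H l ≡
    ∑ᶻ (splits l) (λ p → prod y (proj₁ p) ℤ.* + (M ^ length (proj₂ p) * #covering 1 (length (proj₂ p)) H))
  Rec-splits y []      H = sym (trans (ℤP.+-identityʳ _) (trans (ℤP.*-identityˡ _) (cong +_ (*-identityˡ _))))
  Rec-splits y (v ∷ l) H = begin
    (+ M ℤ.+ y v) ℤ.* Rec a H l ℤ.+ + M ℤ.* ∑ᶻ F (λ c → Rec a (remove H c) l)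
      ≡⟨ ring (+ M) (y v) (Rec a H l) _ ⟩
    y v ℤ.* Rec a H l ℤ.+ + M ℤ.* (Rec a H l ℤ.+ ∑ᶻ F (λ c → Rec a (remove H c) l))
      ≡⟨ cong₂ (λ x z → y v ℤ.* x ℤ.+ + M ℤ.* z) (Rec-splits y l H) (cong₂ ℤ._+_ (Rec-splits y l H)
           (trans (∑ᶻ-cong F (λ c → Rec-splits y l (remove H c))) (∑ᶻ-swap F (splits l) _))) ⟩
    y v ℤ.* ∑ᶻ (splits l) (f H) ℤ.+ + M ℤ.* (∑ᶻ (splits l) (f H) ℤ.+ ∑ᶻ (splits l) (λ p → ∑ᶻ F (λ c → f (remove H c) p)))
      ≡⟨ cong₂ ℤ._+_ (trans (sym (∑ᶻ-*ˡ (splits l) (y v) (f H))) (∑ᶻ-cong (splits l) (λ p → sym (ℤP.*-assoc (y v) (prod y (proj₁ p)) _))))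
           (trans (cong (λ w → + M ℤ.* w) (sym (∑ᶻ-+ (splits l) _ _))) (trans (sym (∑ᶻ-*ˡ (splits l) (+ M) _)) (∑ᶻ-cong (splits l) (λ p → right p)))) ⟩
    ∑ᶻ (splits l) (λ p → f H (v ∷ proj₁ p , proj₂ p)) ℤ.+ ∑ᶻ (splits l) (λ p → f H (proj₁ p , v ∷ proj₂ p)) ≡⟨ sym (∑ᶻ-splits v l (f H)) ⟩
    ∑ᶻ (splits (v ∷ l)) (f H) ∎
    where
    open ≡-Reasoning
    F = allFin r
    a : V → ℤ
    a v = + M ℤ.+ y v
    f : Subset r → List V × List V → ℤ
    f H p = prod y (proj₁ p) ℤ.* + (M ^ length (proj₂ p) * #covering 1 (length (proj₂ p)) H)
    ring : ∀ m y a s → (m ℤ.+ y) ℤ.* a ℤ.+ m ℤ.* s ≡ y ℤ.* a ℤ.+ m ℤ.* (a ℤ.+ s)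
    ring = ℤR.solve-∀
    ring₂ : ∀ m p x z → m ℤ.* (p ℤ.* x ℤ.+ p ℤ.* z) ≡ p ℤ.* (m ℤ.* (x ℤ.+ z))
    ring₂ = ℤR.solve-∀
    nat : ∀ m p x s → m * (p * x + p * s) ≡ m * p * (1 * x + s)
    nat = ℕR.solve-∀
    right : ∀ p → + M ℤ.* (f H p ℤ.+ ∑ᶻ F (λ c → f (remove H c) p)) ≡ f H (proj₁ p , v ∷ proj₂ p)
    right (S , R) = trans (cong (λ w → + M ℤ.* (f H (S , R) ℤ.+ w)) (trans (∑ᶻ-*ˡ F (prod y S) _) (cong (λ w → prod y S ℤ.* w)
        (trans (∑ᶻ-+∑ F _) (cong +_ (∑-*ˡ F (M ^ length R) _))))))
      (trans (ring₂ (+ M) (prod y S) (+ (M ^ length R * #covering 1 (length R) H)) _)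
        (cong (λ w → prod y S ℤ.* w) (trans (sym (ℤP.pos-* M _)) (cong +_ (nat M (M ^ length R) (#covering 1 (length R) H) _)))))

-- The numbers `c_s` of the overview: labellings of the other `k - s` vertices by the colours of
-- `Fin r` and one extra symbol that use all of `H`. The constant term is set to 0 because it
-- belongs to the average.
coefficient : {r : ℕ} → ℕ → Subset r → ℕ → ℕ
coefficient k H zero    = 0
coefficient k H (suc s) = 𝟙 (isEvenℕ (suc s)) * #covering 1 (k ∸ suc s) H

+ᶻ-cancelˡ : ∀ x a b → x ℤ.+ a ≡ x ℤ.+ b → a ≡ b
+ᶻ-cancelˡ x a b h = trans (undo x a) (trans (cong (λ w → ℤ.- x ℤ.+ w) h) (sym (undo x b)))
  where
  undo : ∀ x a → a ≡ ℤ.- x ℤ.+ (x ℤ.+ a)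
  undo = ℤR.solve-∀

pos-^ : ∀ x k → (+ x) ℤ.^ k ≡ + (x ^ k)
pos-^ x zero    = refl
pos-^ x (suc k) = trans (cong (λ w → + x ℤ.* w) (pos-^ x k)) (sym (ℤP.pos-* x (x ^ k)))

ifNull : List A → ℤ → ℤ
ifNull []      x = x
ifNull (_ ∷ _) x = 0ℤ

∑ᶻ-ifNull : (l : List A) (x : List A → ℤ) → ∑ᶻ (splits l) (λ p → ifNull (proj₁ p) (x (proj₂ p))) ≡ x l
∑ᶻ-ifNull []      x = ℤP.+-identityʳ (x [])
∑ᶻ-ifNull (v ∷ l) x = trans (∑ᶻ-splits v l _) (trans (cong₂ ℤ._+_ (∑ᶻ-0 (splits l) (λ _ _ → refl)) (∑ᶻ-ifNull l (x ∘ (v ∷_)))) (ℤP.+-identityˡ _))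

TS-ones : {r : ℕ} {V : Set} (w : V → Fin r → ℤ) → (∀ v c → w v c ≡ 1ℤ) → (l : List V) (H : Subset r) →
  TS (map w l) (λ g → + 𝟙 (covers H g)) ≡ + surj (r ∸ ∣ H ∣) ∣ H ∣ (length l)
TS-ones {r} w hw [] H = cong +_ (base H)
  where
  base : ∀ {r} (H : Subset r) → 𝟙 (empty H) ≡ surj (r ∸ ∣ H ∣) ∣ H ∣ 0
  base {r} H with empty H in eq
  ... | true  rewrite empty-≡⊥ H eq | SubP.∣⊥∣≡0 r = refl
  ... | false = go H eq
    where
    go : ∀ {r} (H : Subset r) → empty H ≡ false → 0 ≡ surj (r ∸ ∣ H ∣) ∣ H ∣ 0
    go (true ∷ H)  _ = refl
    go (false ∷ H) e with ∣ H ∣ in eq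
    ... | suc h = refl
    ... | zero = contradiction (trans (sym e) (zero-empty H eq)) λ ()
      where
      zero-empty : ∀ {r} (H : Subset r) → ∣ H ∣ ≡ 0 → empty H ≡ true
      zero-empty []          _ = refl
      zero-empty (false ∷ H) e = zero-empty H e
TS-ones {r} w hw (v ∷ l) H = begin
  ∑ᶻ (allFin r) (λ c → w v c ℤ.* TS (map w l) (λ g → + 𝟙 (covers (remove H c) g)))
    ≡⟨ ∑ᶻ-cong (allFin r) (λ c → trans (cong₂ ℤ._*_ (hw v c) (TS-ones w hw l (remove H c))) (ℤP.*-identityˡ _)) ⟩
  ∑ᶻ (allFin r) (λ c → + surj (r ∸ ∣ remove H c ∣) ∣ remove H c ∣ (length l)) ≡⟨ ∑ᶻ-+∑ (allFin r) _ ⟩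
  + ∑ (allFin r) (λ c → surj (r ∸ ∣ remove H c ∣) ∣ remove H c ∣ (length l)) ≡⟨ cong +_ (∑-remove H (λ h → surj (r ∸ h) h (length l))) ⟩
  + ((r ∸ ∣ H ∣) * surj (r ∸ ∣ H ∣) ∣ H ∣ (length l) + ∣ H ∣ * surj (r ∸ (∣ H ∣ ∸ 1)) (∣ H ∣ ∸ 1) (length l))
    ≡⟨ cong (λ w → + ((r ∸ ∣ H ∣) * surj (r ∸ ∣ H ∣) ∣ H ∣ (length l) + w)) (shift ∣ H ∣ (SubP.∣p∣≤n H)) ⟩
  + ((r ∸ ∣ H ∣) * surj (r ∸ ∣ H ∣) ∣ H ∣ (length l) + ∣ H ∣ * surj (suc (r ∸ ∣ H ∣)) (∣ H ∣ ∸ 1) (length l)) ≡⟨ cong +_ (sym (unfold (r ∸ ∣ H ∣) ∣ H ∣ (length l))) ⟩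
  + surj (r ∸ ∣ H ∣) ∣ H ∣ (suc (length l)) ∎
  where
  open ≡-Reasoning
  shift : ∀ h → h ≤ r → h * surj (r ∸ (h ∸ 1)) (h ∸ 1) (length l) ≡ h * surj (suc (r ∸ h)) (h ∸ 1) (length l)
  shift zero    _ = refl
  shift (suc h) h≤ = cong (λ d → suc h * surj d h (length l)) (+-∸-assoc 1 h≤)
  unfold : ∀ d h l → surj d h (suc l) ≡ d * surj d h l + h * surj (suc d) (h ∸ 1) l
  unfold d zero    l = refl
  unfold d (suc h) l = refl

∣replicate∣ : ∀ r → ∣ replicate r true ∣ ≡ r
∣replicate∣ zero    = refl
∣replicate∣ (suc r) = cong suc (∣replicate∣ r)

module EdgeWeight (r k : ℕ) where

  Full : Subset r
  Full = replicate r true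

  cf : ℕ → ℕ
  cf = coefficient k Full

  cutTerm : {V : Set} (M : ℕ) (Y : V → ℤ) → List V → ℤ
  cutTerm M Y l = ∑ᶻ (splits l) λ p → + (cf (length (proj₁ p)) * M ^ length (proj₂ p)) ℤ.* prod Y (proj₁ p)

  module _ {V : Set} (M : ℕ) (Y : V → ℤ) where

    open Expansion {V} {r} M Y

    -- The two sums are exchanged by changing the sign of `Y`, so odd terms cancel and even ones
    -- double. The empty split is the constant that `cf 0` leaves out.
    even-part : ∀ l → length l ≡ k → Rec plus Full l ℤ.+ Rec minus Full l ≡ + (2 * (M ^ k * #covering 1 k Full)) ℤ.+ + 2 ℤ.* cutTerm M Y l
    even-part l len = begin
      Rec plus Full l ℤ.+ Rec minus Full l ≡⟨ cong₂ ℤ._+_ (Rec-splits Y l Full) (Rec-splits (λ v → ℤ.- Y v) l Full) ⟩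
      ∑ᶻ (splits l) (λ p → prod Y (proj₁ p) ℤ.* + w p) ℤ.+ ∑ᶻ (splits l) (λ p → prod (λ v → ℤ.- Y v) (proj₁ p) ℤ.* + w p) ≡⟨ sym (∑ᶻ-+ (splits l) _ _) ⟩
      ∑ᶻ (splits l) (λ p → prod Y (proj₁ p) ℤ.* + w p ℤ.+ prod (λ v → ℤ.- Y v) (proj₁ p) ℤ.* + w p)
        ≡⟨ ∑ᶻ-cong∈ (splits l) (λ p p∈ → term (proj₁ p) (proj₂ p) (trans (splits-length l p∈) len)) ⟩
      ∑ᶻ (splits l) (λ p → ifNull (proj₁ p) (+ (2 * (M ^ length (proj₂ p) * #covering 1 (length (proj₂ p)) Full))) ℤ.+ + 2 ℤ.* g p)
        ≡⟨ trans (∑ᶻ-+ (splits l) _ _) (cong₂ ℤ._+_ (∑ᶻ-ifNull l (λ R → + (2 * (M ^ length R * #covering 1 (length R) Full)))) (∑ᶻ-*ˡ (splits l) (+ 2) g)) ⟩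
      + (2 * (M ^ length l * #covering 1 (length l) Full)) ℤ.+ + 2 ℤ.* cutTerm M Y l
        ≡⟨ cong (λ j → + (2 * (M ^ j * #covering 1 j Full)) ℤ.+ + 2 ℤ.* cutTerm M Y l) len ⟩
      + (2 * (M ^ k * #covering 1 k Full)) ℤ.+ + 2 ℤ.* cutTerm M Y l ∎
      where
      open ≡-Reasoning
      w : List V × List V → ℕ
      w p = M ^ length (proj₂ p) * #covering 1 (length (proj₂ p)) Full
      g : List V × List V → ℤ
      g p = + (cf (length (proj₁ p)) * M ^ length (proj₂ p)) ℤ.* prod Y (proj₁ p)
      twice-1 : ∀ x → 1ℤ ℤ.* + x ℤ.+ 1ℤ ℤ.* + x ≡ + (2 * x) ℤ.+ 0ℤ
      twice-1 x = trans (cong₂ ℤ._+_ (ℤP.*-identityˡ (+ x)) (ℤP.*-identityˡ (+ x))) (trans (cong (λ z → + (x + z)) (sym (+-identityʳ x))) (sym (ℤP.+-identityʳ _)))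
      ring-even : ∀ p c → p ℤ.* c ℤ.+ p ℤ.* c ≡ 0ℤ ℤ.+ (1ℤ ℤ.+ 1ℤ) ℤ.* (c ℤ.* p)
      ring-even = ℤR.solve-∀
      ring-odd : ∀ p c → p ℤ.* c ℤ.+ (ℤ.- p) ℤ.* c ≡ 0ℤ ℤ.+ (1ℤ ℤ.+ 1ℤ) ℤ.* (0ℤ ℤ.* p)
      ring-odd = ℤR.solve-∀
      comm₁ : ∀ a b → a * b ≡ 1 * b * a
      comm₁ = ℕR.solve-∀
      term : ∀ S R → length S + length R ≡ k → prod Y S ℤ.* + w (S , R) ℤ.+ prod (λ v → ℤ.- Y v) S ℤ.* + w (S , R) ≡
        ifNull S (+ (2 * w (S , R))) ℤ.+ + 2 ℤ.* g (S , R)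
      term [] R _ = twice-1 (w ([] , R))
      term (v ∷ U) R len rewrite prod-neg Y (v ∷ U) | isEven-length U | trans (cong (_∸ suc (length U)) (sym len)) (m+n∸m≡n (suc (length U)) (length R)) with isEvenℕ (length U)
      ... | false = trans (ring-even (prod Y (v ∷ U)) (+ w (v ∷ U , R))) (cong (λ z → 0ℤ ℤ.+ + 2 ℤ.* (+ z ℤ.* prod Y (v ∷ U))) (comm₁ (M ^ length R) (#covering 1 (length R) Full)))
      ... | true  = ring-odd (prod Y (v ∷ U)) (+ w (v ∷ U , R))

    raw-identity : ∀ l → length l ≡ k → G true true Full l ℤ.+ (+ (2 * (M ^ k * #covering 1 k Full)) ℤ.+ + 2 ℤ.* cutTerm M Y l) ≡
      + (M ^ k * (#covering 2 k Full + #covering 0 k Full))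
    raw-identity l len = trans (cong (λ w → G true true Full l ℤ.+ w) (sym (even-part l len))) (trans (G-tt l Full)
      (trans (cong₂ ℤ._+_ (Rec-const 2 (+ M ℤ.+ + M) (cong (λ w → + (M + w)) (sym (+-identityʳ M))) l Full) (Rec-const 0 0ℤ refl l Full))
        (cong +_ (trans (sym (*-distribˡ-+ (M ^ length l) _ _)) (cong (λ j → M ^ j * (#covering 2 j Full + #covering 0 j Full)) len)))))

  total : ℕ
  total = stirling2 k (2 + r) * (2 + r) !

  -- Evaluation of `raw-identity` at `M = 1` and `Y = 0`, where all weights are 1 and `G` counts the
  -- surjective lists.
  #covering-total : total + 2 * #covering 1 k Full ≡ #covering 2 k Full + #covering 0 k Full
  #covering-total = ℤP.+-injective (begin
    + total ℤ.+ + (2 * #covering 1 k Full) ≡⟨ cong₂ ℤ._+_ (sym count) (cong (λ w → + (2 * w)) (trans (sym (*-identityˡ _)) (cong (_* #covering 1 k Full) (sym (^-zeroˡ k))))) ⟩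
    G true true Full l₀ ℤ.+ + (2 * (1 ^ k * #covering 1 k Full)) ≡⟨ cong (λ w → G true true Full l₀ ℤ.+ w) (sym (trans (cong (λ w → + (2 * (1 ^ k * #covering 1 k Full)) ℤ.+ + 2 ℤ.* w) vanish) (ℤP.+-identityʳ _))) ⟩
    G true true Full l₀ ℤ.+ (+ (2 * (1 ^ k * #covering 1 k Full)) ℤ.+ + 2 ℤ.* cutTerm 1 (λ _ → 0ℤ) l₀)
      ≡⟨ raw-identity 1 (λ _ → 0ℤ) l₀ (ListP.length-replicate k) ⟩
    + (1 ^ k * (#covering 2 k Full + #covering 0 k Full)) ≡⟨ cong +_ (trans (cong (_* (#covering 2 k Full + #covering 0 k Full)) (^-zeroˡ k)) (*-identityˡ _)) ⟩
    + (#covering 2 k Full + #covering 0 k Full) ∎)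
    where
    open ≡-Reasoning
    open Expansion {Unit} {r} 1 (λ _ → 0ℤ)
    l₀ : List Unit
    l₀ = List.replicate k tt
    count : G true true Full l₀ ≡ + total
    count = trans (TS-ones colourWt (λ { v zero → refl ; v (suc zero) → refl ; v (suc (suc c)) → refl }) l₀ (true ∷ true ∷ Full))
      (cong +_ (trans (cong₂ (λ h l → surj (2 + r ∸ h) h l) (∣replicate∣ (2 + r)) (ListP.length-replicate k))
        (trans (cong (λ d → surj d (2 + r) k) (n∸n≡0 (2 + r))) (surj≡stirling2 (2 + r) k))))
    vanish : cutTerm 1 (λ _ → 0ℤ) l₀ ≡ 0ℤ
    vanish = ∑ᶻ-0 (splits l₀) (λ p _ → zero-term (proj₁ p) (proj₂ p))
      where
      zero-term : ∀ (S R : List Unit) → + (cf (length S) * 1 ^ length R) ℤ.* prod (λ _ → 0ℤ) S ≡ 0ℤ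
      zero-term []      R = refl
      zero-term (v ∷ S) R = ℤP.*-zeroʳ (+ (cf (suc (length S)) * 1 ^ length R))

  module _ {V : Set} (M : ℕ) (Y : V → ℤ) where

    open Expansion {V} {r} M Y

    edge-identity : ∀ l → length l ≡ k → G true true Full l ℤ.+ + 2 ℤ.* cutTerm M Y l ≡ + (M ^ k * total)
    edge-identity l len = +ᶻ-cancelˡ (+ x) _ _ (begin
      + x ℤ.+ (G true true Full l ℤ.+ + 2 ℤ.* cutTerm M Y l) ≡⟨ swap (+ x) (G true true Full l) (+ 2 ℤ.* cutTerm M Y l) ⟩
      G true true Full l ℤ.+ (+ x ℤ.+ + 2 ℤ.* cutTerm M Y l) ≡⟨ raw-identity M Y l len ⟩
      + (M ^ k * (#covering 2 k Full + #covering 0 k Full)) ≡⟨ cong (λ w → + (M ^ k * w)) (sym #covering-total) ⟩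
      + (M ^ k * (total + 2 * #covering 1 k Full)) ≡⟨ cong +_ (nat (M ^ k) total (#covering 1 k Full)) ⟩
      + x ℤ.+ + (M ^ k * total) ∎)
      where
      open ≡-Reasoning
      x : ℕ
      x = 2 * (M ^ k * #covering 1 k Full)
      swap : ∀ a b c → a ℤ.+ (b ℤ.+ c) ≡ b ℤ.+ (a ℤ.+ c)
      swap = ℤR.solve-∀
      nat : ∀ p t c → p * (t + 2 * c) ≡ 2 * (p * c) + p * t
      nat = ℕR.solve-∀

  module _ {n : ℕ} (es : List (Subset n)) (uni : ∀ e → e ∈ es → ∣ e ∣ ≡ k) where

    cutCount : Vec (Fin (2 + r)) n → ℕ
    cutCount f = ∑ es (λ e → 𝟙 (does (isCutEdge? (lookup f) e)))

    -- The expected size of a random cut is at most the size of the best one.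
    expected-≤ : ∀ c → (∀ f → cutCount f ≤ c) → ∀ M → 1 ≤ M → (Y : Fin n → ℤ) → (∀ v → ℤ.∣ Y v ∣ ≤ M) →
      + (M ^ k * (total * length es)) ℤ.≤ + 2 ℤ.* cutPoly cf (map els es) M Y ℤ.+ + (M ^ k * ((2 + r) ^ k * c))
    expected-≤ c best M 1≤M Y Y≤ = begin
      + (M ^ k * (total * length es)) ≡⟨ sym total-sum ⟩
      ∑ᶻ es Tₑ ℤ.+ + 2 ℤ.* cutPoly cf (map els es) M Y ≤⟨ ℤP.+-monoˡ-≤ (+ 2 ℤ.* cutPoly cf (map els es) M Y) bound ⟩
      + (ρ ^ k * c) ℤ.+ + 2 ℤ.* cutPoly cf (map els es) M Y ≡⟨ ℤP.+-comm (+ (ρ ^ k * c)) (+ 2 ℤ.* cutPoly cf (map els es) M Y) ⟩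
      + 2 ℤ.* cutPoly cf (map els es) M Y ℤ.+ + (ρ ^ k * c) ≡⟨ cong (λ w → + 2 ℤ.* cutPoly cf (map els es) M Y ℤ.+ + w)
           (trans (cong (_* c) (trans (*-^ (2 + r) M k) (*-comm ((2 + r) ^ k) (M ^ k)))) (*-assoc (M ^ k) _ c)) ⟩
      + 2 ℤ.* cutPoly cf (map els es) M Y ℤ.+ + (M ^ k * ((2 + r) ^ k * c)) ∎
      where
      open ℤP.≤-Reasoning
      open Expansion {Fin n} {r} M Y
      ρ : ℕ
      ρ = (2 + r) * M
      1≤ρ : 1 ≤ ρ
      1≤ρ = *-mono-≤ {1} {2 + r} (s≤s z≤n) 1≤M
      φ : List (Fin (2 + r)) → ℤ
      φ g = + 𝟙 (covers (replicate (2 + r) true) g)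
      Tₑ : Subset n → ℤ
      Tₑ e = TS (map colourWt (els e)) φ
      total-sum : ∑ᶻ es Tₑ ℤ.+ + 2 ℤ.* cutPoly cf (map els es) M Y ≡ + (M ^ k * (total * length es))
      total-sum = trans (cong (λ w → ∑ᶻ es Tₑ ℤ.+ w) (trans (cong (λ w → + 2 ℤ.* w) (∑ᶻ-map els es (cutTerm M Y))) (sym (∑ᶻ-*ˡ es (+ 2) (λ e → cutTerm M Y (els e))))))
        (trans (sym (∑ᶻ-+ es _ _)) (trans (∑ᶻ-cong∈ es (λ e e∈ → edge-identity M Y (els e) (trans (length-els e) (uni e e∈))))
          (trans (∑ᶻ-+∑ es (λ _ → M ^ k * total)) (cong +_ (trans (∑-const es (M ^ k * total)) (trans (*-comm (length es) _) (*-assoc (M ^ k) total (length es))))))))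
      nonneg : ∀ v c → 0ℤ ℤ.≤ colourWt v c
      nonneg v zero          = nn (Y v) (Y≤ v)
        where
        nn : ∀ y → ℤ.∣ y ∣ ≤ M → 0ℤ ℤ.≤ + M ℤ.+ y
        nn (+ y)    h = ℤ.+≤+ z≤n
        nn -[1+ y ] h = ℤP.≤-trans (ℤ.+≤+ z≤n) (ℤP.≤-reflexive (sym (ℤP.⊖-≥ h)))
      nonneg v (suc zero)    = nn (Y v) (Y≤ v)
        where
        nn : ∀ y → ℤ.∣ y ∣ ≤ M → 0ℤ ℤ.≤ + M ℤ.+ ℤ.- y
        nn (+ zero)  h = ℤ.+≤+ z≤n
        nn (+ suc y) h = ℤP.≤-trans (ℤ.+≤+ z≤n) (ℤP.≤-reflexive (sym (ℤP.⊖-≥ h)))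
        nn -[1+ y ]  h = ℤ.+≤+ z≤n
      nonneg v (suc (suc _)) = ℤ.+≤+ z≤n
      bound : ∑ᶻ es Tₑ ℤ.≤ + (ρ ^ k * c)
      -- The factor `ρ ^ n` turns each edge sum into an expectation over colourings of all vertices;
      -- only then can the edges be added and compared with the best cut.
      bound = ℤP.*-cancelˡ-≤-pos (∑ᶻ es Tₑ) (+ (ρ ^ k * c)) (+ (ρ ^ n)) {{ℤ.positive (ℤ.+<+ (m^n>0 ρ {{>-nonZero 1≤ρ}} n))}} (begin
        + (ρ ^ n) ℤ.* ∑ᶻ es Tₑ ≡⟨ cong (λ w → w ℤ.* ∑ᶻ es Tₑ) (sym (pos-^ ρ n)) ⟩
        (+ ρ) ℤ.^ n ℤ.* ∑ᶻ es Tₑ ≡⟨ sym (∑ᶻ-*ˡ es ((+ ρ) ℤ.^ n) Tₑ) ⟩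
        ∑ᶻ es (λ e → (+ ρ) ℤ.^ n ℤ.* Tₑ e)
          ≡⟨ ∑ᶻ-cong∈ es (λ e e∈ → trans (sym (TV-restrict colourWt (+ ρ) ∑-colourWt e φ)) (cong (λ j → (+ ρ) ℤ.^ j ℤ.* TV colourWt (φ ∘ restrict e)) (uni e e∈))) ⟩
        ∑ᶻ es (λ e → (+ ρ) ℤ.^ k ℤ.* TV colourWt (φ ∘ restrict e)) ≡⟨ ∑ᶻ-*ˡ es ((+ ρ) ℤ.^ k) _ ⟩
        (+ ρ) ℤ.^ k ℤ.* ∑ᶻ es (λ e → TV colourWt (φ ∘ restrict e))
          ≡⟨ cong₂ (λ x y → x ℤ.* y) (pos-^ ρ k) (sym (TV-∑ colourWt es (λ e → φ ∘ restrict e))) ⟩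
        + (ρ ^ k) ℤ.* TV colourWt (λ f → ∑ᶻ es (λ e → φ (restrict e f)))
          ≤⟨ ℤP.*-monoˡ-≤-nonNeg (+ (ρ ^ k)) (TV-mono colourWt nonneg (λ f → ℤP.≤-trans (ℤP.≤-reflexive
               (trans (∑ᶻ-+∑ es _) (cong +_ (∑-cong es (λ e → sym (𝟙-cut f e)))))) (ℤ.+≤+ (best f)))) ⟩
        + (ρ ^ k) ℤ.* TV colourWt (λ _ → + c) ≡⟨ cong (λ w → + (ρ ^ k) ℤ.* w) (trans (TV-const colourWt (+ ρ) ∑-colourWt (+ c)) (cong (λ w → w ℤ.* + c) (pos-^ ρ n))) ⟩
        + (ρ ^ k) ℤ.* (+ (ρ ^ n) ℤ.* + c) ≡⟨ *ᶻ-swapˡ (+ (ρ ^ k)) (+ (ρ ^ n)) (+ c) ⟩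
        + (ρ ^ n) ℤ.* (+ (ρ ^ k) ℤ.* + c) ≡⟨ cong (λ w → + (ρ ^ n) ℤ.* w) (sym (ℤP.pos-* (ρ ^ k) c)) ⟩
        + (ρ ^ n) ℤ.* + (ρ ^ k * c) ∎)

    -- The uniform random cut, `Y = 0`. It shows that the truncated subtraction in `cutBound` is
    -- exact.
    average-≤ : ∀ c → (∀ f → cutCount f ≤ c) → total * length es ≤ (2 + r) ^ k * c
    average-≤ c best = ℤP.drop‿+≤+ (ℤP.≤-trans (ℤP.≤-reflexive (cong +_ (sym (one (total * length es)))))
      (ℤP.≤-trans (expected-≤ c best 1 ≤-refl (λ _ → 0ℤ) (λ _ → z≤n)) (ℤP.≤-reflexive (trans (cong (λ w → + 2 ℤ.* w ℤ.+ + (1 ^ k * ((2 + r) ^ k * c))) vanish)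
        (trans (ℤP.+-identityˡ _) (cong +_ (one ((2 + r) ^ k * c))))))))
      where
      one : ∀ x → 1 ^ k * x ≡ x
      one x = trans (cong (_* x) (^-zeroˡ k)) (*-identityˡ x)
      vanish : cutPoly cf (map els es) 1 (λ _ → 0ℤ) ≡ 0ℤ
      vanish = ∑ᶻ-0 (map els es) (λ l _ → ∑ᶻ-0 (splits l) (λ p _ → zero-term (proj₁ p) (proj₂ p)))
        where
        zero-term : ∀ (S R : List (Fin n)) → + (cf (length S) * 1 ^ length R) ℤ.* prod (λ _ → 0ℤ) S ≡ 0ℤ
        zero-term []      R = refl
        zero-term (v ∷ S) R = ℤP.*-zeroʳ (+ (cf (suc (length S)) * 1 ^ length R))

    cutBound : ∀ c → (∀ f → cutCount f ≤ c) → CutBound k cf es ((2 + r) ^ k * c ∸ total * length es)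
    cutBound c best M 1≤M Y Y≤ = begin
      ℤ.- X ≡⟨ ring₁ X (+ (M ^ k * avg)) ⟩
      + (M ^ k * avg) ℤ.+ ℤ.- (X ℤ.+ + (M ^ k * avg)) ≤⟨ ℤP.+-monoˡ-≤ (ℤ.- (X ℤ.+ + (M ^ k * avg))) (expected-≤ c best M 1≤M Y Y≤) ⟩
      X ℤ.+ + (M ^ k * top) ℤ.+ ℤ.- (X ℤ.+ + (M ^ k * avg))
        ≡⟨ cong (λ w → X ℤ.+ + w ℤ.+ ℤ.- (X ℤ.+ + (M ^ k * avg))) (trans (cong (M ^ k *_) (sym (m∸n+n≡m (average-≤ c best)))) (*-distribˡ-+ (M ^ k) (top ∸ avg) avg)) ⟩
      X ℤ.+ (+ (M ^ k * (top ∸ avg)) ℤ.+ + (M ^ k * avg)) ℤ.+ ℤ.- (X ℤ.+ + (M ^ k * avg)) ≡⟨ ring₂ X (+ (M ^ k * (top ∸ avg))) (+ (M ^ k * avg)) ⟩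
      + (M ^ k * (top ∸ avg)) ∎
      where
      open ℤP.≤-Reasoning
      X : ℤ
      X = + 2 ℤ.* cutPoly cf (map els es) M Y
      top avg : ℕ
      top = (2 + r) ^ k * c
      avg = total * length es
      ring₁ : ∀ x a → ℤ.- x ≡ a ℤ.+ ℤ.- (x ℤ.+ a)
      ring₁ = ℤR.solve-∀
      ring₂ : ∀ x a b → x ℤ.+ (a ℤ.+ b) ℤ.+ ℤ.- (x ℤ.+ b) ≡ a
      ring₂ = ℤR.solve-∀

-- Rationals

ι : ℕ → ℚ
ι m = (+ m) ℚ./ 1

fromℚᵘ-* : ∀ p q → ℚ.fromℚᵘ p ℚ.* ℚ.fromℚᵘ q ≡ ℚ.fromℚᵘ (p ℚᵘ.* q)
fromℚᵘ-* p q = ℚP.toℚᵘ-injective (ℚᵘP.≃-trans (ℚP.toℚᵘ-homo-* (ℚ.fromℚᵘ p) (ℚ.fromℚᵘ q))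
  (ℚᵘP.≃-trans (ℚᵘP.*-cong (ℚP.toℚᵘ-fromℚᵘ p) (ℚP.toℚᵘ-fromℚᵘ q)) (ℚᵘP.≃-sym (ℚP.toℚᵘ-fromℚᵘ (p ℚᵘ.* q)))))

fromℚᵘ-+ : ∀ p q → ℚ.fromℚᵘ p ℚ.+ ℚ.fromℚᵘ q ≡ ℚ.fromℚᵘ (p ℚᵘ.+ q)
fromℚᵘ-+ p q = ℚP.toℚᵘ-injective (ℚᵘP.≃-trans (ℚP.toℚᵘ-homo-+ (ℚ.fromℚᵘ p) (ℚ.fromℚᵘ q))
  (ℚᵘP.≃-trans (ℚᵘP.+-cong (ℚP.toℚᵘ-fromℚᵘ p) (ℚP.toℚᵘ-fromℚᵘ q)) (ℚᵘP.≃-sym (ℚP.toℚᵘ-fromℚᵘ (p ℚᵘ.+ q)))))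

ι-* : ∀ m n → ι (m * n) ≡ ι m ℚ.* ι n
ι-* m n = sym (trans (fromℚᵘ-* p q) (ℚP.fromℚᵘ-cong {p ℚᵘ.* q} {ℚᵘ.mkℚᵘ (+ (m * n)) 0} (ℚᵘ.*≡* (cong (λ w → w ℤ.* 1ℤ) (sym (ℤP.pos-* m n))))))
  where
  p q : ℚᵘ.ℚᵘ
  p = ℚᵘ.mkℚᵘ (+ m) 0
  q = ℚᵘ.mkℚᵘ (+ n) 0

ι-+ : ∀ m n → ι (m + n) ≡ ι m ℚ.+ ι n
ι-+ m n = sym (trans (fromℚᵘ-+ p q) (ℚP.fromℚᵘ-cong {p ℚᵘ.+ q} {ℚᵘ.mkℚᵘ (+ (m + n)) 0}
  (ℚᵘ.*≡* (cong (λ w → w ℤ.* 1ℤ) (cong₂ ℤ._+_ (ℤP.*-identityʳ (+ m)) (ℤP.*-identityʳ (+ n)))))))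
  where
  p q : ℚᵘ.ℚᵘ
  p = ℚᵘ.mkℚᵘ (+ m) 0
  q = ℚᵘ.mkℚᵘ (+ n) 0

ι-mono : ∀ {m n} → m ≤ n → ι m ℚ.≤ ι n
ι-mono {m} {n} h = ℚP.toℚᵘ-cancel-≤ (ℚᵘP.≤-respˡ-≃ (ℚᵘP.≃-sym (ℚP.toℚᵘ-fromℚᵘ (ℚᵘ.mkℚᵘ (+ m) 0)))
  (ℚᵘP.≤-respʳ-≃ (ℚᵘP.≃-sym (ℚP.toℚᵘ-fromℚᵘ (ℚᵘ.mkℚᵘ (+ n) 0))) (ℚᵘ.*≤* (ℤP.*-monoʳ-≤-nonNeg 1ℤ (ℤ.+≤+ h)))))

0≤ι : ∀ m → 0ℚ ℚ.≤ ι m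
0≤ι m = ι-mono {0} {m} z≤n

frac-ι : ∀ a d → 1 ≤ d → frac a d ℚ.* ι d ≡ ι a
frac-ι a (suc d) _ = trans (fromℚᵘ-* p q) (ℚP.fromℚᵘ-cong {p ℚᵘ.* q} {ℚᵘ.mkℚᵘ (+ a) 0}
  (ℚᵘ.*≡* (trans (ℤP.*-identityʳ (+ a ℤ.* + suc d)) (cong (λ w → + a ℤ.* w) (cong +_ (sym (*-identityʳ (suc d))))))))
  where
  p q : ℚᵘ.ℚᵘ
  p = ℚᵘ.mkℚᵘ (+ a) d
  q = ℚᵘ.mkℚᵘ (+ suc d) 0

frac-pos : ∀ d → 1 ≤ d → 0ℚ < frac 1 d
frac-pos (suc d) _ = ℚP.positive⁻¹ ((+ 1) ℚ./ suc d) {{ℚP.normalize-pos 1 (suc d)}}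

ι-^ : ∀ m e → ι (m ^ e) ≡ ι m ^ℚ e
ι-^ m zero    = refl
ι-^ m (suc e) = trans (ι-* m (m ^ e)) (cong (λ w → ι m ℚ.* w) (ι-^ m e))

interchangeℚ : ∀ x y z w → (x ℚ.* y) ℚ.* (z ℚ.* w) ≡ (x ℚ.* z) ℚ.* (y ℚ.* w)
interchangeℚ x y z w = trans (ℚP.*-assoc x y _) (trans (cong (λ u → x ℚ.* u) (trans (sym (ℚP.*-assoc y z w))
  (trans (cong (ℚ._* w) (ℚP.*-comm y z)) (ℚP.*-assoc z y w)))) (sym (ℚP.*-assoc x z _)))

*-^ℚ : ∀ x y e → (x ℚ.* y) ^ℚ e ≡ (x ^ℚ e) ℚ.* (y ^ℚ e)
*-^ℚ x y zero    = refl
*-^ℚ x y (suc e) = trans (cong (λ w → x ℚ.* y ℚ.* w) (*-^ℚ x y e)) (interchangeℚ x y (x ^ℚ e) (y ^ℚ e))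

*-monoʳℚ : ∀ z {x y} → 0ℚ ℚ.≤ z → x ℚ.≤ y → z ℚ.* x ℚ.≤ z ℚ.* y
*-monoʳℚ z hz h = ℚP.*-monoˡ-≤-nonNeg z {{ℚ.nonNegative hz}} h

*-nonnegℚ : ∀ x y → 0ℚ ℚ.≤ x → 0ℚ ℚ.≤ y → 0ℚ ℚ.≤ x ℚ.* y
*-nonnegℚ x y hx hy = ℚP.≤-trans (ℚP.≤-reflexive (sym (ℚP.*-zeroʳ x))) (*-monoʳℚ x hx hy)

*-mono-≤ℚ : ∀ {x y z w} → 0ℚ ℚ.≤ x → 0ℚ ℚ.≤ w → x ℚ.≤ y → z ℚ.≤ w → x ℚ.* z ℚ.≤ y ℚ.* w
*-mono-≤ℚ {x} {y} {z} {w} hx hw h₁ h₂ = ℚP.≤-trans (*-monoʳℚ x hx h₂)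
  (ℚP.*-monoʳ-≤-nonNeg w {{ℚ.nonNegative hw}} h₁)

^ℚ-nonneg : ∀ x e → 0ℚ ℚ.≤ x → 0ℚ ℚ.≤ x ^ℚ e
^ℚ-nonneg x zero    h = 0≤ι 1
^ℚ-nonneg x (suc e) h = *-nonnegℚ x (x ^ℚ e) h (^ℚ-nonneg x e h)

^ℚ-mono : ∀ {x y} e → 0ℚ ℚ.≤ x → x ℚ.≤ y → x ^ℚ e ℚ.≤ y ^ℚ e
^ℚ-mono zero    hx h = ℚP.≤-refl
^ℚ-mono {x} {y} (suc e) hx h = *-mono-≤ℚ hx (^ℚ-nonneg y e (ℚP.≤-trans hx h)) h (^ℚ-mono e hx h)

integer-root : ∀ j m → ∃[ B ] (1 ≤ B × B ^ suc j ≤ suc m × suc m <ᴺ suc B ^ suc j)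
integer-root j zero = 1 , ≤-refl , ≤-reflexive (^-zeroˡ (suc j)) , *-mono-≤ {2} {2} ≤-refl (m^n>0 2 j)
integer-root j (suc m) with integer-root j m
... | B , 1≤B , lo , hi with suc B ^ suc j ≤? suc (suc m)
...   | yes p = suc B , s≤s z≤n , p , ≤-trans (s≤s hi) (^-monoˡ-< (suc j) ≤-refl)
...   | no p  = B , 1≤B , ≤-trans lo (n≤1+n _) , ≰⇒> p

root-bounds : ∀ j m → 1 ≤ m → ∃[ B ] (1 ≤ B × B ^ suc j ≤ m × m ≤ (2 * B) ^ suc j)
root-bounds j (suc m) _ with integer-root j m
... | B , 1≤B , lo , hi = B , 1≤B , lo , ≤-trans (<⇒≤ hi) (^-monoˡ-≤ (suc j) (≤-trans (+-monoˡ-≤ B 1≤B) (≤-reflexive (cong (λ w → B + w) (sym (+-identityʳ B))))))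

∑-filter : {X : A → Set} (P? : ∀ x → Dec (X x)) (xs : List A) → ∑ xs (λ x → 𝟙 (does (P? x))) ≡ length (filter P? xs)
∑-filter P? []       = refl
∑-filter P? (x ∷ xs) with does (P? x)
... | true  = cong suc (∑-filter P? xs)
... | false = ∑-filter P? xs

isEvenℕ-double : ∀ x → isEvenℕ (x + x) ≡ true
isEvenℕ-double zero    = refl
isEvenℕ-double (suc x) rewrite +-suc x x = trans (double-not (isEvenℕ (x + x))) (isEvenℕ-double x)
  where
  double-not : ∀ b → not (not b) ≡ b
  double-not true  = refl
  double-not false = refl

-- The `k - s` vertices outside `S` are enough to show all `r` other colours.
coefficient-≥ : ∀ r k s → 1 ≤ s → isEvenℕ s ≡ true → r + s ≤ k → 1 ≤ coefficient k (replicate r true) s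
coefficient-≥ r k (suc s) _ ev h rewrite ev = ≤-trans (#covering-≥ (k ∸ suc s) (replicate r true)
  (≤-trans (≤-reflexive (∣replicate∣ r)) (≤-trans (≤-reflexive (sym (m+n∸n≡m r (suc s)))) (∸-monoˡ-≤ (suc s) h)))) (≤-reflexive (sym (*-identityˡ _)))

coefficient-≤ : ∀ r k s → suc r ≤ k → coefficient k (replicate r true) s ≤ k ^ k
coefficient-≤ r k zero    h = z≤n
coefficient-≤ r k (suc s) h = ≤-trans (*-mono-≤ (𝟙≤1 (isEvenℕ (suc s))) (#covering-≤ (k ∸ suc s) (replicate r true))) (≤-trans (≤-reflexive (*-identityˡ _))
  (≤-trans (^-monoˡ-≤ (k ∸ suc s) h) (^-monoʳ-≤ k {{>-nonZero (≤-trans (s≤s z≤n) h)}} (m∸n≤m k (suc s)))))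

-- A cut of size c exceeding the average avg / R by σ / R.
surplus-scale : ∀ c avg R σ C E β² → 1 ≤ R → σ + avg ≡ R * c → β² ≤ C * σ → R * C ≤ E →
  0ℚ ℚ.≤ ι c ℚ.- frac avg R × ι β² ℚ.≤ (ι c ℚ.- frac avg R) ℚ.* ι E
surplus-scale c avg R σ C E β² 1≤R σ+avg β²≤ RC≤ = s≥0 , final
  where
  s : ℚ
  s = ι c ℚ.- frac avg R
  sR : s ℚ.* ι R ≡ ι σ
  sR = trans (ℚP.*-distribʳ-+ (ι R) (ι c) (ℚ.- frac avg R))
    (trans (cong₂ ℚ._+_ (trans (sym (ι-* c R)) (trans (cong ι (trans (*-comm c R) (sym σ+avg))) (ι-+ σ avg)))
        (trans (sym (ℚP.neg-distribˡ-* (frac avg R) (ι R))) (cong ℚ.-_ (frac-ι avg R 1≤R))))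
      (trans (ℚP.+-assoc (ι σ) (ι avg) (ℚ.- ι avg)) (trans (cong (λ w → ι σ ℚ.+ w) (ℚP.+-inverseʳ (ι avg))) (ℚP.+-identityʳ (ι σ)))))
  0<ιR : 0ℚ < ι R
  0<ιR = ℚP.<-≤-trans (ℚP.positive⁻¹ (ι 1)) (ι-mono 1≤R)
  s≥0 : 0ℚ ℚ.≤ s
  s≥0 = ℚP.*-cancelʳ-≤-pos (ι R) {{ℚ.positive 0<ιR}} (ℚP.≤-trans (ℚP.≤-reflexive (ℚP.*-zeroˡ (ι R))) (ℚP.≤-trans (0≤ι σ) (ℚP.≤-reflexive (sym sR))))
  final : ι β² ℚ.≤ s ℚ.* ι E
  final = ℚP.≤-trans (ι-mono β²≤) (ℚP.≤-trans (ℚP.≤-reflexive (trans (cong ι (*-comm C σ)) (trans (ι-* σ C) (trans (cong (ℚ._* ι C) (sym sR))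
      (trans (ℚP.*-assoc s (ι R) (ι C)) (cong (λ w → s ℚ.* w) (sym (ι-* R C))))))))
    (*-monoʳℚ s s≥0 (ι-mono RC≤)))

-- Assembly, and passage to the exponent 2/3 - ε

module CutLevel (b′ k r : ℕ) (r+q≤k : 2 + r + 4 * (2 * 4 ^ (3 * suc b′)) ≤ k) where

  q : ℕ
  q = 4 * (2 * 4 ^ (3 * suc b′))

  q≤k : 2 + q ≤ k
  q≤k = ≤-trans (+-monoˡ-≤ q (m≤m+n 2 r)) r+q≤k

  2≤k : 2 ≤ k
  2≤k = ≤-trans (m≤m+n 2 q) q≤k

  2≤q : 2 ≤ q
  2≤q = *-mono-≤ {1} {4} (s≤s z≤n) (*-mono-≤ {2} {2} ≤-refl (m^n>0 4 (3 * suc b′)))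

  fits : ∀ s → s ≤ q → r + s ≤ k
  fits s h = ≤-trans (≤-trans (+-monoʳ-≤ r h) (m≤n+m (r + q) 2)) r+q≤k

  suc-r≤k : suc r ≤ k
  suc-r≤k = ≤-trans (≤-trans (n≤1+n (suc r)) (m≤m+n (2 + r) q)) r+q≤k

  1≤cf-level : ∀ c → c ≤ 3 * suc b′ → 1 ≤ coefficient k (replicate r true) (4 * (2 * 4 ^ c))
  1≤cf-level c h = coefficient-≥ r k (4 * (2 * 4 ^ c)) (*-mono-≤ {1} {4} (s≤s z≤n) (*-mono-≤ {1} {2} (s≤s z≤n) (m^n>0 4 c)))
    (subst (λ w → isEvenℕ w ≡ true) (quad (2 * 4 ^ c)) (isEvenℕ-double (2 * 4 ^ c + 2 * 4 ^ c)))
    (fits _ (*-monoʳ-≤ 4 (*-monoʳ-≤ 2 (^-monoʳ-≤ 4 h))))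
    where
    quad : ∀ x → (x + x) + (x + x) ≡ 4 * x
    quad = ℕR.solve-∀

  open Constants k b′ (k ^ k) using (C*)
  open EdgeWeight r k

  module _ {n : ℕ} (es : List (Subset n)) (uni : ∀ e → e ∈ es → ∣ e ∣ ≡ k) (c : ℕ) (best : ∀ f → cutCount es uni f ≤ c)
    (B : ℕ) (1≤B : 1 ≤ B) (lo : B ^ (3 * suc b′) ≤ length es) (hi : length es ≤ (2 * B) ^ (3 * suc b′)) where

    excess-≥ : B ^ b′ * B ^ b′ ≤ C* * ((2 + r) ^ k * c ∸ total * length es)
    excess-≥ = Core.core k 2≤k es uni cf refl (coefficient-≥ r k 2 (s≤s z≤n) refl (fits 2 2≤q)) (k ^ k) (λ s → coefficient-≤ r k s suc-r≤k)
      ((2 + r) ^ k * c ∸ total * length es) (cutBound es uni c best) b′ B 1≤B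
      (≤-trans (≤-reflexive y³) lo) hi 1≤cf-level (≤-trans (n≤1+n (suc q)) q≤k)
      where
      y³ : B ^ suc b′ * (B ^ suc b′ * B ^ suc b′) ≡ B ^ (3 * suc b′)
      y³ = trans (cong (B ^ suc b′ *_) (sym (^-distribˡ-+-* B (suc b′) (suc b′)))) (trans (sym (^-distribˡ-+-* B (suc b′) (suc b′ + suc b′))) (cong (B ^_) (three (suc b′))))
        where
        three : ∀ b → b + (b + b) ≡ 3 * b
        three = ℕR.solve-∀

module Final (b′ : ℕ) where

  q : ℕ
  q = 4 * (2 * 4 ^ (3 * suc b′))

  module _ (k : ℕ) where

    open Constants k b′ (k ^ k) using (C*)

    -- `E` absorbs `C*` and the denominator of the average, at most `k ^ k` for every admissible
    -- `r`. `Y` pays for the 2 in `m ≤ (2 * B) ^ (3 * suc b′)`.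
    E Y cd : ℕ
    E = suc (k ^ k * C*)
    Y = 4 ^ b′
    cd = E * Y

    1≤cd : 1 ≤ cd
    1≤cd = *-mono-≤ {1} {E} (s≤s z≤n) (m^n>0 4 b′)

    best-surplus : ∀ r → 2 + r + q ≤ k → (H : Hypergraph k) → ∀ B → 1 ≤ B → B ^ (3 * suc b′) ≤ numEdges H → numEdges H ≤ (2 * B) ^ (3 * suc b′) →
      ∃[ f ] (0ℚ ℚ.≤ surplus {k} {2 + r} H f × ι (B ^ b′ * B ^ b′) ℚ.≤ surplus {k} {2 + r} H f ℚ.* ι E)
    best-surplus r r+q≤k H B 1≤B lo hi = lookup f* , subst Claim (∑-filter (isCutEdge? (lookup f*)) es)
        (surplus-scale (cutCount es uni f*) (total * length es) ((2 + r) ^ k) ((2 + r) ^ k * cutCount es uni f* ∸ total * length es) C* E (B ^ b′ * B ^ b′)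
          (m^n>0 (2 + r) k) (m∸n+n≡m (average-≤ es uni (cutCount es uni f*) best-f*))
          (CutLevel.excess-≥ b′ k r r+q≤k es uni (cutCount es uni f*) best-f* B 1≤B lo hi)
          (≤-trans (*-monoˡ-≤ C* (^-monoˡ-≤ k (≤-trans (m≤m+n (2 + r) q) r+q≤k))) (n≤1+n (k ^ k * C*))))
      where
      open EdgeWeight r k
      es : List (Subset (order H))
      es = edges H
      uni : ∀ e → e ∈ es → ∣ e ∣ ≡ k
      uni e e∈ = All.lookup (uniform H) e∈
      f* : Vec (Fin (2 + r)) (order H)
      f* = proj₁ (best (cutCount es uni))
      best-f* : ∀ f → cutCount es uni f ≤ cutCount es uni f*
      best-f* = proj₂ (best (cutCount es uni))
      Claim : ℕ → Set
      Claim c = 0ℚ ℚ.≤ ι c ℚ.- frac (total * length es) ((2 + r) ^ k) ×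
        ι (B ^ b′ * B ^ b′) ℚ.≤ (ι c ℚ.- frac (total * length es) ((2 + r) ^ k)) ℚ.* ι E

    -- m^{2b} = m² m^{2b′}, where m² is absorbed by m^{3a} and m^{2b′} by the upper bound on m.
    power-bound : ∀ a m B → 1 ≤ a → m ≤ (2 * B) ^ (3 * suc b′) →
      suc zero ≤ m → m ^ (2 * suc b′) ≤ (B ^ b′ * B ^ b′) ^ (3 * suc b′) * Y ^ (3 * suc b′) * m ^ (3 * a)
    power-bound a m B 1≤a hm 1≤m = begin
      m ^ (2 * suc b′) ≡⟨ cong (m ^_) (expand b′) ⟩
      m ^ (2 * b′ + 2) ≡⟨ ^-distribˡ-+-* m (2 * b′) 2 ⟩
      m ^ (2 * b′) * m ^ 2 ≤⟨ *-mono-≤ (^-monoˡ-≤ (2 * b′) hm) (^-monoʳ-≤ m {{>-nonZero 1≤m}} (≤-trans (n≤1+n 2) (*-monoʳ-≤ 3 1≤a))) ⟩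
      ((2 * B) ^ 3b) ^ (2 * b′) * m ^ (3 * a) ≡⟨ cong (_* m ^ (3 * a)) regroup ⟩
      (B ^ b′ * B ^ b′) ^ 3b * Y ^ 3b * m ^ (3 * a) ∎
      where
      open ≤-Reasoning
      3b : ℕ
      3b = 3 * suc b′
      expand : ∀ b → 2 * suc b ≡ 2 * b + 2
      expand = ℕR.solve-∀
      square : ∀ x → (2 * x) * ((2 * x) * 1) ≡ x * x * 4
      square = ℕR.solve-∀
      regroup : ((2 * B) ^ 3b) ^ (2 * b′) ≡ (B ^ b′ * B ^ b′) ^ 3b * Y ^ 3b
      regroup = trans (^-*-assoc (2 * B) 3b (2 * b′)) (trans (cong ((2 * B) ^_) (*-comm 3b (2 * b′))) (trans (sym (^-*-assoc (2 * B) (2 * b′) 3b))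
        (trans (cong (_^ 3b) (trans (sym (^-*-assoc (2 * B) 2 b′)) (trans (cong (_^ b′) (square B)) (trans (*-^ (B * B) 4 b′) (cong (_* 4 ^ b′) (*-^ B B b′))))))
          (*-^ (B ^ b′ * B ^ b′) Y 3b))))

    power-surplus : ∀ a m (β² : ℕ) (s : ℚ) (x : ℕ) → 0ℚ ℚ.≤ s → ι β² ℚ.≤ s ℚ.* ι E →
      m ^ (2 * suc b′) ≤ β² ^ x * Y ^ x * m ^ (3 * a) →
      (frac 1 cd ^ℚ x) ℚ.* (ι m ^ℚ (2 * suc b′)) ℚ.≤ (s ^ℚ x) ℚ.* (ι m ^ℚ (3 * a))
    power-surplus a m β² s x s≥0 hs hm = begin
      cˣ ℚ.* (ι m ^ℚ (2 * suc b′)) ≡⟨ cong (λ w → cˣ ℚ.* w) (sym (ι-^ m (2 * suc b′))) ⟩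
      cˣ ℚ.* ι (m ^ (2 * suc b′)) ≤⟨ *-monoʳℚ cˣ cˣ≥0 (ι-mono hm) ⟩
      cˣ ℚ.* ι (β² ^ x * Y ^ x * m ^ (3 * a)) ≡⟨ cong (λ w → cˣ ℚ.* w) (trans (ι-* (β² ^ x * Y ^ x) _) (cong₂ ℚ._*_ (trans (ι-* (β² ^ x) _) (cong₂ ℚ._*_ (ι-^ β² x) (ι-^ Y x))) (ι-^ m (3 * a)))) ⟩
      cˣ ℚ.* ((ι β² ^ℚ x) ℚ.* (ι Y ^ℚ x) ℚ.* μ)
        ≤⟨ *-monoʳℚ cˣ cˣ≥0 (ℚP.*-monoʳ-≤-nonNeg μ {{ℚ.nonNegative μ≥0}} (ℚP.*-monoʳ-≤-nonNeg (ι Y ^ℚ x) {{ℚ.nonNegative (^ℚ-nonneg (ι Y) x (0≤ι Y))}} (^ℚ-mono x (0≤ι β²) hs))) ⟩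
      cˣ ℚ.* (((s ℚ.* ι E) ^ℚ x) ℚ.* (ι Y ^ℚ x) ℚ.* μ) ≡⟨ sym (ℚP.*-assoc cˣ _ μ) ⟩
      cˣ ℚ.* (((s ℚ.* ι E) ^ℚ x) ℚ.* (ι Y ^ℚ x)) ℚ.* μ
        ≡⟨ cong (ℚ._* μ) (trans (cong (λ w → cˣ ℚ.* w) (sym (*-^ℚ (s ℚ.* ι E) (ι Y) x))) (trans (sym (*-^ℚ (frac 1 cd) (s ℚ.* ι E ℚ.* ι Y) x)) (cong (_^ℚ x) cancel))) ⟩
      (s ^ℚ x) ℚ.* μ ∎
      where
      open ℚP.≤-Reasoning
      cˣ μ : ℚ
      cˣ = frac 1 cd ^ℚ x
      μ = ι m ^ℚ (3 * a)
      μ≥0 : 0ℚ ℚ.≤ μ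
      μ≥0 = ^ℚ-nonneg (ι m) (3 * a) (0≤ι m)
      cancel : frac 1 cd ℚ.* (s ℚ.* ι E ℚ.* ι Y) ≡ s
      cancel = trans (cong (λ w → frac 1 cd ℚ.* w) (trans (ℚP.*-assoc s (ι E) (ι Y)) (trans (cong (λ w → s ℚ.* w) (sym (ι-* E Y))) (ℚP.*-comm s (ι cd)))))
        (trans (sym (ℚP.*-assoc (frac 1 cd) (ι cd) s)) (trans (cong (ℚ._* s) (frac-ι 1 cd 1≤cd)) (ℚP.*-identityˡ s)))
      cˣ≥0 : 0ℚ ℚ.≤ cˣ
      cˣ≥0 = ^ℚ-nonneg (frac 1 cd) x (ℚP.<⇒≤ (frac-pos cd 1≤cd))

numerator≥1 : (ε : ℚ) → 0ℚ < ε → 1 ≤ ℤ.∣ ℚ.↥ ε ∣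
numerator≥1 ε h = n≢0⇒n>0 (λ e → ℚP.<-irrefl (sym (ℚP.↥p≡0⇒p≡0 ε (ℤP.∣i∣≡0⇒i≡0 e))) h)

theorem7p7 : (ε : ℚ) → 0ℚ < ε →
    ∃[ q ] (1 ≤ q ×
    ((k : ℕ) → ∃[ c ] (0ℚ < c ×
    ((r : ℕ) → 2 ≤ r → r + q ≤ k →
    (H : Hypergraph k) → 1 ≤ numEdges H →
    ∃[ f ] AtLeastPow (surplus {k} {r} H f) c ε (numEdges H)))))
theorem7p7 ε 0<ε = q , 1≤q , λ k → frac 1 (cd k) , frac-pos (cd k) (1≤cd k) , claim k
  where
  b′ : ℕ
  b′ = ℚ.denominator-1 ε
  open Final b′
  1≤q : 1 ≤ q
  1≤q = *-mono-≤ {1} {4} (s≤s z≤n) (*-mono-≤ {1} {2} (s≤s z≤n) (m^n>0 4 (3 * suc b′)))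
  claim : ∀ k r → 2 ≤ r → r + q ≤ k → (H : Hypergraph k) → 1 ≤ numEdges H →
    ∃[ f ] AtLeastPow (surplus {k} {r} H f) (frac 1 (cd k)) ε (numEdges H)
  claim k (suc (suc r)) (s≤s (s≤s _)) r+q≤k H 1≤m =
    -- `root-bounds` takes the predecessor of the exponent: `suc (b′ + 2 * suc b′)` is `3 * suc b′`.
    let (B , 1≤B , lo , hi) = root-bounds (b′ + 2 * suc b′) (numEdges H) 1≤m
        (f , s≥0 , hs) = best-surplus k r r+q≤k H B 1≤B lo hi
    in f , s≥0 , power-surplus k ℤ.∣ ℚ.↥ ε ∣ (numEdges H) (B ^ b′ * B ^ b′) (surplus {k} {2 + r} H f) (3 * suc b′) s≥0 hs
         (power-bound k ℤ.∣ ℚ.↥ ε ∣ (numEdges H) B (numerator≥1 ε 0<ε) hi 1≤m)
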